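{- The maps $R\colon Sig\to FIC$ and $S\colon FIC\to Sig$ described in the context are mutually inverse, and hence define a bijection $Sig\cong FIC$ between isomorphism classes of well-formed signatures of $TT_{Sig}$ and isomorphism classes of finite inverse categories. (In particular, for every finite inverse category $\mathcal L$, the signature $S(\mathcal L)$ is derivable in $TT_{Sig}$.)
   Context: Fix disjoint countably infinite sets $Var$ (variables) and $SN$ (sort names), with the ability to choose fresh elements. The type theory $TT_{Sig}$ has: signatures $\Psi ::= \bullet \mid \Psi, A\colon\Gamma$ ($A\in SN$); contexts $\Gamma ::= \bullet\mid \Gamma, x\colon X$ ($x\in Var$); substitutions $\sigma ::= \epsilon\mid(\sigma,t)$; terms are variables; sorts are $A\,\sigma$ with $A\in SN$. Write $|\Gamma|$ for the set of variables of $\Gamma$; for a substitution $\sigma\colon\Gamma\Rightarrow\Delta$ let $[\![\sigma]\!]\colon|\Delta|\to|\Gamma|$ be given by $[\![\epsilon]\!]=\varnothing$, $[\![\sigma,z]\!](y)=[\![\sigma]\!](y)$ for $y\in|\Delta|$ and $[\![\sigma,z]\!](x)=z$ where $x$ is the last variable of the target context. Composition: $\sigma\cdot\epsilon=\epsilon$, $\sigma\cdot(\tau,z)=(\sigma\cdot\tau,[\![\sigma]\!](z))$; action on sorts: $\sigma(A\,\tau)=A\,(\sigma\cdot\tau)$. Rules: (sig_empty) $\bullet\vdash$. (sig_ext) from $\Psi\vdash$, $\Psi;\Gamma\vdash$, and $A$ not already declared in $\Psi$, infer $\Psi,A\colon\Gamma\vdash$. (ctx_empty) $\Psi;\bullet\vdash$.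 (ctx_ext) from $\Psi;\Gamma\vdash$, $\Psi;\Gamma\vdash X$, and $x$ not declared in $\Gamma$, infer $\Psi;\Gamma,x\colon X\vdash$. (sub_empty) $\Psi\vdash\epsilon\colon\Gamma\Rightarrow\bullet$. (sub_ext) from $\Psi\vdash\sigma\colon\Gamma\Rightarrow\Delta$ and $\Psi;\Gamma\vdash z\colon\sigma(X)$ infer $\Psi\vdash(\sigma,z)\colon\Gamma\Rightarrow\Delta,x\colon X$. (type_var) from $(x\colon X)\in\Gamma$ and $\Psi;\Gamma\vdash$ infer $\Psi;\Gamma\vdash x\colon X$. (type_sort) from $(A\colon\Delta)\in\Psi$ and $\Psi\vdash\sigma\colon\Gamma\Rightarrow\Delta$ infer $\Psi;\Gamma\vdash A\,\sigma$. Congruence of contexts $\equiv$ is the equivalence relation generated by $\Gamma,x\colon X,y\colon Y,\Delta\equiv\Gamma,y\colon Y,x\colon X,\Delta$ when $x$ does not occur in $Y$ and $y$ does not occur in $X$; congruence of signatures is generated by $\Psi,A\colon\Gamma,B\colon\Delta,\Phi\equiv\Psi,B\colon\Delta,A\colon\Gamma,\Phi$ when $A$ does not occur in $\Delta$ and $B$ does not occur in $\Gamma$. Two signatures are isomorphic if they are congruent or $\alpha$-equivalent (consistent renaming of bound variables/sort names). $Sig$ is the set of isomorphism classes of derivable signatures ($\Psi\vdash$). A finite inverse category (fic) is a category with finitely many morphisms, skeletal, with no non-identity endomorphisms. $FIC$ is the set of isomorphism classes of fics, represented by fics whose objects lie in $SN$, whose non-identity morphisms are (distinct) elements of $Var$,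 and whose identities are written $1_K$. For an object $K$, $K\downarrow\mathcal L$ denotes the set of non-identity morphisms with domain $K$, and for $f\colon K\to K'$, $K_f:=K'$. The map $R$: by induction on derivations, $R(\bullet)$ is the empty category; if $\Phi=\Psi,K\colon\Gamma$, then $R(\Phi)$ has objects $\mathrm{ob}\,R(\Psi)\amalg\{K\}$, hom-sets $R(\Phi)(X,Y)=R(\Psi)(X,Y)$ for $X,Y\neq K$, $R(\Phi)(K,K)=\{1_K\}$, $R(\Phi)(X,K)=\varnothing$ for $X\neq K$, and $R(\Phi)(K,Y)=|\Gamma|_Y$ := the set of variables $y$ of $\Gamma$ whose declared sort has sort name $Y$. Composition is that of $R(\Psi)$ away from $K$, identities act as identities, and for $f\in|\Gamma|_Y$ declared as $f\colon Y\,\sigma$ (so $(Y\colon\Delta)\in\Psi$, $\sigma\colon\Gamma\Rightarrow\Delta$) and $g\colon Y\to Z$ (a variable $g\in|\Delta|$), $g\circ f:=[\![\sigma]\!](g)$. The map $S$: given a fic $\mathcal L$, choose a linear order on objects such that whenever there is a non-identity $f\colon K'\to K$, $K$ precedes $K'$, and for each object $K$ a linear order on $K\downarrow\mathcal L$ such that $g\circ f$ precedes $f$ for non-identity $g$. For $K$ with $K\downarrow\mathcal L=(f_1,\dots,f_n)$ in order, and $K\downarrow\mathcal L$-orders $(p_{i1},\dots,p_{im_i})$ of $K_{f_i}\downarrow\mathcal L$, let $T_K$ be the context $(f_1\colon K_{f_1}(p_{11}\circ f_1,\dots,p_{1m_1}\circ f_1),\dots,f_n\colon K_{f_n}(p_{n1}\circ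 f_n,\dots,p_{nm_n}\circ f_n))$. Then $S(\mathcal L)$ is the signature $K_1\colon T_{K_1},\dots,K_N\colon T_{K_N}$ with the objects listed in the chosen order (and $S$ of the empty category is $\bullet$).
   Formalization: Isomorphism of signatures also includes congruence of the declared contexts (swapping independent variables, with the matching permutation of arguments in later sorts); without it R would not be injective on classes and S would depend on the chosen orders. -}

module Defs where

open import Data.Nat using (ℕ; zero; suc; _≡ᵇ_; _≟_)
open import Data.Bool using (Bool; true; false; if_then_else_)
open import Data.Product using (Σ; ∃₂; _×_; _,_; proj₁; proj₂)
open import Data.List using (List; []; _∷_; _++_; map; concatMap; filter; length)
open import Data.Maybe using (Maybe; just; nothing; _>>=_; fromMaybe)
open import Data.List.Membership.Propositional using (_∈_; _∉_)
open import Data.List.Relation.Unary.Unique.Propositional using (Unique)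
open import Data.List.Relation.Binary.Permutation.Propositional using (_↭_)
open import Relation.Binary.PropositionalEquality using (_≡_)
open import Relation.Binary.Construct.Closure.Equivalence using (EqClosure)

-- Names.  Var and SN are two countably infinite sets with decidable
-- equality (freshness is available since they are ℕ).  They are kept
-- apart by their roles (they never appear in the same position).

Var : Set
Var = ℕ

SN : Set
SN = ℕ

-- substitutions  σ ::= ε | (σ , t)   (terms are variables)
data Sub : Set where
  ε    : Sub
  _,ₛ_ : Sub → Var → Sub

record Sort : Set where
  constructor _⟨_⟩
  field
    name : SN
    args : Sub
open Sort public

data Ctx : Set where
  •     : Ctx
  _▸_∶_ : Ctx → Var → Sort → Ctx

data Sig : Set where
  •ˢ     : Sig
  _▸ˢ_∶_ : Sig → SN → Ctx → Sig

subList : Sub → List Var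
subList ε        = []
subList (σ ,ₛ z) = subList σ ++ (z ∷ [])

subFromList : List Var → Sub
subFromList = go ε
  where
  go : Sub → List Var → Sub
  go σ []       = σ
  go σ (z ∷ zs) = go (σ ,ₛ z) zs

ctxList : Ctx → List (Var × Sort)
ctxList •           = []
ctxList (Γ ▸ x ∶ X) = ctxList Γ ++ ((x , X) ∷ [])

ctxFromList : List (Var × Sort) → Ctx
ctxFromList = go •
  where
  go : Ctx → List (Var × Sort) → Ctx
  go Γ []             = Γ
  go Γ ((x , X) ∷ xs) = go (Γ ▸ x ∶ X) xs

sigList : Sig → List (SN × Ctx)
sigList •ˢ           = []
sigList (Ψ ▸ˢ A ∶ Γ) = sigList Ψ ++ ((A , Γ) ∷ [])

sigFromList : List (SN × Ctx) → Sig
sigFromList = go •ˢ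
  where
  go : Sig → List (SN × Ctx) → Sig
  go Ψ []             = Ψ
  go Ψ ((A , Γ) ∷ xs) = go (Ψ ▸ˢ A ∶ Γ) xs

_++ᶜ_ : Ctx → Ctx → Ctx
Γ ++ᶜ •           = Γ
Γ ++ᶜ (Δ ▸ x ∶ X) = (Γ ++ᶜ Δ) ▸ x ∶ X

_++ˢ_ : Sig → Sig → Sig
Ψ ++ˢ •ˢ           = Ψ
Ψ ++ˢ (Φ ▸ˢ A ∶ Γ) = (Ψ ++ˢ Φ) ▸ˢ A ∶ Γ

ctxLen : Ctx → ℕ
ctxLen Γ = length (ctxList Γ)

ctxVars : Ctx → List Var
ctxVars Γ = map proj₁ (ctxList Γ)

sigNames : Sig → List SN
sigNames Ψ = map proj₁ (sigList Ψ)

sortVars : Sort → List Var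
sortVars X = subList (args X)

ctxAllVars : Ctx → List Var
ctxAllVars Γ = concatMap (λ p → proj₁ p ∷ sortVars (proj₂ p)) (ctxList Γ)

ctxSNs : Ctx → List SN
ctxSNs Γ = map (λ p → name (proj₂ p)) (ctxList Γ)

sigAllSNs : Sig → List SN
sigAllSNs Ψ = concatMap (λ p → proj₁ p ∷ ctxSNs (proj₂ p)) (sigList Ψ)

-- ⟦ σ ⟧ Δ : |Δ| → |Γ|  for σ : Γ ⇒ Δ  (partial: nothing outside |Δ|)
⟦_⟧ : Sub → Ctx → Var → Maybe Var
⟦ σ ,ₛ z ⟧ (Δ ▸ x ∶ X) y = if x ≡ᵇ y then just z else ⟦ σ ⟧ Δ y
⟦ _ ⟧ _ _ = nothing

-- σ · τ, where Δ is the target context of σ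
compSub : Ctx → Sub → Sub → Maybe Sub
compSub Δ σ ε        = just ε
compSub Δ σ (τ ,ₛ z) = compSub Δ σ τ >>= λ ρ → ⟦ σ ⟧ Δ z >>= λ w → just (ρ ,ₛ w)

-- σ (A τ) = A (σ · τ), where Δ is the target context of σ
actSort : Ctx → Sub → Sort → Maybe Sort
actSort Δ σ (A ⟨ τ ⟩) = compSub Δ σ τ >>= λ ρ → just (A ⟨ ρ ⟩)

mutual
  data SigOK : Sig → Set where
    sig-empty : SigOK •ˢ
    sig-ext   : ∀ {Ψ Γ A} → SigOK Ψ → CtxOK Ψ Γ → A ∉ sigNames Ψ →
                SigOK (Ψ ▸ˢ A ∶ Γ)

  data CtxOK : Sig → Ctx → Set where
    ctx-empty : ∀ {Ψ} → CtxOK Ψ •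
    ctx-ext   : ∀ {Ψ Γ X x} → CtxOK Ψ Γ → SortOK Ψ Γ X → x ∉ ctxVars Γ →
                CtxOK Ψ (Γ ▸ x ∶ X)

  data SubOK : Sig → Ctx → Sub → Ctx → Set where
    sub-empty : ∀ {Ψ Γ} → SubOK Ψ Γ ε •
    sub-ext   : ∀ {Ψ Γ Δ σ z x X Y} → SubOK Ψ Γ σ Δ →
                actSort Δ σ X ≡ just Y → TmOK Ψ Γ z Y →
                SubOK Ψ Γ (σ ,ₛ z) (Δ ▸ x ∶ X)

  data TmOK : Sig → Ctx → Var → Sort → Set where
    type-var : ∀ {Ψ Γ x X} → (x , X) ∈ ctxList Γ → CtxOK Ψ Γ → TmOK Ψ Γ x X

  data SortOK : Sig → Ctx → Sort → Set where
    type-sort : ∀ {Ψ Γ Δ A σ} → (A , Δ) ∈ sigList Ψ → SubOK Ψ Γ σ Δ →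
                SortOK Ψ Γ (A ⟨ σ ⟩)

swapAt : {A : Set} → ℕ → List A → List A
swapAt zero    (a ∷ b ∷ r) = b ∷ a ∷ r
swapAt (suc n) (a ∷ r)     = a ∷ swapAt n r
swapAt _       xs          = xs

swapArgsSort : SN → ℕ → Sort → Sort
swapArgsSort K n (C ⟨ σ ⟩) =
  if C ≡ᵇ K then C ⟨ subFromList (swapAt n (subList σ)) ⟩ else C ⟨ σ ⟩

swapArgsCtx : SN → ℕ → Ctx → Ctx
swapArgsCtx K n •           = •
swapArgsCtx K n (Γ ▸ x ∶ X) = swapArgsCtx K n Γ ▸ x ∶ swapArgsSort K n X

swapArgsSig : SN → ℕ → Sig → Sig
swapArgsSig K n •ˢ           = •ˢ
swapArgsSig K n (Ψ ▸ˢ A ∶ Γ) = swapArgsSig K n Ψ ▸ˢ A ∶ swapArgsCtx K n Γ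

renSN : SN → SN → SN → SN
renSN A B C = if C ≡ᵇ A then B else C

renSNCtx : SN → SN → Ctx → Ctx
renSNCtx A B •                   = •
renSNCtx A B (Γ ▸ x ∶ (C ⟨ σ ⟩)) = renSNCtx A B Γ ▸ x ∶ (renSN A B C ⟨ σ ⟩)

renSNSig : SN → SN → Sig → Sig
renSNSig A B •ˢ           = •ˢ
renSNSig A B (Ψ ▸ˢ C ∶ Γ) = renSNSig A B Ψ ▸ˢ renSN A B C ∶ renSNCtx A B Γ

renV : Var → Var → Var → Var
renV x y z = if z ≡ᵇ x then y else z

renVSub : Var → Var → Sub → Sub
renVSub x y ε        = ε
renVSub x y (σ ,ₛ z) = renVSub x y σ ,ₛ renV x y z

renVCtx : Var → Var → Ctx → Ctx
renVCtx x y •                   = •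
renVCtx x y (Γ ▸ z ∶ (C ⟨ σ ⟩)) = renVCtx x y Γ ▸ renV x y z ∶ (C ⟨ renVSub x y σ ⟩)

data SigStep : Sig → Sig → Set where
  sig-swap : ∀ {Ψ Φ A B Γ Δ} → A ∉ ctxSNs Δ → B ∉ ctxSNs Γ →
             SigStep (((Ψ ▸ˢ A ∶ Γ) ▸ˢ B ∶ Δ) ++ˢ Φ)
                     (((Ψ ▸ˢ B ∶ Δ) ▸ˢ A ∶ Γ) ++ˢ Φ)
  -- congruence of a declared context (with the corresponding
  -- permutation of the arguments of the sorts K σ using it)
  ctx-swap : ∀ {Ψ Φ K Γ Δ x y X Y} → x ∉ sortVars Y → y ∉ sortVars X →
             SigStep ((Ψ ▸ˢ K ∶ (((Γ ▸ x ∶ X) ▸ y ∶ Y) ++ᶜ Δ)) ++ˢ Φ)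
                     ((Ψ ▸ˢ K ∶ (((Γ ▸ y ∶ Y) ▸ x ∶ X) ++ᶜ Δ)) ++ˢ
                        swapArgsSig K (ctxLen Γ) Φ)
  α-sn     : ∀ {Ψ A B} → B ∉ sigAllSNs Ψ → SigStep Ψ (renSNSig A B Ψ)
  α-var    : ∀ {Ψ Φ K Γ x y} → y ∉ ctxAllVars Γ →
             SigStep ((Ψ ▸ˢ K ∶ Γ) ++ˢ Φ) ((Ψ ▸ˢ K ∶ renVCtx x y Γ) ++ˢ Φ)

_≅ˢ_ : Sig → Sig → Set
_≅ˢ_ = EqClosure SigStep

-- Finite categories presented with objects in SN.
-- Morphisms: identities 1_K, and non-identity morphisms  arr K f
-- (domain K, name f ∈ Var; names distinct among morphisms of the same
-- domain).

data Arr : Set where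
  idA : SN → Arr
  arr : SN → Var → Arr

record FinCatData : Set where
  field
    objs : List SN
    mors : List (SN × Var × SN)   -- (domain , name , codomain)
    comp : Arr → Arr → Arr        -- comp g f = g ∘ f
open FinCatData public

data Hom (C : FinCatData) : Arr → SN → SN → Set where
  hom-id  : ∀ {K} → K ∈ objs C → Hom C (idA K) K K
  hom-arr : ∀ {K f K'} → (K , f , K') ∈ mors C → Hom C (arr K f) K K'

record IsCategory (C : FinCatData) : Set where
  field
    objs-unique : Unique (objs C)
    mors-unique : Unique (map (λ m → proj₁ m , proj₁ (proj₂ m)) (mors C))
    mors-dom    : ∀ {K f K'} → (K , f , K') ∈ mors C → K ∈ objs C
    mors-cod    : ∀ {K f K'} → (K , f , K') ∈ mors C → K' ∈ objs C
    comp-hom    : ∀ {f g X Y Z} → Hom C f X Y → Hom C g Y Z →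
                  Hom C (comp C g f) X Z
    id-left     : ∀ {f X Y} → Hom C f X Y → comp C (idA Y) f ≡ f
    id-right    : ∀ {f X Y} → Hom C f X Y → comp C f (idA X) ≡ f
    assoc       : ∀ {f g h W X Y Z} → Hom C f W X → Hom C g X Y →
                  Hom C h Y Z → comp C h (comp C g f) ≡ comp C (comp C h g) f

-- finite inverse category: finite (automatic), skeletal, no non-identity
-- endomorphisms
record IsFIC (C : FinCatData) : Set where
  field
    isCategory : IsCategory C
    skeletal   : ∀ {f g X Y} → Hom C f X Y → Hom C g Y X →
                 comp C g f ≡ idA X → comp C f g ≡ idA Y → X ≡ Y
    noEndo     : ∀ {a X} → Hom C a X X → a ≡ idA X

record _≅ᶜ_ (C D : FinCatData) : Set where
  field
    Fo   : SN → SN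
    Fm   : Arr → Arr
    Go   : SN → SN
    Gm   : Arr → Arr
    F-hom  : ∀ {a X Y} → Hom C a X Y → Hom D (Fm a) (Fo X) (Fo Y)
    F-id   : ∀ {X} → X ∈ objs C → Fm (idA X) ≡ idA (Fo X)
    F-comp : ∀ {f g X Y Z} → Hom C f X Y → Hom C g Y Z →
             Fm (comp C g f) ≡ comp D (Fm g) (Fm f)
    G-hom  : ∀ {a X Y} → Hom D a X Y → Hom C (Gm a) (Go X) (Go Y)
    G-id   : ∀ {X} → X ∈ objs D → Gm (idA X) ≡ idA (Go X)
    G-comp : ∀ {f g X Y Z} → Hom D f X Y → Hom D g Y Z →
             Gm (comp D g f) ≡ comp C (Gm g) (Gm f)
    GF-obj : ∀ {X} → X ∈ objs C → Go (Fo X) ≡ X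
    GF-arr : ∀ {a X Y} → Hom C a X Y → Gm (Fm a) ≡ a
    FG-obj : ∀ {X} → X ∈ objs D → Fo (Go X) ≡ X
    FG-arr : ∀ {a X Y} → Hom D a X Y → Fm (Gm a) ≡ a

lookupSig : SN → Sig → Maybe Ctx
lookupSig K •ˢ           = nothing
lookupSig K (Ψ ▸ˢ A ∶ Γ) = if A ≡ᵇ K then just Γ else lookupSig K Ψ

lookupCtx : Var → Ctx → Maybe Sort
lookupCtx y •           = nothing
lookupCtx y (Γ ▸ x ∶ X) = if x ≡ᵇ y then just X else lookupCtx y Γ

-- g ∘ f for f ∈ |Γ|, f : Y σ declared in the context Γ of K, g ∈ |Δ|
-- where (Y : Δ) ∈ Ψ :  g ∘ f = ⟦σ⟧(g)
R-comp : Sig → Arr → Arr → Arr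
R-comp Ψ (idA _)   a         = a
R-comp Ψ (arr Y g) (idA _)   = arr Y g
R-comp Ψ (arr Y g) (arr K f) =
  fromMaybe (idA K)
    (lookupSig K Ψ >>= λ Γ →
     lookupCtx f Γ >>= λ X →
     lookupSig (name X) Ψ >>= λ Δ →
     ⟦ args X ⟧ Δ g >>= λ z → just (arr K z))

R : Sig → FinCatData
R Ψ = record
  { objs = sigNames Ψ
  ; mors = concatMap (λ d → map (λ p → proj₁ d , proj₁ p , name (proj₂ p))
                                (ctxList (proj₂ d)))
                     (sigList Ψ)
  ; comp = R-comp Ψ
  }

Precedes : {A : Set} → List A → A → A → Set
Precedes xs a b = ∃₂ λ ys zs → (xs ≡ ys ++ zs) × (a ∈ ys) × (b ∈ zs)

outNames : FinCatData → SN → List Var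
outNames C K = map (λ m → proj₁ (proj₂ m)) (filter (λ m → proj₁ m ≟ K) (mors C))

record Choice (C : FinCatData) : Set where
  field
    objOrder      : List SN
    objOrder-perm : objOrder ↭ objs C
    objOrder-ok   : ∀ {K K' f} → Hom C (arr K' f) K' K → Precedes objOrder K K'
    morOrder      : SN → List Var
    morOrder-perm : ∀ {K} → K ∈ objs C → morOrder K ↭ outNames C K
    morOrder-ok   : ∀ {K f Y g Z h} → Hom C (arr K f) K Y → Hom C (arr Y g) Y Z →
                    comp C (arr Y g) (arr K f) ≡ arr K h → Precedes (morOrder K) h f
open Choice public

codOf : FinCatData → SN → Var → SN
codOf C K f = go (mors C)
  where
  go : List (SN × Var × SN) → SN
  go []                  = K
  go ((K₀ , f₀ , K₁) ∷ ms) = if (K₀ ≡ᵇ K) Data.Bool.∧ (f₀ ≡ᵇ f) then K₁ else go ms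

nameOf : Arr → Var
nameOf (arr _ h) = h
nameOf (idA _)   = 0

T : (C : FinCatData) → Choice C → SN → Ctx
T C ch K = ctxFromList (map decl (morOrder ch K))
  where
  decl : Var → Var × Sort
  decl f = f , (codOf C K f ⟨ subFromList
                  (map (λ p → nameOf (comp C (arr (codOf C K f) p) (arr K f)))
                       (morOrder ch (codOf C K f))) ⟩)

S : (C : FinCatData) → Choice C → Sig
S C ch = sigFromList (map (λ K → K , T C ch K) (objOrder ch))

{-# OPTIONS --safe #-}
module Submission where

-- Every well-formed signature Ψ is literally S (R Ψ) c for c the order of declaration, so
-- all questions about signatures become questions about finite inverse categories with
-- chosen orders.  Exchanging two incomparable neighbours in such an order is exactly a
-- swap step on the signature, and any two linear extensions of a finite strict order are
-- connected by such exchanges; hence S does not depend on the orders.  An isomorphism of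
-- categories transports orders, and the two signatures then differ by a renaming that is
-- injective on the names in use, which decomposes into single fresh renamings.
-- Conversely, each step takes Ψ = S (R Ψ) c to some S L c′ with L ≅ R Ψ (L = R Ψ for swaps,
-- a relabelling of R Ψ by a transposition for α-steps), and S L c′ is well formed with
-- R (S L c′) ≅ L.

open import Defs
open import Data.Bool using (true; false; if_then_else_)
open import Data.Empty using (⊥-elim)
open import Data.List using (List; []; _∷_; _++_; _∷ʳ_; map; foldl; concatMap; filter; length)
open import Data.List.Membership.Propositional using (_∈_; _∉_; find; lose)
open import Data.List.Membership.Propositional.Properties using (∈-++⁺ˡ; ∈-++⁺ʳ; ∈-++⁻; ∈-map⁺; ∈-map⁻; ∈-∃++; ∈-filter⁺; ∈-filter⁻; ∈-concatMap⁺; ∈-concatMap⁻; ∈-insert)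
open import Data.List.Properties using (foldl-∷ʳ; map-++; map-∘; map-cong; map-id; ++-assoc; ++-identityʳ; ∷-injectiveˡ; ∷-injectiveʳ; length-map; map-concatMap; concatMap-map; concatMap-cong)
import Data.List.Relation.Binary.Permutation.Propositional as ↭
open import Data.List.Relation.Binary.Permutation.Propositional using (_↭_; ↭-refl; ↭-sym; ↭-trans; ↭-reflexive; prep; swap)
open import Data.List.Relation.Binary.Permutation.Propositional.Properties using (∈-resp-↭; All-resp-↭; shift; drop-mid; ++⁺ˡ; ↭-empty-inv)
open import Data.List.Relation.Unary.All as All using (All; []; _∷_)
open import Data.List.Relation.Unary.All.Properties using (¬Any⇒All¬; All¬⇒¬Any)
open import Data.List.Relation.Unary.AllPairs using (AllPairs; []; _∷_)
open import Data.List.Relation.Unary.Any using (Any; here; there; any?)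
open import Data.List.Relation.Unary.Unique.Propositional using (Unique)
import Data.List.Relation.Unary.Unique.Propositional.Properties as Uniqueₚ
open import Data.List.Reverse using (Reverse; reverseView; []; _∶_∶ʳ_)
open import Data.Maybe using (just; _>>=_; fromMaybe)
open import Data.Maybe.Properties using (just-injective)
open import Data.Nat using (ℕ; zero; suc; _≡ᵇ_; _≟_; _+_; _∸_; _<_; _≤_; s≤s)
open import Data.Nat.Properties using (≡ᵇ⇒≡; ≡⇒≡ᵇ; <⇒≱; m≤n+m; m≤m+n; m+n∸n≡m; +-cancelʳ-≡; ≤-trans)
open import Data.Product using (∃; ∃₂; _×_; _,_; proj₁; proj₂)
open import Data.Product.Properties using (≡-dec)
open import Data.Sum using (_⊎_; inj₁; inj₂; [_,_]′)
open import Data.Unit using (tt)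
open import Function using (_∘_; id)
open import Relation.Binary.Construct.Closure.ReflexiveTransitive as Star using (Star; _◅_; _◅◅_) renaming (ε to nil)
open import Relation.Binary.Construct.Closure.Symmetric using (fwd; bwd)
open import Relation.Binary.PropositionalEquality using (_≡_; _≢_; refl; sym; trans; cong; cong₂; subst; subst₂; module ≡-Reasoning)
open import Relation.Nullary using (¬_; Dec; yes; no)
open import Relation.Nullary.Decidable using (map′; _×-dec_)

-- `_≅ˢ_` is generated on raw signatures and its steps may be taken backwards, so a chain between
-- two derivable signatures comes with no derivations in between. Invariance of `R` therefore has to
-- carry derivability through every step, in both directions. Working on derivations would mean
-- following each permutation of variables through all later sorts. The form `Sᵖ o m` avoids this:
-- the arguments of a sort over `K` are the list `m K` composed with one morphism, so a change of
-- `m K` permutes them everywhere at once. Composition in `FinCatData` is a total function on `Arr`,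
-- constrained only on composable pairs. Dummy values, such as the default `0` of `nameOf`, are kept
-- out by one fact: in a finite inverse category a composite of non-identities is never an identity.

if-≡ : ∀ {B : Set} {x y : ℕ} {b c : B} → x ≡ y → (if x ≡ᵇ y then b else c) ≡ b
if-≡ {x = x} {y} x≡y with x ≡ᵇ y | ≡⇒≡ᵇ x y x≡y
... | true | _ = refl

if-≢ : ∀ {B : Set} {x y : ℕ} {b c : B} → x ≢ y → (if x ≡ᵇ y then b else c) ≡ c
if-≢ {x = x} {y} x≢y with x ≡ᵇ y | ≡ᵇ⇒≡ x y
... | true  | x≡y = ⊥-elim (x≢y (x≡y tt))
... | false | _   = refl

-- Lists without repetitions, membership and permutations

map-cong-∈ : ∀ {A B : Set} {f g : A → B} xs → (∀ {x} → x ∈ xs → f x ≡ g x) → map f xs ≡ map g xs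
map-cong-∈ []       f≗g = refl
map-cong-∈ (x ∷ xs) f≗g = cong₂ _∷_ (f≗g (here refl)) (map-cong-∈ xs (f≗g ∘ there))

∈-∷ʳ⁻ : ∀ {A : Set} xs {x y : A} → y ∈ xs ∷ʳ x → y ∈ xs ⊎ y ≡ x
∈-∷ʳ⁻ xs y∈ with ∈-++⁻ xs y∈
... | inj₁ p        = inj₁ p
... | inj₂ (here p) = inj₂ p

∈-∷ʳ⁺ : ∀ {A : Set} xs {x : A} → x ∈ xs ∷ʳ x
∈-∷ʳ⁺ xs = ∈-++⁺ʳ xs (here refl)

unique-resp-↭ : ∀ {A : Set} {xs ys : List A} → xs ↭ ys → Unique xs → Unique ys
unique-resp-↭ ↭.refl         u                   = u
unique-resp-↭ (prep x p)     (a ∷ u)             = All-resp-↭ p a ∷ unique-resp-↭ p u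
unique-resp-↭ (swap x y p)   ((n ∷ a) ∷ b ∷ u)   = ((n ∘ sym) ∷ All-resp-↭ p b) ∷ All-resp-↭ p a ∷ unique-resp-↭ p u
unique-resp-↭ (↭.trans p q)  u                   = unique-resp-↭ q (unique-resp-↭ p u)

unique-∷ʳ⁺ : ∀ {A : Set} {xs} {x : A} → Unique xs → x ∉ xs → Unique (xs ∷ʳ x)
unique-∷ʳ⁺ {xs = xs} {x} u x∉ = unique-resp-↭
  (↭-sym (↭-trans (shift x xs []) (↭-reflexive (cong (x ∷_) (++-identityʳ xs)))))
  (¬Any⇒All¬ xs x∉ ∷ u)

unique-mid⁻ : ∀ {A : Set} xs {ys} {x : A} → Unique (xs ++ x ∷ ys) → Unique (xs ++ ys) × x ∉ xs ++ ys
unique-mid⁻ xs {ys} {x} u with unique-resp-↭ (shift x xs ys) u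
... | a ∷ u′ = u′ , All¬⇒¬Any a

-- Lets the permutation fields of a `Choice` be checked on membership alone, without following the
-- order in which `filter` and `concatMap` produce their lists.
unique-set⇒↭ : ∀ {A : Set} {xs ys : List A} → Unique xs → Unique ys →
               (∀ {x} → x ∈ xs → x ∈ ys) → (∀ {x} → x ∈ ys → x ∈ xs) → xs ↭ ys
unique-set⇒↭ {xs = []} {[]}    ux uy f g = ↭-refl
unique-set⇒↭ {xs = []} {y ∷ _} ux uy f g with () ← g (here refl)
unique-set⇒↭ {xs = x ∷ xs}     (ax ∷ ux) uy f g
  with us , vs , refl ← ∈-∃++ (f (here refl))
  with uy′ , x∉ ← unique-mid⁻ us uy
  = ↭-trans (prep x (unique-set⇒↭ ux uy′ to from)) (↭-sym (shift x us vs))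
  where
  to : ∀ {z} → z ∈ xs → z ∈ us ++ vs
  to z∈ with ∈-resp-↭ (shift x us vs) (f (there z∈))
  ... | here refl = ⊥-elim (All¬⇒¬Any ax z∈)
  ... | there p   = p
  from : ∀ {z} → z ∈ us ++ vs → z ∈ xs
  from z∈ with g (∈-resp-↭ (↭-sym (shift x us vs)) (there z∈))
  ... | here refl = ⊥-elim (x∉ z∈)
  ... | there p   = p

unique-map-∈ : ∀ {A B : Set} {f : A → B} {xs} → (∀ {x y} → x ∈ xs → y ∈ xs → f x ≡ f y → x ≡ y) →
               Unique xs → Unique (map f xs)
unique-map-∈ inj []      = []
unique-map-∈ {f = f} inj (a ∷ u) =
  ¬Any⇒All¬ _ (λ p → let z , z∈ , e = ∈-map⁻ f p in All.lookup a z∈ (inj (here refl) (there z∈) e))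
  ∷ unique-map-∈ (λ p q → inj (there p) (there q)) u

unique-map⇒unique : ∀ {A B : Set} {f : A → B} xs → Unique (map f xs) → Unique xs
unique-map⇒unique []       []      = []
unique-map⇒unique {f = f} (x ∷ xs) (a ∷ u) =
  ¬Any⇒All¬ _ (λ p → All¬⇒¬Any a (∈-map⁺ f p)) ∷ unique-map⇒unique xs u

unique-map-injective : ∀ {A B : Set} {f : A → B} {xs} → Unique (map f xs) →
                       ∀ {x y} → x ∈ xs → y ∈ xs → f x ≡ f y → x ≡ y
unique-map-injective         (a ∷ u) (here refl) (here refl) e = refl
unique-map-injective {f = f} (a ∷ u) (here refl) (there q)   e = ⊥-elim (All.lookup a (∈-map⁺ f q) e)
unique-map-injective {f = f} (a ∷ u) (there p) (here refl)   e = ⊥-elim (All.lookup a (∈-map⁺ f p) (sym e))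
unique-map-injective         (a ∷ u) (there p) (there q)     e = unique-map-injective u p q e

-- Linear extensions of a strict order

precedes-map : ∀ {A B : Set} (f : A → B) {xs a b} → Precedes xs a b → Precedes (map f xs) (f a) (f b)
precedes-map f (ys , zs , refl , p , q) = map f ys , map f zs , map-++ f ys zs , ∈-map⁺ f p , ∈-map⁺ f q

-- Turns an order condition into availability of a declaration: when `b` is about to be declared,
-- `us` is what has been declared so far. Uniqueness rules out that `a` merely precedes some later
-- occurrence of `b`.
precedes-prefix : ∀ {A : Set} us {vs} {a b : A} → Unique (us ++ b ∷ vs) → Precedes (us ++ b ∷ vs) a b → a ∈ us
precedes-prefix []       (n ∷ u) (_ ∷ ys , zs , refl , p , q)         = ⊥-elim (All¬⇒¬Any n (∈-++⁺ʳ ys q))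
precedes-prefix (_ ∷ us) u       (_ ∷ ys , zs , e , here refl , q)    = here (sym (∷-injectiveˡ e))
precedes-prefix (_ ∷ us) (_ ∷ u) (y ∷ ys , zs , e , there p , q)      =
  there (precedes-prefix us u (ys , zs , ∷-injectiveʳ e , p , q))

module LinearExtension {A : Set} (_≺_ : A → A → Set) where

  -- The negative, pairwise form of the order conditions of a `Choice`. Unlike `Precedes`, which
  -- speaks of a splitting of the whole list, it passes to tails and survives the removal of an
  -- element, so induction on the list applies.
  LinExt : List A → Set
  LinExt = AllPairs (λ a b → ¬ (b ≺ a))

  linExt⇒precedes : (∀ {a} → ¬ (a ≺ a)) → ∀ {xs a b} → LinExt xs → a ∈ xs → b ∈ xs → a ≺ b → Precedes xs a b
  linExt⇒precedes irr (n ∷ l) (here refl) (here refl) a≺b = ⊥-elim (irr a≺b)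
  linExt⇒precedes irr (n ∷ l) (there p)   (here refl) a≺b = ⊥-elim (All.lookup n p a≺b)
  linExt⇒precedes irr {x ∷ xs} (n ∷ l) (here refl) (there q) a≺b = x ∷ [] , xs , refl , here refl , q
  linExt⇒precedes irr {x ∷ xs} (n ∷ l) (there p) (there q) a≺b
    with ys , zs , e , p′ , q′ ← linExt⇒precedes irr l p q a≺b
    = x ∷ ys , zs , cong (x ∷_) e , there p′ , q′

  precedes⇒linExt : ∀ {xs} → Unique xs → (∀ {a b} → a ∈ xs → b ∈ xs → a ≺ b → Precedes xs a b) → LinExt xs
  precedes⇒linExt []      prec = []
  precedes⇒linExt {x ∷ xs} (n ∷ u) prec =
    All.tabulate (λ b∈ b≺x → case-[] (precedes-prefix [] (n ∷ u) (prec (there b∈) (here refl) b≺x)))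
    ∷ precedes⇒linExt u tail
    where
    case-[] : ∀ {b : A} → ¬ (b ∈ [])
    case-[] ()
    tail : ∀ {a b} → a ∈ xs → b ∈ xs → a ≺ b → Precedes xs a b
    tail a∈ b∈ a≺b with prec (there a∈) (there b∈) a≺b
    ... | _ ∷ ys , zs , refl , here refl , q = ⊥-elim (All¬⇒¬Any n a∈)
    ... | _ ∷ ys , zs , refl , there p , q   = ys , zs , refl , p , q

  linExt-before : ∀ us {u y vs} → LinExt (us ++ y ∷ vs) → u ∈ us → ¬ (y ≺ u)
  linExt-before (_ ∷ us) (n ∷ l) (here refl) = All.lookup n (∈-insert us)
  linExt-before (_ ∷ us) (n ∷ l) (there p)   = linExt-before us l p

  data Swap : List A → List A → Set where
    swap-at : ∀ us {a b vs} → ¬ (a ≺ b) → ¬ (b ≺ a) → Swap (us ++ a ∷ b ∷ vs) (us ++ b ∷ a ∷ vs)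

  swap-∷ : ∀ c {xs ys} → Swap xs ys → Swap (c ∷ xs) (c ∷ ys)
  swap-∷ c (swap-at us p q) = swap-at (c ∷ us) p q

  swap-linExt : ∀ us {a b vs} → ¬ (a ≺ b) → LinExt (us ++ a ∷ b ∷ vs) → LinExt (us ++ b ∷ a ∷ vs)
  swap-linExt []       a⊀b ((_ ∷ n) ∷ m ∷ l) = (a⊀b ∷ m) ∷ n ∷ l
  swap-linExt (u ∷ us) a⊀b (n ∷ l) = All-resp-↭ (++⁺ˡ us (swap _ _ ↭-refl)) n ∷ swap-linExt us a⊀b l

  -- `y` passes the elements of `us` one by one. Each `u` is incomparable with it: `u` is not below
  -- `y` by assumption, and `y` is not below `u` because `u` comes earlier in a linear extension.
  move-front : ∀ {y} us {vs} → All (λ u → ¬ (u ≺ y)) us → LinExt (us ++ y ∷ vs) → Star Swap (us ++ y ∷ vs) (y ∷ us ++ vs)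
  move-front []       []      l       = nil
  move-front (u ∷ us) (p ∷ ps) (n ∷ l) =
    Star.gmap (u ∷_) (swap-∷ u) (move-front us ps l) ◅◅ swap-at [] p (All.lookup n (∈-insert us)) ◅ nil

  linExt-drop : ∀ us {y vs} → LinExt (us ++ y ∷ vs) → LinExt (us ++ vs)
  linExt-drop []       (_ ∷ l) = l
  linExt-drop (u ∷ us) (n ∷ l) with _ ∷ n′ ← All-resp-↭ (shift _ us _) n = n′ ∷ linExt-drop us l

  -- The head `y` of the target can be moved to the front of `xs`: whatever stands before it there
  -- comes after it in the target, hence is not below `y`. Then the tails are treated in the same
  -- way.
  linExt-connected : ∀ {xs ys} → xs ↭ ys → LinExt xs → LinExt ys → Star Swap xs ys
  linExt-connected {xs} {[]} p lx ly with refl ← ↭-empty-inv p = nil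
  linExt-connected {xs} {y ∷ ys} p lx (n ∷ ly)
    with us , vs , refl ← ∈-∃++ (∈-resp-↭ (↭-sym p) (here refl))
    with p′ ← drop-mid us [] p
    = move-front us (All.tabulate (λ u∈ → All.lookup n (∈-resp-↭ p′ (∈-++⁺ˡ u∈)))) lx
      ◅◅ Star.gmap (y ∷_) (swap-∷ y) (linExt-connected p′ (linExt-drop us lx) ly)

  module Sorting (_≺?_ : ∀ a b → Dec (a ≺ b)) (irr : ∀ {a} → ¬ (a ≺ a))
                 (≺-trans : ∀ {a b c} → a ≺ b → b ≺ c → a ≺ c) where

    insert : A → List A → List A
    insert x []       = x ∷ []
    insert x (y ∷ ys) with x ≺? y
    ... | yes _ = x ∷ y ∷ ys
    ... | no _  = y ∷ insert x ys

    insert-↭ : ∀ x ys → insert x ys ↭ x ∷ ys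
    insert-↭ x []       = ↭-refl
    insert-↭ x (y ∷ ys) with x ≺? y
    ... | yes _ = ↭-refl
    ... | no _  = ↭-trans (prep y (insert-↭ x ys)) (swap y x ↭-refl)

    -- Stopping at the first `y` above `x` is enough by transitivity: a later `z` below `x` would be
    -- below `y` as well, although it comes after `y`.
    insert-linExt : ∀ x {ys} → LinExt ys → LinExt (insert x ys)
    insert-linExt x []                = [] ∷ []
    insert-linExt x {y ∷ ys} (n ∷ l) with x ≺? y
    ... | yes x≺y = ((λ y≺x → irr (≺-trans x≺y y≺x)) ∷ All.map (λ z⊀y z≺x → z⊀y (≺-trans z≺x x≺y)) n) ∷ n ∷ l
    ... | no x⊀y  = All-resp-↭ (↭-sym (insert-↭ x ys)) (x⊀y ∷ n) ∷ insert-linExt x l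

    sort : ∀ xs → ∃ λ ys → ys ↭ xs × LinExt ys
    sort []       = [] , ↭-refl , []
    sort (x ∷ xs) with ys , p , l ← sort xs =
      insert x ys , ↭-trans (insert-↭ x ys) (prep x p) , insert-linExt x l

-- Contexts, substitutions and signatures as lists

foldl-unique : ∀ {A B : Set} {n : B → A → B} (g : B → List A → B) → (∀ b → g b [] ≡ b) →
               (∀ b a as → g b (a ∷ as) ≡ g (n b a) as) → ∀ b as → g b as ≡ foldl n b as
foldl-unique g e c b []       = e b
foldl-unique g e c b (a ∷ as) = trans (c b a as) (foldl-unique g e c _ as)

-- The accumulator loops inside subFromList, ctxFromList, sigFromList and codOf have no name in scope; the
-- metavariables below are solved to them by the lemma of the same mutual block.
mutual
  subLoop : Sub → List Var → Sub
  subLoop = _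

  subFromList-foldl : ∀ xs → subFromList xs ≡ foldl _,ₛ_ ε xs
  -- Abstracting the start value leaves the metavariable applied to distinct variables, a pattern
  -- problem with a unique solution; applied to the constructor `ε` it would not be one.
  subFromList-foldl xs with ε
  ... | σ = foldl-unique subLoop (λ _ → refl) (λ _ _ _ → refl) σ xs

mutual
  ctxLoop : Ctx → List (Var × Sort) → Ctx
  ctxLoop = _

  ctxFromList-foldl : ∀ xs → ctxFromList xs ≡ foldl (λ Γ p → Γ ▸ proj₁ p ∶ proj₂ p) • xs
  ctxFromList-foldl xs with •
  ... | Γ = foldl-unique ctxLoop (λ _ → refl) (λ _ _ _ → refl) Γ xs

mutual
  sigLoop : Sig → List (SN × Ctx) → Sig
  sigLoop = _

  sigFromList-foldl : ∀ xs → sigFromList xs ≡ foldl (λ Ψ p → Ψ ▸ˢ proj₁ p ∶ proj₂ p) •ˢ xs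
  sigFromList-foldl xs with •ˢ
  ... | Ψ = foldl-unique sigLoop (λ _ → refl) (λ _ _ _ → refl) Ψ xs

mutual
  codLoop : FinCatData → SN → Var → List (SN × Var × SN) → SN
  codLoop = _

  codOf-loop : ∀ C K f → codOf C K f ≡ codLoop C K f (mors C)
  codOf-loop C K f with mors C
  ... | ms = refl

subFromList-∷ʳ : ∀ xs x → subFromList (xs ∷ʳ x) ≡ subFromList xs ,ₛ x
subFromList-∷ʳ xs x = trans (subFromList-foldl (xs ∷ʳ x))
  (trans (foldl-∷ʳ _,ₛ_ ε x xs) (cong (_,ₛ x) (sym (subFromList-foldl xs))))

ctxFromList-∷ʳ : ∀ xs x X → ctxFromList (xs ∷ʳ (x , X)) ≡ ctxFromList xs ▸ x ∶ X
ctxFromList-∷ʳ xs x X = trans (ctxFromList-foldl (xs ∷ʳ (x , X)))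
  (trans (foldl-∷ʳ _ • (x , X) xs) (cong (_▸ x ∶ X) (sym (ctxFromList-foldl xs))))

sigFromList-∷ʳ : ∀ xs A Γ → sigFromList (xs ∷ʳ (A , Γ)) ≡ sigFromList xs ▸ˢ A ∶ Γ
sigFromList-∷ʳ xs A Γ = trans (sigFromList-foldl (xs ∷ʳ (A , Γ)))
  (trans (foldl-∷ʳ _ •ˢ (A , Γ) xs) (cong (_▸ˢ A ∶ Γ) (sym (sigFromList-foldl xs))))

subFromList-subList : ∀ σ → subFromList (subList σ) ≡ σ
subFromList-subList ε        = refl
subFromList-subList (σ ,ₛ z) = trans (subFromList-∷ʳ (subList σ) z) (cong (_,ₛ z) (subFromList-subList σ))

ctxFromList-ctxList : ∀ Γ → ctxFromList (ctxList Γ) ≡ Γ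
ctxFromList-ctxList •           = refl
ctxFromList-ctxList (Γ ▸ x ∶ X) = trans (ctxFromList-∷ʳ (ctxList Γ) x X) (cong (_▸ x ∶ X) (ctxFromList-ctxList Γ))

sigFromList-sigList : ∀ Ψ → sigFromList (sigList Ψ) ≡ Ψ
sigFromList-sigList •ˢ           = refl
sigFromList-sigList (Ψ ▸ˢ A ∶ Γ) = trans (sigFromList-∷ʳ (sigList Ψ) A Γ) (cong (_▸ˢ A ∶ Γ) (sigFromList-sigList Ψ))

subList-subFromList : ∀ xs → subList (subFromList xs) ≡ xs
subList-subFromList xs = go (reverseView xs)
  where
  go : ∀ {xs} → Reverse xs → subList (subFromList xs) ≡ xs
  go []             = refl
  go (xs ∶ r ∶ʳ x) = trans (cong subList (subFromList-∷ʳ xs x)) (cong (_∷ʳ x) (go r))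

ctxList-ctxFromList : ∀ xs → ctxList (ctxFromList xs) ≡ xs
ctxList-ctxFromList xs = go (reverseView xs)
  where
  go : ∀ {xs} → Reverse xs → ctxList (ctxFromList xs) ≡ xs
  go []             = refl
  go (xs ∶ r ∶ʳ x) = trans (cong ctxList (ctxFromList-∷ʳ xs _ _)) (cong (_∷ʳ x) (go r))

sigList-sigFromList : ∀ xs → sigList (sigFromList xs) ≡ xs
sigList-sigFromList xs = go (reverseView xs)
  where
  go : ∀ {xs} → Reverse xs → sigList (sigFromList xs) ≡ xs
  go []             = refl
  go (xs ∶ r ∶ʳ x) = trans (cong sigList (sigFromList-∷ʳ xs _ _)) (cong (_∷ʳ x) (go r))

ctxList-++ᶜ : ∀ Γ Δ → ctxList (Γ ++ᶜ Δ) ≡ ctxList Γ ++ ctxList Δ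
ctxList-++ᶜ Γ •           = sym (++-identityʳ (ctxList Γ))
ctxList-++ᶜ Γ (Δ ▸ x ∶ X) = trans (cong (_∷ʳ (x , X)) (ctxList-++ᶜ Γ Δ)) (++-assoc (ctxList Γ) (ctxList Δ) _)

sigList-++ˢ : ∀ Ψ Φ → sigList (Ψ ++ˢ Φ) ≡ sigList Ψ ++ sigList Φ
sigList-++ˢ Ψ •ˢ           = sym (++-identityʳ (sigList Ψ))
sigList-++ˢ Ψ (Φ ▸ˢ A ∶ Γ) = trans (cong (_∷ʳ (A , Γ)) (sigList-++ˢ Ψ Φ)) (++-assoc (sigList Ψ) (sigList Φ) _)

ctxList-injective : ∀ {Γ Δ} → ctxList Γ ≡ ctxList Δ → Γ ≡ Δ
ctxList-injective {Γ} {Δ} e = trans (sym (ctxFromList-ctxList Γ)) (trans (cong ctxFromList e) (ctxFromList-ctxList Δ))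

sigList-injective : ∀ {Ψ Φ} → sigList Ψ ≡ sigList Φ → Ψ ≡ Φ
sigList-injective {Ψ} {Φ} e = trans (sym (sigFromList-sigList Ψ)) (trans (cong sigFromList e) (sigFromList-sigList Φ))

ctxVars-∷ʳ : ∀ Γ x X → ctxVars (Γ ▸ x ∶ X) ≡ ctxVars Γ ∷ʳ x
ctxVars-∷ʳ Γ x X = map-++ proj₁ (ctxList Γ) _

sigNames-∷ʳ : ∀ Ψ A Γ → sigNames (Ψ ▸ˢ A ∶ Γ) ≡ sigNames Ψ ∷ʳ A
sigNames-∷ʳ Ψ A Γ = map-++ proj₁ (sigList Ψ) _

swapAt-map : ∀ {A B : Set} (k : A → B) ps {x y qs} →
             swapAt (length ps) (map k (ps ++ x ∷ y ∷ qs)) ≡ map k (ps ++ y ∷ x ∷ qs)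
swapAt-map k []       = refl
swapAt-map k (p ∷ ps) = cong (k p ∷_) (swapAt-map k ps)

ctxList-swapArgs : ∀ K n Γ → ctxList (swapArgsCtx K n Γ) ≡
                   map (λ p → proj₁ p , swapArgsSort K n (proj₂ p)) (ctxList Γ)
ctxList-swapArgs K n •           = refl
ctxList-swapArgs K n (Γ ▸ x ∶ X) =
  trans (cong (_∷ʳ (x , swapArgsSort K n X)) (ctxList-swapArgs K n Γ)) (sym (map-++ _ (ctxList Γ) _))

sigList-swapArgs : ∀ K n Ψ → sigList (swapArgsSig K n Ψ) ≡
                   map (λ d → proj₁ d , swapArgsCtx K n (proj₂ d)) (sigList Ψ)
sigList-swapArgs K n •ˢ           = refl
sigList-swapArgs K n (Ψ ▸ˢ A ∶ Γ) =
  trans (cong (_∷ʳ (A , swapArgsCtx K n Γ)) (sigList-swapArgs K n Ψ)) (sym (map-++ _ (sigList Ψ) _))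

-- The signature of a category with given orders

module Presentation (cod : SN → Var → SN) (cmp : SN → Var → Var → Var) where

  sortAt : (SN → List Var) → SN → Var → Sort
  sortAt m K f = cod K f ⟨ subFromList (map (cmp K f) (m (cod K f))) ⟩

  declAt : (SN → List Var) → SN → Var → Var × Sort
  declAt m K f = f , sortAt m K f

  Tᵖ : (SN → List Var) → SN → Ctx
  Tᵖ m K = ctxFromList (map (declAt m K) (m K))

  -- With `codOf L`, `cmpOf L` and the two orders of `c` this is `S L c` by definition. Keeping `o`
  -- apart from `m` makes prefixes and suffixes of a signature of the same form, with sorts still
  -- read off the full `m`.
  Sᵖ : List SN → (SN → List Var) → Sig
  Sᵖ o m = sigFromList (map (λ K → K , Tᵖ m K) o)

  ctxVars-decls : ∀ m K fs → ctxVars (ctxFromList (map (declAt m K) fs)) ≡ fs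
  ctxVars-decls m K fs = trans (cong (map proj₁) (ctxList-ctxFromList (map (declAt m K) fs)))
    (trans (sym (map-∘ fs)) (map-id fs))

  sigNames-Sᵖ : ∀ o m → sigNames (Sᵖ o m) ≡ o
  sigNames-Sᵖ o m = trans (cong (map proj₁) (sigList-sigFromList (map (λ K → K , Tᵖ m K) o)))
    (trans (sym (map-∘ o)) (map-id o))

  sigList-Sᵖ : ∀ o m → sigList (Sᵖ o m) ≡ map (λ K → K , Tᵖ m K) o
  sigList-Sᵖ o m = sigList-sigFromList (map (λ K → K , Tᵖ m K) o)

  ∈-Sᵖ : ∀ o m {K} → K ∈ o → (K , Tᵖ m K) ∈ sigList (Sᵖ o m)
  ∈-Sᵖ o m {K} K∈ = subst ((K , Tᵖ m K) ∈_) (sym (sigList-Sᵖ o m)) (∈-map⁺ (λ K → K , Tᵖ m K) K∈)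

  decls-of-entries : ∀ m {K} Γ → (∀ {f X} → (f , X) ∈ ctxList Γ → sortAt m K f ≡ X) →
                     map (declAt m K) (ctxVars Γ) ≡ ctxList Γ
  decls-of-entries m Γ h = trans (sym (map-∘ (ctxList Γ)))
    (trans (map-cong-∈ (ctxList Γ) (λ p → cong (_ ,_) (h p))) (map-id (ctxList Γ)))

  -- Only the entries are inspected, each by itself. So knowledge about the entries of one signature
  -- also identifies any signature made of the same entries in another order.
  Sᵖ-of-entries : ∀ m Ψ → (∀ {K Γ} → (K , Γ) ∈ sigList Ψ → Tᵖ m K ≡ Γ) → Sᵖ (sigNames Ψ) m ≡ Ψ
  Sᵖ-of-entries m Ψ h = sigList-injective (trans (sigList-Sᵖ (sigNames Ψ) m) (trans (sym (map-∘ (sigList Ψ)))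
    (trans (map-cong-∈ (sigList Ψ) (λ p → cong (_ ,_) (h p))) (map-id (sigList Ψ)))))

  ctxSNs-decls : ∀ m K fs → ctxSNs (ctxFromList (map (declAt m K) fs)) ≡ map (cod K) fs
  ctxSNs-decls m K fs = trans (cong (map (λ p → name (proj₂ p))) (ctxList-ctxFromList (map (declAt m K) fs)))
    (sym (map-∘ fs))

  Tᵖ-cong : ∀ {m m′ K} → m K ≡ m′ K → (∀ {f} → f ∈ m K → m (cod K f) ≡ m′ (cod K f)) → Tᵖ m K ≡ Tᵖ m′ K
  Tᵖ-cong {m} {m′} {K} e h = cong ctxFromList (trans
    (map-cong-∈ (m K) (λ {f} f∈ → cong (λ l → f , (cod K f ⟨ subFromList (map (cmp K f) l) ⟩)) (h f∈)))
    (cong (map (declAt m′ K)) e))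

  Sᵖ-cong : ∀ {m m′} o → (∀ {K} → K ∈ o → m K ≡ m′ K × (∀ {f} → f ∈ m K → m (cod K f) ≡ m′ (cod K f))) →
            Sᵖ o m ≡ Sᵖ o m′
  Sᵖ-cong {m} {m′} o h = cong sigFromList (map-cong-∈ o (λ K∈ → cong (_ ,_) (Tᵖ-cong {m} {m′} (proj₁ (h K∈)) (proj₂ (h K∈)))))

  Sᵖ-++ : ∀ us vs m → Sᵖ (us ++ vs) m ≡ Sᵖ us m ++ˢ Sᵖ vs m
  Sᵖ-++ us vs m = sigList-injective (begin
    sigList (Sᵖ (us ++ vs) m)                   ≡⟨ sigList-Sᵖ (us ++ vs) m ⟩
    map (λ K → K , Tᵖ m K) (us ++ vs)           ≡⟨ map-++ _ us vs ⟩
    map _ us ++ map _ vs                        ≡⟨ cong₂ _++_ (sym (sigList-Sᵖ us m)) (sym (sigList-Sᵖ vs m)) ⟩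
    sigList (Sᵖ us m) ++ sigList (Sᵖ vs m)      ≡⟨ sym (sigList-++ˢ (Sᵖ us m) (Sᵖ vs m)) ⟩
    sigList (Sᵖ us m ++ˢ Sᵖ vs m)               ∎)
    where open ≡-Reasoning

  Sᵖ-∷ʳ : ∀ us K m → Sᵖ (us ∷ʳ K) m ≡ Sᵖ us m ▸ˢ K ∶ Tᵖ m K
  Sᵖ-∷ʳ us K m = Sᵖ-++ us (K ∷ []) m

  decls-++ : ∀ m K fs gs → ctxFromList (map (declAt m K) (fs ++ gs)) ≡
             ctxFromList (map (declAt m K) fs) ++ᶜ ctxFromList (map (declAt m K) gs)
  decls-++ m K fs gs = ctxList-injective (begin
    ctxList (ctxFromList (map d (fs ++ gs)))    ≡⟨ ctxList-ctxFromList (map d (fs ++ gs)) ⟩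
    map d (fs ++ gs)                            ≡⟨ map-++ d fs gs ⟩
    map d fs ++ map d gs                        ≡⟨ cong₂ _++_ (sym (ctxList-ctxFromList (map d fs))) (sym (ctxList-ctxFromList (map d gs))) ⟩
    ctxList (ctxFromList (map d fs)) ++ ctxList (ctxFromList (map d gs))
                                                ≡⟨ sym (ctxList-++ᶜ (ctxFromList (map d fs)) (ctxFromList (map d gs))) ⟩
    ctxList (ctxFromList (map d fs) ++ᶜ ctxFromList (map d gs)) ∎)
    where
    open ≡-Reasoning
    d = declAt m K

  decls-∷ʳ : ∀ m K fs f → ctxFromList (map (declAt m K) (fs ∷ʳ f)) ≡ ctxFromList (map (declAt m K) fs) ▸ f ∶ sortAt m K f
  decls-∷ʳ m K fs f = decls-++ m K fs (f ∷ [])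

  Sᵖ-split₂ : ∀ us {a b} vs m → Sᵖ (us ++ a ∷ b ∷ vs) m ≡ ((Sᵖ us m ▸ˢ a ∶ Tᵖ m a) ▸ˢ b ∶ Tᵖ m b) ++ˢ Sᵖ vs m
  Sᵖ-split₂ us {a} {b} vs m = begin
    Sᵖ (us ++ a ∷ b ∷ vs) m                  ≡⟨ cong (λ o → Sᵖ o m) (trans (sym (++-assoc us (a ∷ []) (b ∷ vs))) (sym (++-assoc (us ∷ʳ a) (b ∷ []) vs))) ⟩
    Sᵖ ((us ∷ʳ a) ∷ʳ b ++ vs) m              ≡⟨ Sᵖ-++ ((us ∷ʳ a) ∷ʳ b) vs m ⟩
    Sᵖ ((us ∷ʳ a) ∷ʳ b) m ++ˢ Sᵖ vs m        ≡⟨ cong (_++ˢ Sᵖ vs m) (trans (Sᵖ-∷ʳ (us ∷ʳ a) b m) (cong (_▸ˢ b ∶ Tᵖ m b) (Sᵖ-∷ʳ us a m))) ⟩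
    ((Sᵖ us m ▸ˢ a ∶ Tᵖ m a) ▸ˢ b ∶ Tᵖ m b) ++ˢ Sᵖ vs m ∎
    where open ≡-Reasoning

  Sᵖ-split : ∀ us {K} vs m → Sᵖ (us ++ K ∷ vs) m ≡ (Sᵖ us m ▸ˢ K ∶ Tᵖ m K) ++ˢ Sᵖ vs m
  Sᵖ-split us {K} vs m = trans (cong (λ o → Sᵖ o m) (sym (++-assoc us (K ∷ []) vs)))
    (trans (Sᵖ-++ (us ∷ʳ K) vs m) (cong (_++ˢ Sᵖ vs m) (Sᵖ-∷ʳ us K m)))

  decls-split₂ : ∀ m K ps {x y} qs → ctxFromList (map (declAt m K) (ps ++ x ∷ y ∷ qs)) ≡
    ((ctxFromList (map (declAt m K) ps) ▸ x ∶ sortAt m K x) ▸ y ∶ sortAt m K y) ++ᶜ ctxFromList (map (declAt m K) qs)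
  decls-split₂ m K ps {x} {y} qs = begin
    Dc (ps ++ x ∷ y ∷ qs)               ≡⟨ cong Dc (trans (sym (++-assoc ps (x ∷ []) (y ∷ qs))) (sym (++-assoc (ps ∷ʳ x) (y ∷ []) qs))) ⟩
    Dc ((ps ∷ʳ x) ∷ʳ y ++ qs)           ≡⟨ decls-++ m K ((ps ∷ʳ x) ∷ʳ y) qs ⟩
    Dc ((ps ∷ʳ x) ∷ʳ y) ++ᶜ Dc qs       ≡⟨ cong (_++ᶜ Dc qs) (trans (decls-∷ʳ m K (ps ∷ʳ x) y) (cong (_▸ y ∶ sortAt m K y) (decls-∷ʳ m K ps x))) ⟩
    ((Dc ps ▸ x ∶ sortAt m K x) ▸ y ∶ sortAt m K y) ++ᶜ Dc qs ∎
    where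
    open ≡-Reasoning
    Dc : List Var → Ctx
    Dc fs = ctxFromList (map (declAt m K) fs)

  module SwapArgs {K : SN} {m m′ : SN → List Var} (ps : List Var) {x y : Var} {qs : List Var}
                  (mK : m K ≡ ps ++ x ∷ y ∷ qs) (m′K : m′ K ≡ ps ++ y ∷ x ∷ qs)
                  (off : ∀ {K′} → K′ ≢ K → m K′ ≡ m′ K′) where

    -- The arguments of a sort over `K` are `m K` under a map, so exchanging neighbours in `m K`
    -- exchanges the arguments at the same positions. Sorts over other names do not read `m K`.
    swapArgs-sort : ∀ K′ f → swapArgsSort K (length ps) (sortAt m K′ f) ≡ sortAt m′ K′ f
    swapArgs-sort K′ f with cod K′ f ≟ K
    ... | no ≢K   = trans (if-≢ ≢K) (cong (λ l → cod K′ f ⟨ subFromList (map (cmp K′ f) l) ⟩) (off ≢K))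
    ... | yes ≡K  = trans (if-≡ ≡K) (cong (cod K′ f ⟨_⟩) (cong subFromList (begin
      swapAt (length ps) (subList (subFromList (map k (m (cod K′ f)))))  ≡⟨ cong (swapAt (length ps)) (subList-subFromList (map k (m (cod K′ f)))) ⟩
      swapAt (length ps) (map k (m (cod K′ f)))                          ≡⟨ cong (swapAt (length ps) ∘ map k) (trans (cong m ≡K) mK) ⟩
      swapAt (length ps) (map k (ps ++ x ∷ y ∷ qs))                      ≡⟨ swapAt-map k ps ⟩
      map k (ps ++ y ∷ x ∷ qs)                                           ≡⟨ cong (map k) (sym (trans (cong m′ ≡K) m′K)) ⟩
      map k (m′ (cod K′ f))                                              ∎)))
      where
      open ≡-Reasoning
      k = cmp K′ f

    swapArgs-Tᵖ : ∀ {K′} → K′ ≢ K → swapArgsCtx K (length ps) (Tᵖ m K′) ≡ Tᵖ m′ K′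
    swapArgs-Tᵖ {K′} ≢K = ctxList-injective (begin
      ctxList (swapArgsCtx K n (Tᵖ m K′))                             ≡⟨ ctxList-swapArgs K n (Tᵖ m K′) ⟩
      map sw (ctxList (Tᵖ m K′))                                      ≡⟨ cong (map sw) (ctxList-ctxFromList (map (declAt m K′) (m K′))) ⟩
      map sw (map (declAt m K′) (m K′))                               ≡⟨ sym (map-∘ (m K′)) ⟩
      map (sw ∘ declAt m K′) (m K′)                                   ≡⟨ map-cong (λ f → cong (f ,_) (swapArgs-sort K′ f)) (m K′) ⟩
      map (declAt m′ K′) (m K′)                                       ≡⟨ cong (map (declAt m′ K′)) (off ≢K) ⟩
      map (declAt m′ K′) (m′ K′)                                      ≡⟨ sym (ctxList-ctxFromList (map (declAt m′ K′) (m′ K′))) ⟩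
      ctxList (Tᵖ m′ K′)                                              ∎)
      where
      open ≡-Reasoning
      n = length ps
      sw : Var × Sort → Var × Sort
      sw p = proj₁ p , swapArgsSort K n (proj₂ p)

    swapArgs-Sᵖ : ∀ vs → K ∉ vs → swapArgsSig K (length ps) (Sᵖ vs m) ≡ Sᵖ vs m′
    swapArgs-Sᵖ vs K∉ = sigList-injective (begin
      sigList (swapArgsSig K n (Sᵖ vs m))       ≡⟨ sigList-swapArgs K n (Sᵖ vs m) ⟩
      map sw (sigList (Sᵖ vs m))                ≡⟨ cong (map sw) (sigList-Sᵖ vs m) ⟩
      map sw (map (λ K → K , Tᵖ m K) vs)        ≡⟨ sym (map-∘ vs) ⟩
      map (λ K′ → sw (K′ , Tᵖ m K′)) vs         ≡⟨ map-cong-∈ vs (λ K′∈ → cong (_ ,_) (swapArgs-Tᵖ (λ { refl → K∉ K′∈ }))) ⟩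
      map (λ K → K , Tᵖ m′ K) vs                ≡⟨ sym (sigList-Sᵖ vs m′) ⟩
      sigList (Sᵖ vs m′)                        ∎)
      where
      open ≡-Reasoning
      n = length ps
      sw : SN × Ctx → SN × Ctx
      sw d = proj₁ d , swapArgsCtx K n (proj₂ d)

    -- The right-hand side is the target of the corresponding ctx-swap step.
    Sᵖ-swapped : ∀ us vs → K ∉ us → K ∉ vs → (∀ {K′ f} → K′ ∈ us → f ∈ m K′ → cod K′ f ≢ K) →
                 (∀ {f} → f ∈ m K → cod K f ≢ K) →
                 Sᵖ (us ++ K ∷ vs) m′ ≡
                 (Sᵖ us m ▸ˢ K ∶ (((ctxFromList (map (declAt m K) ps) ▸ y ∶ sortAt m K y) ▸ x ∶ sortAt m K x)
                                   ++ᶜ ctxFromList (map (declAt m K) qs)))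
                 ++ˢ swapArgsSig K (ctxLen (ctxFromList (map (declAt m K) ps))) (Sᵖ vs m)
    Sᵖ-swapped us vs K∉us K∉vs before self = begin
      Sᵖ (us ++ K ∷ vs) m′                               ≡⟨ Sᵖ-split us vs m′ ⟩
      (Sᵖ us m′ ▸ˢ K ∶ Tᵖ m′ K) ++ˢ Sᵖ vs m′             ≡⟨ cong₂ _++ˢ_ (cong₂ (_▸ˢ K ∶_) us-eq K-eq) vs-eq ⟩
      _                                                  ∎
      where
      open ≡-Reasoning
      -- By `before` and `self` no sort up to and including the context of `K` is over `K`, so the
      -- changed list is read only in `vs`, where `swapArgsSig` accounts for it.
      us-eq : Sᵖ us m′ ≡ Sᵖ us m
      us-eq = sym (Sᵖ-cong {m} {m′} us (λ K′∈ → off (λ { refl → K∉us K′∈ }) , λ f∈ → off (before K′∈ f∈)))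
      m⊇ : ∀ {f} → f ∈ ps ++ y ∷ x ∷ qs → f ∈ m K
      m⊇ {f} = subst (f ∈_) (sym mK) ∘ ∈-resp-↭ (++⁺ˡ ps (swap y x ↭-refl))
      K-eq : Tᵖ m′ K ≡ ((ctxFromList (map (declAt m K) ps) ▸ y ∶ sortAt m K y) ▸ x ∶ sortAt m K x)
                       ++ᶜ ctxFromList (map (declAt m K) qs)
      K-eq = trans (cong (ctxFromList ∘ map (declAt m′ K)) m′K) (trans
        (cong ctxFromList (map-cong-∈ (ps ++ y ∷ x ∷ qs)
          (λ {f} f∈ → cong (λ l → f , (cod K f ⟨ subFromList (map (cmp K f) l) ⟩)) (sym (off (self (m⊇ f∈)))))))
        (decls-split₂ m K ps qs))
      n≡ : ctxLen (ctxFromList (map (declAt m K) ps)) ≡ length ps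
      n≡ = trans (cong length (ctxList-ctxFromList (map (declAt m K) ps))) (length-map (declAt m K) ps)
      vs-eq : Sᵖ vs m′ ≡ swapArgsSig K (ctxLen (ctxFromList (map (declAt m K) ps))) (Sᵖ vs m)
      vs-eq = trans (sym (swapArgs-Sᵖ vs K∉vs)) (cong (λ n → swapArgsSig K n (Sᵖ vs m)) (sym n≡))

⟦⟧-map : ∀ (k : Var → Var) (s : Var → Sort) xs {g} → g ∈ xs →
         ⟦ subFromList (map k xs) ⟧ (ctxFromList (map (λ x → x , s x) xs)) g ≡ just (k g)
⟦⟧-map k s xs g∈ = go (reverseView xs) g∈
  where
  go : ∀ {xs} → Reverse xs → ∀ {g} → g ∈ xs →
       ⟦ subFromList (map k xs) ⟧ (ctxFromList (map (λ x → x , s x) xs)) g ≡ just (k g)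
  go (xs ∶ r ∶ʳ x) {g} g∈
    rewrite map-++ k xs (x ∷ []) | map-++ (λ x → x , s x) xs (x ∷ [])
          | subFromList-∷ʳ (map k xs) (k x) | ctxFromList-∷ʳ (map (λ x → x , s x) xs) x (s x)
    with ∈-∷ʳ⁻ xs g∈
  ... | inj₂ refl = if-≡ {x = g} refl
  ... | inj₁ g∈′ with x ≟ g
  -- If `g` is in `xs` and is also the last variable, the lookup stops at the last one, and the
  -- value there is `k g` too.
  ...   | yes refl = if-≡ {x = g} refl
  ...   | no x≢g   = trans (if-≢ x≢g) (go r g∈′)

compSub-map : ∀ Δ σ (j k : Var → Var) ps → (∀ {p} → p ∈ ps → ⟦ σ ⟧ Δ (j p) ≡ just (k p)) →
              compSub Δ σ (subFromList (map j ps)) ≡ just (subFromList (map k ps))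
compSub-map Δ σ j k ps = go (reverseView ps)
  where
  go : ∀ {ps} → Reverse ps → (∀ {p} → p ∈ ps → ⟦ σ ⟧ Δ (j p) ≡ just (k p)) →
       compSub Δ σ (subFromList (map j ps)) ≡ just (subFromList (map k ps))
  go []             h = refl
  go (ps ∶ r ∶ʳ p) h
    rewrite map-++ j ps (p ∷ []) | map-++ k ps (p ∷ [])
          | subFromList-∷ʳ (map j ps) (j p) | subFromList-∷ʳ (map k ps) (k p)
          | go r (h ∘ ∈-++⁺ˡ) | h (∈-∷ʳ⁺ ps) = refl

-- Finite inverse categories

codLoop-∈ : ∀ C {K f K′} ms → Unique (map (λ m → proj₁ m , proj₁ (proj₂ m)) ms) →
            (K , f , K′) ∈ ms → codLoop C K f ms ≡ K′
codLoop-∈ C {K} {f} ((K , f , K₁) ∷ ms) u (here refl)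
  with K ≡ᵇ K | ≡⇒≡ᵇ K K refl | f ≡ᵇ f | ≡⇒≡ᵇ f f refl
... | true | _ | true | _ = refl
codLoop-∈ C {K} {f} ((K₀ , f₀ , K₁) ∷ ms) (n ∷ u) (there p)
  with K₀ ≡ᵇ K | ≡ᵇ⇒≡ K₀ K | f₀ ≡ᵇ f | ≡ᵇ⇒≡ f₀ f
... | false | _ | _     | _ = codLoop-∈ C ms u p
... | true  | _ | false | _ = codLoop-∈ C ms u p
... | true  | a | true  | b =
  ⊥-elim (All.lookup n (∈-map⁺ (λ m → proj₁ m , proj₁ (proj₂ m)) p) (cong₂ _,_ (a tt) (b tt)))

-- The name of the composite "`p` after `f`". The default of `nameOf` does not occur on composable
-- non-identities, by `comp-mor`.
cmpOf : FinCatData → SN → Var → Var → Var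
cmpOf L K f p = nameOf (comp L (arr (codOf L K f) p) (arr K f))

∈-outNames⁺ : ∀ L {K f Y} → (K , f , Y) ∈ mors L → f ∈ outNames L K
∈-outNames⁺ L {K} p = ∈-map⁺ (λ m → proj₁ (proj₂ m)) (∈-filter⁺ (λ m → proj₁ m ≟ K) p refl)

∈-outNames⁻ : ∀ L {K f} → f ∈ outNames L K → ∃ λ Y → (K , f , Y) ∈ mors L
∈-outNames⁻ L {K} p
  with (_ , _ , Y) , q , refl ← ∈-map⁻ (λ m → proj₁ (proj₂ m)) p
  with r , refl ← ∈-filter⁻ (λ m → proj₁ m ≟ K) {xs = mors L} q = Y , r

module FIC (L : FinCatData) (fic : IsFIC L) where

  open IsFIC fic public
  open IsCategory isCategory public
  open Presentation (codOf L) (cmpOf L) public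

  codOf-mor : ∀ {K f K′} → (K , f , K′) ∈ mors L → codOf L K f ≡ K′
  codOf-mor {K} {f} p = trans (codOf-loop L K f) (codLoop-∈ L (mors L) mors-unique p)

  outNames-unique : ∀ K → Unique (outNames L K)
  outNames-unique K = unique-map-∈ inj (Uniqueₚ.filter⁺ (λ m → proj₁ m ≟ K) (unique-map⇒unique (mors L) mors-unique))
    where
    inj : ∀ {x y} → x ∈ filter (λ m → proj₁ m ≟ K) (mors L) → y ∈ filter (λ m → proj₁ m ≟ K) (mors L) →
          proj₁ (proj₂ x) ≡ proj₁ (proj₂ y) → x ≡ y
    inj p q e
      with p′ , d ← ∈-filter⁻ (λ m → proj₁ m ≟ K) {xs = mors L} p
      with q′ , d′ ← ∈-filter⁻ (λ m → proj₁ m ≟ K) {xs = mors L} q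
      = unique-map-injective mors-unique p′ q′ (cong₂ _,_ (trans d (sym d′)) e)

  no-endo-mor : ∀ {K f} → (K , f , K) ∉ mors L
  no-endo-mor p with () ← noEndo (hom-arr p)

  -- Both composites are endomorphisms, hence identities, so `K` and `Y` are isomorphic and
  -- skeletality makes them equal. Then `f` itself is a non-identity endomorphism.
  no-cycle : ∀ {K f Y g} → (K , f , Y) ∈ mors L → (Y , g , K) ∉ mors L
  no-cycle p q
    with refl ← skeletal (hom-arr p) (hom-arr q) (noEndo (comp-hom (hom-arr p) (hom-arr q)))
                         (noEndo (comp-hom (hom-arr q) (hom-arr p)))
    = no-endo-mor p

  comp-mor′ : ∀ {K f Y g Z} → (K , f , Y) ∈ mors L → (Y , g , Z) ∈ mors L →
             ∃ λ h → comp L (arr Y g) (arr K f) ≡ arr K h × (K , h , Z) ∈ mors L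
  comp-mor′ {K} {f} {Y} {g} p q with comp L (arr Y g) (arr K f) | comp-hom (hom-arr p) (hom-arr q)
  ... | .(idA K)   | hom-id _  = ⊥-elim (no-cycle p q)
  ... | .(arr K _) | hom-arr r = _ , refl , r

  comp-mor : ∀ {K f Y g Z} → (K , f , Y) ∈ mors L → (Y , g , Z) ∈ mors L →
             comp L (arr Y g) (arr K f) ≡ arr K (cmpOf L K f g) × (K , cmpOf L K f g , Z) ∈ mors L
  comp-mor p q rewrite codOf-mor p with h , e , r ← comp-mor′ p q rewrite e = refl , r

  -- Read on substitutions: the one attached to `g ∘ f` is the one attached to `f` composed with the
  -- one attached to `g`.
  cmpOf-assoc : ∀ {K f Y g Z p W} → (K , f , Y) ∈ mors L → (Y , g , Z) ∈ mors L → (Z , p , W) ∈ mors L →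
                cmpOf L K f (cmpOf L Y g p) ≡ cmpOf L K (cmpOf L K f g) p
  cmpOf-assoc {K} {f} {Y} {g} {Z} {p} a b c
    with gf , a′ ← comp-mor a b
    with pg , b′ ← comp-mor b c
    with e₁ , _ ← comp-mor a b′
    with e₂ , _ ← comp-mor a′ c
    = cong nameOf (trans (sym e₁) (trans (cong (λ z → comp L z (arr K f)) (sym pg))
        (trans (sym (assoc (hom-arr a) (hom-arr b) (hom-arr c)))
        (trans (cong (comp L (arr Z p)) gf) e₂))))

-- The strict orders on objects and on the morphisms out of an object

module FICOrders (L : FinCatData) (fic : IsFIC L) where

  open FIC L fic public

  _≺_ : SN → SN → Set
  K ≺ K′ = ∃ λ f → (K′ , f , K) ∈ mors L

  -- The divisibility order: `h` lies below `f` when `h` is `g ∘ f` for a non-identity `g`.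
  -- Requiring `f` to be a morphism makes irreflexivity and transitivity hold for arbitrary names,
  -- where `comp` would be unconstrained.
  Factors : SN → Var → Var → Set
  Factors K h f = (K , f , codOf L K f) ∈ mors L ×
                  ∃₂ λ g Z → (codOf L K f , g , Z) ∈ mors L × cmpOf L K f g ≡ h

  factors : ∀ {K f Y g Z} → (K , f , Y) ∈ mors L → (Y , g , Z) ∈ mors L → Factors K (cmpOf L K f g) f
  factors p q with refl ← codOf-mor p = p , _ , _ , q , refl

  ≺-irrefl : ∀ {K} → ¬ (K ≺ K)
  ≺-irrefl (f , p) = no-endo-mor p

  ≺-trans : ∀ {A B C} → A ≺ B → B ≺ C → A ≺ C
  ≺-trans (g , q) (f , p) = _ , proj₂ (comp-mor p q)

  _≺?_ : ∀ A B → Dec (A ≺ B)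
  A ≺? B = map′ to from (any? (λ m → (proj₁ m ≟ B) ×-dec (proj₂ (proj₂ m) ≟ A)) (mors L))
    where
    to : Any (λ m → proj₁ m ≡ B × proj₂ (proj₂ m) ≡ A) (mors L) → A ≺ B
    to p with (_ , f , _) , q , refl , refl ← find p = f , q
    from : A ≺ B → Any (λ m → proj₁ m ≡ B × proj₂ (proj₂ m) ≡ A) (mors L)
    from (f , p) = lose p (refl , refl)

  -- If `g ∘ f` is `f`, comparing codomains shows that `g` is an endomorphism, and it is not an
  -- identity.
  factors-irrefl : ∀ {K f} → ¬ Factors K f f
  factors-irrefl {K} {f} (p , g , Z , q , e)
    with refl ← codOf-mor (subst (λ h → (K , h , Z) ∈ mors L) e (proj₂ (comp-mor p q))) = no-endo-mor q

  factors-trans : ∀ {K h f e} → Factors K h f → Factors K f e → Factors K h e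
  factors-trans (p , g , Z , q , refl) (p′ , g′ , Z′ , q′ , refl)
    with refl ← codOf-mor (proj₂ (comp-mor p′ q′))
    = p′ , _ , _ , proj₂ (comp-mor q′ q) , cmpOf-assoc p′ q′ q

  factors? : ∀ K h f → Dec (Factors K h f)
  factors? K h f = (_∈?_ (K , f , codOf L K f) (mors L)) ×-dec
    map′ to from (any? (λ m → (proj₁ m ≟ codOf L K f) ×-dec (cmpOf L K f (proj₁ (proj₂ m)) ≟ h)) (mors L))
    where
    open import Data.List.Membership.DecPropositional (≡-dec _≟_ (≡-dec _≟_ _≟_)) using (_∈?_)
    to : Any (λ m → proj₁ m ≡ codOf L K f × cmpOf L K f (proj₁ (proj₂ m)) ≡ h) (mors L) →
         ∃₂ λ g Z → (codOf L K f , g , Z) ∈ mors L × cmpOf L K f g ≡ h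
    to p with (_ , g , Z) , q , e , e′ ← find p = g , Z , subst (λ Y → (Y , g , Z) ∈ mors L) e q , e′
    from : (∃₂ λ g Z → (codOf L K f , g , Z) ∈ mors L × cmpOf L K f g ≡ h) →
           Any (λ m → proj₁ m ≡ codOf L K f × cmpOf L K f (proj₁ (proj₂ m)) ≡ h) (mors L)
    from (g , Z , q , e) = lose q (refl , e)

  module ObjLin = LinearExtension _≺_
  module MorLin (K : SN) = LinearExtension (Factors K)

  mkChoice : (o : List SN) → o ↭ objs L → ObjLin.LinExt o →
             (m : SN → List Var) → (∀ {K} → K ∈ objs L → m K ↭ outNames L K) →
             (∀ {K} → K ∈ objs L → MorLin.LinExt K (m K)) → Choice L
  mkChoice o o↭ o-lin m m↭ m-lin = record
    { objOrder      = o
    ; objOrder-perm = o↭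
    ; objOrder-ok   = λ { (hom-arr p) → ObjLin.linExt⇒precedes ≺-irrefl o-lin
                            (∈-resp-↭ (↭-sym o↭) (mors-cod p)) (∈-resp-↭ (↭-sym o↭) (mors-dom p)) (_ , p) }
    ; morOrder      = m
    ; morOrder-perm = m↭
    ; morOrder-ok   = ok
    }
    where
    ok : ∀ {K f Y g Z h} → Hom L (arr K f) K Y → Hom L (arr Y g) Y Z →
         comp L (arr Y g) (arr K f) ≡ arr K h → Precedes (m K) h f
    ok {K} {f} {Y} {g} {Z} (hom-arr p) (hom-arr q) e
      with refl ← trans (sym (proj₁ (comp-mor p q))) e
      with K∈ ← mors-dom p
      = MorLin.linExt⇒precedes K factors-irrefl (m-lin K∈)
          (∈-resp-↭ (↭-sym (m↭ K∈)) (∈-outNames⁺ L (proj₂ (comp-mor p q))))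
          (∈-resp-↭ (↭-sym (m↭ K∈)) (∈-outNames⁺ L p)) (factors p q)

  choice : Choice L
  choice = mkChoice (proj₁ o) (proj₁ (proj₂ o)) (proj₂ (proj₂ o))
                    (proj₁ ∘ m) (λ {K} _ → proj₁ (proj₂ (m K))) (λ {K} _ → proj₂ (proj₂ (m K)))
    where
    o = ObjLin.Sorting.sort _≺?_ ≺-irrefl ≺-trans (objs L)
    m = λ K → MorLin.Sorting.sort K (factors? K) factors-irrefl factors-trans (outNames L K)

  perm⇒mor : ∀ {m : SN → List Var} → (∀ {K} → K ∈ objs L → m K ↭ outNames L K) →
             ∀ {K f} → K ∈ objs L → f ∈ m K → (K , f , codOf L K f) ∈ mors L
  perm⇒mor m↭ {K} {f} K∈ f∈ with Y , p ← ∈-outNames⁻ L (∈-resp-↭ (m↭ K∈) f∈)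
    = subst (λ Z → (K , f , Z) ∈ mors L) (sym (codOf-mor p)) p

  -- Derivability of the signature of a category

  module Chosen (c : Choice L) where

    o = objOrder c
    m = morOrder c

    o-unique : Unique o
    o-unique = unique-resp-↭ (↭-sym (objOrder-perm c)) objs-unique

    m-unique : ∀ {K} → K ∈ objs L → Unique (m K)
    m-unique K∈ = unique-resp-↭ (↭-sym (morOrder-perm c K∈)) (outNames-unique _)

    o⇒objs : ∀ {K} → K ∈ o → K ∈ objs L
    o⇒objs = ∈-resp-↭ (objOrder-perm c)

    objs⇒o : ∀ {K} → K ∈ objs L → K ∈ o
    objs⇒o = ∈-resp-↭ (↭-sym (objOrder-perm c))

    m⇒mor : ∀ {K f} → K ∈ objs L → f ∈ m K → (K , f , codOf L K f) ∈ mors L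
    m⇒mor = perm⇒mor (morOrder-perm c)

    mor⇒m : ∀ {K f Y} → (K , f , Y) ∈ mors L → f ∈ m K
    mor⇒m p = ∈-resp-↭ (↭-sym (morOrder-perm c (mors-dom p))) (∈-outNames⁺ L p)

    o-linExt : ObjLin.LinExt o
    o-linExt = ObjLin.precedes⇒linExt o-unique (λ _ _ → λ { (_ , p) → objOrder-ok c (hom-arr p) })

    m-linExt : ∀ {K} → K ∈ objs L → MorLin.LinExt K (m K)
    m-linExt {K} K∈ = MorLin.precedes⇒linExt K (m-unique K∈)
      (λ _ _ → λ { (p , g , Z , q , refl) → morOrder-ok c (hom-arr p) (hom-arr q) (proj₁ (comp-mor p q)) })

    -- Associativity in syntactic form: the substitution attached to `f` takes the declared sort of
    -- `g` to that of `g ∘ f`. The assumption on `σ` concerns only the variables in the sort of `g`,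
    -- because `σ` will be a substitution that is still being built.
    act-sortAt : ∀ {K f Y g Z Δ σ} → (K , f , Y) ∈ mors L → (Y , g , Z) ∈ mors L →
                 (∀ {p} → p ∈ m Z → ⟦ σ ⟧ Δ (cmpOf L Y g p) ≡ just (cmpOf L K f (cmpOf L Y g p))) →
                 actSort Δ σ (sortAt m Y g) ≡ just (sortAt m K (cmpOf L K f g))
    act-sortAt {K} {f} {Y} {g} {Z} {Δ} {σ} a b h
      with b-cod ← codOf-mor b
      with gf-cod ← codOf-mor (proj₂ (comp-mor a b))
      = begin
        actSort Δ σ (sortAt m Y g)
          ≡⟨ cong (λ W → actSort Δ σ (W ⟨ subFromList (map (cmpOf L Y g) (m W)) ⟩)) b-cod ⟩
        actSort Δ σ (Z ⟨ subFromList (map (cmpOf L Y g) (m Z)) ⟩)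
          ≡⟨ cong (λ r → r >>= λ ρ → just (Z ⟨ ρ ⟩))
                  (compSub-map Δ σ (cmpOf L Y g) (cmpOf L K (cmpOf L K f g)) (m Z)
                    (λ {p} p∈ → trans (h p∈) (cong just (cmpOf-assoc a b (m⇒mor (mors-cod b) p∈))))) ⟩
        just (Z ⟨ subFromList (map (cmpOf L K (cmpOf L K f g)) (m Z)) ⟩)
          ≡⟨ cong (λ W → just (W ⟨ subFromList (map (cmpOf L K (cmpOf L K f g)) (m W)) ⟩)) (sym gf-cod) ⟩
        just (sortAt m K (cmpOf L K f g)) ∎
      where open ≡-Reasoning

    -- Induction along the prefixes `gs` of `m Y`. The sort of the next `g` mentions composites with
    -- `g`, which the chosen order places before `g`, so the substitution built so far is defined on
    -- them.
    sub-ok : ∀ {K f Y Ψ Γ} → (K , f , Y) ∈ mors L → CtxOK Ψ Γ →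
             (∀ {g Z} → (Y , g , Z) ∈ mors L → declAt m K (cmpOf L K f g) ∈ ctxList Γ) →
             ∀ {gs} → Reverse gs → ∀ rest → m Y ≡ gs ++ rest →
             SubOK Ψ Γ (subFromList (map (cmpOf L K f) gs)) (ctxFromList (map (declAt m Y) gs))
    sub-ok p Γ-ok Γ∋ []             rest e = sub-empty
    sub-ok {K} {f} {Y} {Ψ} {Γ} p Γ-ok Γ∋ (gs ∶ r ∶ʳ g) rest e =
      subst₂ (SubOK Ψ Γ) (sym σ-eq) (sym (decls-∷ʳ m Y gs g))
        (sub-ext (sub-ok p Γ-ok Γ∋ r (g ∷ rest) e′) (act-sortAt p q before) (type-var (Γ∋ q) Γ-ok))
      where
      e′ : m Y ≡ gs ++ g ∷ rest
      e′ = trans e (++-assoc gs (g ∷ []) rest)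
      g∈ : g ∈ m Y
      g∈ = subst (g ∈_) (sym e′) (∈-insert gs)
      q : (Y , g , codOf L Y g) ∈ mors L
      q = m⇒mor (mors-cod p) g∈
      before : ∀ {h} → h ∈ m (codOf L Y g) →
               ⟦ subFromList (map (cmpOf L K f) gs) ⟧ (ctxFromList (map (declAt m Y) gs)) (cmpOf L Y g h)
               ≡ just (cmpOf L K f (cmpOf L Y g h))
      before h∈ = ⟦⟧-map (cmpOf L K f) (sortAt m Y) gs
        (precedes-prefix gs (subst Unique e′ (m-unique (mors-cod p)))
          (subst (λ xs → Precedes xs _ _) e′
            (morOrder-ok c (hom-arr q) (hom-arr (m⇒mor (mors-cod q) h∈)) (proj₁ (comp-mor q (m⇒mor (mors-cod q) h∈))))))
      σ-eq : subFromList (map (cmpOf L K f) (gs ∷ʳ g)) ≡ subFromList (map (cmpOf L K f) gs) ,ₛ cmpOf L K f g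
      σ-eq = trans (cong subFromList (map-++ _ gs (g ∷ []))) (subFromList-∷ʳ (map (cmpOf L K f) gs) _)

    -- The sort of `f` needs two things declared earlier: its name, the codomain of `f`, which
    -- `below` finds in `o′`; and its arguments, the composites `g ∘ f`, which the order on `m K`
    -- places in `fs`.
    ctx-ok : ∀ {K o′} → K ∈ objs L → (∀ {Y} → Y ≺ K → Y ∈ o′) →
             ∀ {fs} → Reverse fs → ∀ rest → m K ≡ fs ++ rest →
             CtxOK (Sᵖ o′ m) (ctxFromList (map (declAt m K) fs))
    ctx-ok K∈ below []             rest e = ctx-empty
    ctx-ok {K} {o′} K∈ below (fs ∶ r ∶ʳ f) rest e =
      subst (CtxOK (Sᵖ o′ m)) (sym (decls-∷ʳ m K fs f))
        (ctx-ext ih (type-sort (∈-Sᵖ o′ m (below (f , p))) (sub-ok p ih decl∈ (reverseView _) [] (sym (++-identityʳ _)))) f∉)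
      where
      e′ : m K ≡ fs ++ f ∷ rest
      e′ = trans e (++-assoc fs (f ∷ []) rest)
      p : (K , f , codOf L K f) ∈ mors L
      p = m⇒mor K∈ (subst (f ∈_) (sym e′) (∈-insert fs))
      ih = ctx-ok {K} {o′} K∈ below r (f ∷ rest) e′
      u : Unique (fs ++ f ∷ rest)
      u = subst Unique e′ (m-unique K∈)
      f∉ : f ∉ ctxVars (ctxFromList (map (declAt m K) fs))
      f∉ f∈ = proj₂ (unique-mid⁻ fs u) (∈-++⁺ˡ (subst (f ∈_) (ctxVars-decls m K fs) f∈))
      decl∈ : ∀ {g Z} → (codOf L K f , g , Z) ∈ mors L →
              declAt m K (cmpOf L K f g) ∈ ctxList (ctxFromList (map (declAt m K) fs))
      decl∈ q = subst (declAt m K _ ∈_) (sym (ctxList-ctxFromList (map (declAt m K) fs)))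
        (∈-map⁺ (declAt m K) (precedes-prefix fs u
          (subst (λ xs → Precedes xs _ _) e′ (morOrder-ok c (hom-arr p) (hom-arr q) (proj₁ (comp-mor p q))))))

    sig-ok : ∀ {o′} → Reverse o′ → ∀ rest → o ≡ o′ ++ rest → SigOK (Sᵖ o′ m)
    sig-ok []             rest e = sig-empty
    sig-ok (o′ ∶ r ∶ʳ K) rest e =
      subst SigOK (sym (Sᵖ-∷ʳ o′ K m)) (sig-ext (sig-ok r (K ∷ rest) e′)
        (ctx-ok K∈ below (reverseView (m K)) [] (sym (++-identityʳ _)))
        (λ p → proj₂ (unique-mid⁻ o′ u) (∈-++⁺ˡ (subst (K ∈_) (sigNames-Sᵖ o′ m) p))))
      where
      e′ : o ≡ o′ ++ K ∷ rest
      e′ = trans e (++-assoc o′ (K ∷ []) rest)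
      u : Unique (o′ ++ K ∷ rest)
      u = subst Unique e′ o-unique
      K∈ : K ∈ objs L
      K∈ = o⇒objs (subst (K ∈_) (sym e′) (∈-insert o′))
      below : ∀ {Y} → Y ≺ K → Y ∈ o′
      below (f , p) = precedes-prefix o′ u (subst (λ xs → Precedes xs _ _) e′ (objOrder-ok c (hom-arr p)))

    S-ok : SigOK (S L c)
    S-ok = sig-ok (reverseView o) [] (sym (++-identityʳ o))

-- Lookup in well-formed signatures

lookupCtx-∈ : ∀ Γ {x X} → Unique (ctxVars Γ) → (x , X) ∈ ctxList Γ → lookupCtx x Γ ≡ just X
lookupCtx-∈ (Γ ▸ y ∶ Y) {x} {X} u p with ∈-∷ʳ⁻ (ctxList Γ) p
... | inj₂ refl = if-≡ {x = y} refl
... | inj₁ q    = trans (if-≢ {x = y} y≢x) (lookupCtx-∈ Γ (subst Unique (++-identityʳ _) (proj₁ u′)) q)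
  where
  u′ = unique-mid⁻ (ctxVars Γ) (subst Unique (ctxVars-∷ʳ Γ y Y) u)
  y≢x : y ≢ x
  y≢x refl = proj₂ u′ (∈-++⁺ˡ (∈-map⁺ proj₁ q))

lookupSig-∈ : ∀ Ψ {K Γ} → Unique (sigNames Ψ) → (K , Γ) ∈ sigList Ψ → lookupSig K Ψ ≡ just Γ
lookupSig-∈ (Ψ ▸ˢ A ∶ Δ) {K} u p with ∈-∷ʳ⁻ (sigList Ψ) p
... | inj₂ refl = if-≡ {x = A} refl
... | inj₁ q    = trans (if-≢ {x = A} A≢K) (lookupSig-∈ Ψ (subst Unique (++-identityʳ _) (proj₁ u′)) q)
  where
  u′ = unique-mid⁻ (sigNames Ψ) (subst Unique (sigNames-∷ʳ Ψ A Δ) u)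
  A≢K : A ≢ K
  A≢K refl = proj₂ u′ (∈-++⁺ˡ (∈-map⁺ proj₁ q))

R-mor⁺ : ∀ Ψ {K Γ f X} → (K , Γ) ∈ sigList Ψ → (f , X) ∈ ctxList Γ → (K , f , name X) ∈ mors (R Ψ)
R-mor⁺ Ψ {K} {Γ} p q = ∈-concatMap⁺ (λ d → map (λ p → proj₁ d , proj₁ p , name (proj₂ p)) (ctxList (proj₂ d)))
  (lose p (∈-map⁺ (λ p → K , proj₁ p , name (proj₂ p)) q))

R-mor⁻ : ∀ Ψ {K f Y} → (K , f , Y) ∈ mors (R Ψ) →
         ∃₂ λ Γ X → (K , Γ) ∈ sigList Ψ × (f , X) ∈ ctxList Γ × name X ≡ Y
R-mor⁻ Ψ p
  with (K , Γ) , q , r ← find (∈-concatMap⁻ (λ d → map (λ p → proj₁ d , proj₁ p , name (proj₂ p)) (ctxList (proj₂ d))) p)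
  with (f , X) , s , refl ← ∈-map⁻ _ r
  = Γ , X , q , s , refl

R-comp-arr : ∀ Ψ {K f Y g Γ X Δ z} → lookupSig K Ψ ≡ just Γ → lookupCtx f Γ ≡ just X →
             lookupSig (name X) Ψ ≡ just Δ → ⟦ args X ⟧ Δ g ≡ just z →
             R-comp Ψ (arr Y g) (arr K f) ≡ arr K z
R-comp-arr Ψ a b c d rewrite a | b | c | d = refl

≅ᶜ-identity : ∀ {C D} → (∀ {a X Y} → Hom C a X Y → Hom D a X Y) → (∀ {a X Y} → Hom D a X Y → Hom C a X Y) →
              (∀ {f g X Y Z} → Hom C f X Y → Hom C g Y Z → comp C g f ≡ comp D g f) → C ≅ᶜ D
≅ᶜ-identity to from eq = record
  { Fo = id ; Fm = id ; Go = id ; Gm = id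
  ; F-hom = to ; F-id = λ _ → refl ; F-comp = eq
  ; G-hom = from ; G-id = λ _ → refl ; G-comp = λ p q → sym (eq (from p) (from q))
  ; GF-obj = λ _ → refl ; GF-arr = λ _ → refl ; FG-obj = λ _ → refl ; FG-arr = λ _ → refl
  }

-- The category of the signature of a category

module RS (L : FinCatData) (fic : IsFIC L) (c : Choice L) where

  open FICOrders L fic
  open Chosen c

  private
    Ψ = Sᵖ o m

  names-unique : Unique (sigNames Ψ)
  names-unique = subst Unique (sym (sigNames-Sᵖ o m)) o-unique

  obj⁻ : ∀ {K} → K ∈ objs (R Ψ) → K ∈ objs L
  obj⁻ {K} = o⇒objs ∘ subst (K ∈_) (sigNames-Sᵖ o m)

  obj⁺ : ∀ {K} → K ∈ objs L → K ∈ objs (R Ψ)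
  obj⁺ {K} = subst (K ∈_) (sym (sigNames-Sᵖ o m)) ∘ objs⇒o

  decl∈ : ∀ {K f} → f ∈ m K → declAt m K f ∈ ctxList (Tᵖ m K)
  decl∈ {K} f∈ = subst (declAt m K _ ∈_) (sym (ctxList-ctxFromList (map (declAt m K) (m K)))) (∈-map⁺ (declAt m K) f∈)

  mor⁺ : ∀ {K f Y} → (K , f , Y) ∈ mors L → (K , f , Y) ∈ mors (R Ψ)
  mor⁺ {K} {f} p = subst (λ Y → (K , f , Y) ∈ mors (R Ψ)) (codOf-mor p)
    (R-mor⁺ Ψ (∈-Sᵖ o m (objs⇒o (mors-dom p))) (decl∈ (mor⇒m p)))

  mor⁻ : ∀ {K f Y} → (K , f , Y) ∈ mors (R Ψ) → (K , f , Y) ∈ mors L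
  mor⁻ p
    with Γ , X , q , r , refl ← R-mor⁻ Ψ p
    with K , K∈ , refl ← ∈-map⁻ _ (subst (_ ∈_) (sigList-Sᵖ o m) q)
    with f , f∈ , refl ← ∈-map⁻ (declAt m K) (subst (_ ∈_) (ctxList-ctxFromList (map (declAt m K) (m K))) r)
    = m⇒mor (o⇒objs K∈) f∈

  to : ∀ {a X Y} → Hom (R Ψ) a X Y → Hom L a X Y
  to (hom-id p)  = hom-id (obj⁻ p)
  to (hom-arr p) = hom-arr (mor⁻ p)

  from : ∀ {a X Y} → Hom L a X Y → Hom (R Ψ) a X Y
  from (hom-id p)  = hom-id (obj⁺ p)
  from (hom-arr p) = hom-arr (mor⁺ p)

  comp-arr : ∀ {K f Y g Z} → (K , f , Y) ∈ mors L → (Y , g , Z) ∈ mors L →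
             R-comp Ψ (arr Y g) (arr K f) ≡ comp L (arr Y g) (arr K f)
  comp-arr {K} {f} {Y} {g} p q with refl ← codOf-mor p = trans
    (R-comp-arr Ψ {Y = Y} {X = sortAt m K f}
      (lookupSig-∈ Ψ names-unique (∈-Sᵖ o m (objs⇒o (mors-dom p))))
      (lookupCtx-∈ (Tᵖ m K) (subst Unique (sym (ctxVars-decls m K (m K))) (m-unique (mors-dom p))) (decl∈ (mor⇒m p)))
      (lookupSig-∈ Ψ names-unique (∈-Sᵖ o m (objs⇒o (mors-cod p))))
      (⟦⟧-map (cmpOf L K f) (sortAt m Y) (m Y) (mor⇒m q)))
    (sym (proj₁ (comp-mor p q)))

  comp-eq : ∀ {f g X Y Z} → Hom (R Ψ) f X Y → Hom (R Ψ) g Y Z → R-comp Ψ g f ≡ comp L g f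
  comp-eq p           (hom-id q)  = sym (id-left (to p))
  comp-eq (hom-id p)  (hom-arr q) = sym (id-right (to (hom-arr q)))
  comp-eq (hom-arr p) (hom-arr q) = comp-arr (mor⁻ p) (mor⁻ q)

  -- The names of objects and arrows are unchanged; only the lists are permuted, and the two
  -- composition functions agree where arrows are composable. So all four maps can be the identity.
  R∘S≅ : R (S L c) ≅ᶜ L
  R∘S≅ = ≅ᶜ-identity to from comp-eq

-- Well-formed signatures

ctxOK⇒unique : ∀ {Ψ Γ} → CtxOK Ψ Γ → Unique (ctxVars Γ)
ctxOK⇒unique ctx-empty                             = []
ctxOK⇒unique (ctx-ext {Γ = Γ} {X} {x} Γ-ok _ x∉) =
  subst Unique (sym (ctxVars-∷ʳ Γ x X)) (unique-∷ʳ⁺ (ctxOK⇒unique Γ-ok) x∉)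

sigOK⇒unique : ∀ {Ψ} → SigOK Ψ → Unique (sigNames Ψ)
sigOK⇒unique sig-empty                             = []
sigOK⇒unique (sig-ext {Ψ} {Γ} {A} Ψ-ok _ A∉) =
  subst Unique (sym (sigNames-∷ʳ Ψ A Γ)) (unique-∷ʳ⁺ (sigOK⇒unique Ψ-ok) A∉)

sig-entry : ∀ {Ψ} → SigOK Ψ → ∀ {K Γ} → (K , Γ) ∈ sigList Ψ →
            ∃₂ λ Ψ₀ Φ → sigList Ψ ≡ sigList Ψ₀ ++ (K , Γ) ∷ Φ × CtxOK Ψ₀ Γ
sig-entry (sig-ext {Ψ} {Γ} {A} Ψ-ok Γ-ok A∉) p with ∈-∷ʳ⁻ (sigList Ψ) p
... | inj₂ refl = Ψ , [] , refl , Γ-ok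
... | inj₁ q with Ψ₀ , Φ , e , r ← sig-entry Ψ-ok q =
  Ψ₀ , Φ ∷ʳ (A , Γ) , trans (cong (_∷ʳ (A , Γ)) e) (++-assoc (sigList Ψ₀) _ _) , r

ctx-entry : ∀ {Ψ Γ} → CtxOK Ψ Γ → ∀ {x X} → (x , X) ∈ ctxList Γ →
            ∃₂ λ Γ₀ Θ → ctxList Γ ≡ ctxList Γ₀ ++ (x , X) ∷ Θ × SortOK Ψ Γ₀ X
ctx-entry (ctx-ext {Γ = Γ} {Y} {y} Γ-ok Y-ok y∉) p with ∈-∷ʳ⁻ (ctxList Γ) p
... | inj₂ refl = Γ , [] , refl , Y-ok
... | inj₁ q with Γ₀ , Θ , e , r ← ctx-entry Γ-ok q =
  Γ₀ , Θ ∷ʳ (y , Y) , trans (cong (_∷ʳ (y , Y)) e) (++-assoc (ctxList Γ₀) _ _) , r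

⟦⟧-dom : ∀ σ Δ {y w} → ⟦ σ ⟧ Δ y ≡ just w → y ∈ ctxVars Δ
⟦⟧-dom (σ ,ₛ z) (Δ ▸ x ∶ X) {y} e with x ≟ y
... | yes refl = subst (y ∈_) (sym (ctxVars-∷ʳ Δ x X)) (∈-∷ʳ⁺ (ctxVars Δ))
... | no x≢y   = subst (y ∈_) (sym (ctxVars-∷ʳ Δ x X)) (∈-++⁺ˡ (⟦⟧-dom σ Δ (trans (sym (if-≢ x≢y)) e)))

⟦⟧-weaken : ∀ σ Δ {x X y z w} → x ∉ ctxVars Δ → ⟦ σ ⟧ Δ y ≡ just w → ⟦ σ ,ₛ z ⟧ (Δ ▸ x ∶ X) y ≡ just w
⟦⟧-weaken σ Δ {x} x∉ e = trans (if-≢ {x = x} λ { refl → x∉ (⟦⟧-dom σ Δ e) }) e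

compSub-just : ∀ Δ σ τ {z ρ} → compSub Δ σ (τ ,ₛ z) ≡ just ρ →
               ∃₂ λ ρ′ w → ρ ≡ ρ′ ,ₛ w × compSub Δ σ τ ≡ just ρ′ × ⟦ σ ⟧ Δ z ≡ just w
compSub-just Δ σ τ {z} e with compSub Δ σ τ
... | just ρ′ with ⟦ σ ⟧ Δ z
...   | just w with refl ← e = ρ′ , w , refl , refl , refl

compSub-,ₛ : ∀ Δ σ τ {z ρ w} → compSub Δ σ τ ≡ just ρ → ⟦ σ ⟧ Δ z ≡ just w → compSub Δ σ (τ ,ₛ z) ≡ just (ρ ,ₛ w)
compSub-,ₛ Δ σ τ e e′ rewrite e | e′ = refl

compSub-weaken : ∀ σ Δ {x X z} τ {ρ} → x ∉ ctxVars Δ → compSub Δ σ τ ≡ just ρ → compSub (Δ ▸ x ∶ X) (σ ,ₛ z) τ ≡ just ρ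
compSub-weaken σ Δ ε x∉ e = e
compSub-weaken σ Δ {X = X} (τ ,ₛ y) x∉ e with ρ′ , w , refl , e₁ , e₂ ← compSub-just Δ σ τ e =
  compSub-,ₛ _ (σ ,ₛ _) τ (compSub-weaken σ Δ τ x∉ e₁) (⟦⟧-weaken σ Δ {X = X} x∉ e₂)

-- The source of associativity in `R Ψ`: composition of substitutions is interpreted by composition
-- of the maps on variables.
⟦⟧-compSub : ∀ Δ σ Θ τ {ρ h v} → compSub Δ σ τ ≡ just ρ → ⟦ τ ⟧ Θ h ≡ just v → ⟦ ρ ⟧ Θ h ≡ ⟦ σ ⟧ Δ v
⟦⟧-compSub Δ σ (Θ ▸ x ∶ X) (τ ,ₛ z) {h = h} {v} e e′
  with ρ′ , w , refl , e₁ , e₂ ← compSub-just Δ σ τ e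
  with x ≟ h
... | yes x≡h with refl ← just-injective (trans (sym (if-≡ x≡h)) e′) = trans (if-≡ x≡h) (sym e₂)
... | no x≢h  = trans (if-≢ x≢h) (⟦⟧-compSub Δ σ Θ τ e₁ (trans (sym (if-≢ x≢h)) e′))

actSort-just : ∀ Δ σ X {Y} → actSort Δ σ X ≡ just Y → ∃ λ ρ → compSub Δ σ (args X) ≡ just ρ × Y ≡ name X ⟨ ρ ⟩
actSort-just Δ σ (A ⟨ τ ⟩) e with compSub Δ σ τ
... | just ρ with refl ← e = ρ , refl , refl

unique-ctx⁻ : ∀ Δ {x X} → Unique (ctxVars (Δ ▸ x ∶ X)) → Unique (ctxVars Δ) × x ∉ ctxVars Δ
unique-ctx⁻ Δ {x} {X} u with a , b ← unique-mid⁻ (ctxVars Δ) (subst Unique (ctxVars-∷ʳ Δ x X) u) =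
  subst Unique (++-identityʳ _) a , b ∘ ∈-++⁺ˡ

-- Provides the composites in `R Ψ` and their codomains: the image of `g` is a variable of `Γ` whose
-- sort has the same name. Typing compares with the sort under an initial part of `σ`; later
-- components bind new variables and change nothing.
subOK-entry : ∀ {Ψ Γ σ Δ} → SubOK Ψ Γ σ Δ → Unique (ctxVars Δ) → ∀ {g W} → (g , W) ∈ ctxList Δ →
              ∃₂ λ h ρ → ⟦ σ ⟧ Δ g ≡ just h × compSub Δ σ (args W) ≡ just ρ × (h , name W ⟨ ρ ⟩) ∈ ctxList Γ
subOK-entry (sub-ext {Δ = Δ} {σ} {z} {x} {X} σ-ok e (type-var z∈ _)) u {W = W} p
  with uΔ , x∉ ← unique-ctx⁻ Δ u
  with ∈-∷ʳ⁻ (ctxList Δ) p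
... | inj₂ refl with ρ , e₁ , refl ← actSort-just Δ σ X e =
  z , ρ , if-≡ {x = x} refl , compSub-weaken σ Δ (args X) x∉ e₁ , z∈
... | inj₁ q with h , ρ , e₁ , e₂ , r ← subOK-entry σ-ok uΔ q =
  h , ρ , ⟦⟧-weaken σ Δ {X = X} x∉ e₁ , compSub-weaken σ Δ (args W) x∉ e₂ , r

-- A substitution has exactly one component for each variable of its target, so its action
-- determines it. This is what allows arguments of sorts to be recovered from composition.
subList-map : ∀ {Ψ Γ σ Δ} → SubOK Ψ Γ σ Δ → Unique (ctxVars Δ) → (k : Var → Var) →
              (∀ {g} → g ∈ ctxVars Δ → ⟦ σ ⟧ Δ g ≡ just (k g)) → subFromList (map k (ctxVars Δ)) ≡ σ
subList-map sub-empty u k h = refl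
subList-map (sub-ext {Δ = Δ} {σ} {z} {x} {X} σ-ok e _) u k h
  rewrite ctxVars-∷ʳ Δ x X
  with uΔ , x∉ ← unique-mid⁻ (ctxVars Δ) u
  = begin
    subFromList (map k (ctxVars Δ ∷ʳ x))     ≡⟨ cong subFromList (map-++ k (ctxVars Δ) (x ∷ [])) ⟩
    subFromList (map k (ctxVars Δ) ∷ʳ k x)   ≡⟨ subFromList-∷ʳ (map k (ctxVars Δ)) (k x) ⟩
    subFromList (map k (ctxVars Δ)) ,ₛ k x   ≡⟨ cong₂ _,ₛ_ ih (sym z≡kx) ⟩
    σ ,ₛ z ∎
  where
  open ≡-Reasoning
  z≡kx : z ≡ k x
  z≡kx = just-injective (trans (sym (if-≡ {x = x} refl)) (h (∈-∷ʳ⁺ (ctxVars Δ))))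
  x≢ : ∀ {g} → g ∈ ctxVars Δ → x ≢ g
  x≢ g∈ refl = proj₂ (unique-mid⁻ (ctxVars Δ) u) (∈-++⁺ˡ g∈)
  ih = subList-map σ-ok (subst Unique (++-identityʳ _) (proj₁ (unique-mid⁻ (ctxVars Δ) u))) k
         (λ g∈ → trans (sym (if-≢ (x≢ g∈))) (h (∈-++⁺ˡ g∈)))

pairs-unique : ∀ (ds : List (SN × Ctx)) → Unique (map proj₁ ds) → (∀ {d} → d ∈ ds → Unique (ctxVars (proj₂ d))) →
  Unique (map (λ m → proj₁ m , proj₁ (proj₂ m))
    (concatMap (λ d → map (λ p → proj₁ d , proj₁ p , name (proj₂ p)) (ctxList (proj₂ d))) ds))
pairs-unique []             _       _  = []
pairs-unique ((K , Γ) ∷ ds) (n ∷ u) us =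
  subst Unique (sym (map-++ _ (map (λ p → K , proj₁ p , name (proj₂ p)) (ctxList Γ)) _))
    (Uniqueₚ.++⁺ head-unique (pairs-unique ds u (us ∘ there)) disjoint)
  where
  pr : SN × Var × SN → SN × Var
  pr m = proj₁ m , proj₁ (proj₂ m)
  outs : SN × Ctx → List (SN × Var × SN)
  outs d = map (λ p → proj₁ d , proj₁ p , name (proj₂ p)) (ctxList (proj₂ d))
  head-unique : Unique (map pr (outs (K , Γ)))
  head-unique = subst Unique (trans (sym (map-∘ (ctxList Γ))) (map-∘ (ctxList Γ)))
    (Uniqueₚ.map⁺ (cong proj₂) (us (here refl)))
  disjoint : ∀ {v} → ¬ (v ∈ map pr (outs (K , Γ)) × v ∈ map pr (concatMap outs ds))
  disjoint (p , q)
    with _ , p′ , refl ← ∈-map⁻ pr p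
    with _ , p″ , refl ← ∈-map⁻ (λ p → K , proj₁ p , name (proj₂ p)) p′
    with _ , q′ , e ← ∈-map⁻ pr q
    with (K′ , Γ′) , d∈ , q″ ← find (∈-concatMap⁻ outs q′)
    with _ , _ , refl ← ∈-map⁻ (λ p → K′ , proj₁ p , name (proj₂ p)) q″
    = All.lookup n (∈-map⁺ proj₁ d∈) (cong proj₁ e)

module WellFormed (Ψ : Sig) (Ψ-ok : SigOK Ψ) where

  names-unique : Unique (sigNames Ψ)
  names-unique = sigOK⇒unique Ψ-ok

  vars-unique : ∀ {K Γ} → (K , Γ) ∈ sigList Ψ → Unique (ctxVars Γ)
  vars-unique p with _ , _ , _ , Γ-ok ← sig-entry Ψ-ok p = ctxOK⇒unique Γ-ok

  entry-unique : ∀ {K Γ Δ} → (K , Γ) ∈ sigList Ψ → (K , Δ) ∈ sigList Ψ → Γ ≡ Δ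
  entry-unique p q with refl ← unique-map-injective names-unique p q refl = refl

  -- `Ψ₀` and `Γ₀` are what was declared before `K` and before `f`. Finding the codomain in the one
  -- and the composites in the other is what makes the order of declaration a `Choice`.
  record Decl (K : SN) (Γ : Ctx) (f : Var) (X : Sort) : Set where
    field
      {Ψ₀}   : Sig
      {Φ}    : List (SN × Ctx)
      {Γ₀}   : Ctx
      {Θ}    : List (Var × Sort)
      {Δ}    : Ctx
      Ψ-split : sigList Ψ ≡ sigList Ψ₀ ++ (K , Γ) ∷ Φ
      Γ-split : ctxList Γ ≡ ctxList Γ₀ ++ (f , X) ∷ Θ
      Δ∈      : (name X , Δ) ∈ sigList Ψ₀
      σ-ok    : SubOK Ψ₀ Γ₀ (args X) Δ

    Δ∈Ψ : (name X , Δ) ∈ sigList Ψ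
    Δ∈Ψ = subst ((name X , Δ) ∈_) (sym Ψ-split) (∈-++⁺ˡ Δ∈)

    cod-precedes : Precedes (sigNames Ψ) (name X) K
    cod-precedes = sigNames Ψ₀ , map proj₁ ((K , Γ) ∷ Φ) ,
      trans (cong (map proj₁) Ψ-split) (map-++ proj₁ (sigList Ψ₀) _) , ∈-map⁺ proj₁ Δ∈ , here refl

    Γ₀⊆Γ : ∀ {d} → d ∈ ctxList Γ₀ → d ∈ ctxList Γ
    Γ₀⊆Γ {d} p = subst (d ∈_) (sym Γ-split) (∈-++⁺ˡ p)

    Γ₀-precedes : ∀ {h Y} → (h , Y) ∈ ctxList Γ₀ → Precedes (ctxVars Γ) h f
    Γ₀-precedes p = ctxVars Γ₀ , map proj₁ ((f , X) ∷ Θ) ,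
      trans (cong (map proj₁) Γ-split) (map-++ proj₁ (ctxList Γ₀) _) , ∈-map⁺ proj₁ p , here refl

  decl : ∀ {K Γ f X} → (K , Γ) ∈ sigList Ψ → (f , X) ∈ ctxList Γ → Decl K Γ f X
  decl p q
    with Ψ₀ , Φ , e , Γ-ok ← sig-entry Ψ-ok p
    with Γ₀ , Θ , e′ , type-sort Δ∈ σ-ok ← ctx-entry Γ-ok q
    = record { Ψ-split = e ; Γ-split = e′ ; Δ∈ = Δ∈ ; σ-ok = σ-ok }

  record Composite (K : SN) (Γ : Ctx) (f : Var) (X : Sort) (Δ : Ctx) (g : Var) (W : Sort) : Set where
    field
      {h}       : Var
      {ρ}       : Sub
      value     : ⟦ args X ⟧ Δ g ≡ just h
      sort-comp : compSub Δ (args X) (args W) ≡ just ρ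
      h∈        : (h , name W ⟨ ρ ⟩) ∈ ctxList Γ
      precedes  : Precedes (ctxVars Γ) h f
      comp≡     : R-comp Ψ (arr (name X) g) (arr K f) ≡ arr K h

  -- The substitution in the sort of `f` is derivable over the part of `Γ` before `f`. Hence the
  -- composite is a declared variable, it precedes `f`, and all lookups in `R-comp` succeed.
  composite : ∀ {K Γ f X Δ g W} → (K , Γ) ∈ sigList Ψ → (f , X) ∈ ctxList Γ →
              (name X , Δ) ∈ sigList Ψ → (g , W) ∈ ctxList Δ → Composite K Γ f X Δ g W
  composite {Γ = Γ} {X = X} p q r s
    with D ← decl p q
    with refl ← entry-unique r (Decl.Δ∈Ψ D)
    with h , ρ , e₁ , e₂ , t ← subOK-entry (Decl.σ-ok D) (vars-unique r) s
    = record
    { value = e₁ ; sort-comp = e₂ ; h∈ = Decl.Γ₀⊆Γ D t ; precedes = Decl.Γ₀-precedes D t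
    ; comp≡ = R-comp-arr Ψ {Y = name X} {X = X} (lookupSig-∈ Ψ names-unique p) (lookupCtx-∈ Γ (vars-unique p) q)
                           (lookupSig-∈ Ψ names-unique r) e₁
    }

  no-self : ∀ {K f} → (K , f , K) ∉ mors (R Ψ)
  no-self p
    with Γ , X , q , r , refl ← R-mor⁻ Ψ p
    with D ← decl q r
    = proj₂ (unique-mid⁻ (sigNames (Decl.Ψ₀ D)) (subst Unique (trans (cong (map proj₁) (Decl.Ψ-split D))
        (map-++ proj₁ (sigList (Decl.Ψ₀ D)) _)) names-unique)) (∈-++⁺ˡ (∈-map⁺ proj₁ (Decl.Δ∈ D)))

  R-comp-hom : ∀ {f g X Y Z} → Hom (R Ψ) f X Y → Hom (R Ψ) g Y Z → Hom (R Ψ) (R-comp Ψ g f) X Z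
  R-comp-hom p           (hom-id q)  = p
  R-comp-hom (hom-id p)  (hom-arr q) = hom-arr q
  R-comp-hom (hom-arr p) (hom-arr q)
    with Γ , X , p₁ , p₂ , refl ← R-mor⁻ Ψ p
    with Δ , W , q₁ , q₂ , refl ← R-mor⁻ Ψ q
    with c ← composite p₁ p₂ q₁ q₂
    = subst (λ a → Hom (R Ψ) a _ _) (sym (Composite.comp≡ c)) (hom-arr (R-mor⁺ Ψ p₁ (Composite.h∈ c)))

  R-id-right : ∀ {f X Y} → Hom (R Ψ) f X Y → R-comp Ψ f (idA X) ≡ f
  R-id-right (hom-id _)  = refl
  R-id-right (hom-arr _) = refl

  R-assoc : ∀ {f g h W X Y Z} → Hom (R Ψ) f W X → Hom (R Ψ) g X Y → Hom (R Ψ) h Y Z →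
            R-comp Ψ h (R-comp Ψ g f) ≡ R-comp Ψ (R-comp Ψ h g) f
  R-assoc p           q           (hom-id r)  = refl
  R-assoc p           (hom-id q)  (hom-arr r) = refl
  R-assoc (hom-id p)  (hom-arr q) (hom-arr r) = sym (R-id-right (R-comp-hom (hom-arr q) (hom-arr r)))
  R-assoc (hom-arr {K} {f} p) (hom-arr {Y} {g} q) (hom-arr {Z} {h} r)
    with Γ , X , p₁ , p₂ , refl ← R-mor⁻ Ψ p
    with Δ , V , q₁ , q₂ , refl ← R-mor⁻ Ψ q
    with Θ , U , r₁ , r₂ , refl ← R-mor⁻ Ψ r
    with gf ← composite p₁ p₂ q₁ q₂
    with hg ← composite q₁ q₂ r₁ r₂
    -- The variable `g ∘ f` is declared with a composite substitution as its arguments. Composing it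
    -- with `h` evaluates that substitution, so `⟦⟧-compSub` compares the two sides.
    with h-gf ← composite p₁ (Composite.h∈ gf) r₁ r₂
    with hg-f ← composite p₁ p₂ q₁ (Composite.h∈ hg)
    = begin
      R-comp Ψ (arr Z h) (R-comp Ψ (arr Y g) (arr K f)) ≡⟨ cong (R-comp Ψ (arr Z h)) (Composite.comp≡ gf) ⟩
      R-comp Ψ (arr Z h) (arr K (Composite.h gf))   ≡⟨ Composite.comp≡ h-gf ⟩
      arr K (Composite.h h-gf)              ≡⟨ cong (arr K) (just-injective (trans (sym (Composite.value h-gf))
                                                 (trans (⟦⟧-compSub Δ (args X) Θ (args V) (Composite.sort-comp gf) (Composite.value hg))
                                                        (Composite.value hg-f)))) ⟩
      arr K (Composite.h hg-f)              ≡⟨ sym (Composite.comp≡ hg-f) ⟩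
      R-comp Ψ (arr Y (Composite.h hg)) (arr K f)   ≡⟨ cong (λ a → R-comp Ψ a (arr K f)) (sym (Composite.comp≡ hg)) ⟩
      R-comp Ψ (R-comp Ψ (arr Z h) (arr Y g)) (arr K f)     ∎
    where open ≡-Reasoning

  -- A composite of two variables is again a variable, never an identity. So `e` forces one of the
  -- two arrows to be an identity, and its ends coincide.
  R-skeletal : ∀ {f g X Y} → Hom (R Ψ) f X Y → Hom (R Ψ) g Y X → R-comp Ψ g f ≡ idA X → X ≡ Y
  R-skeletal (hom-id _)  _           e = refl
  R-skeletal (hom-arr _) (hom-id _)  e = refl
  R-skeletal (hom-arr p) (hom-arr q) e
    with Γ , X , p₁ , p₂ , refl ← R-mor⁻ Ψ p
    with Δ , W , q₁ , q₂ , refl ← R-mor⁻ Ψ q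
    with () ← trans (sym (Composite.comp≡ (composite p₁ p₂ q₁ q₂))) e

  R-noEndo : ∀ {a X} → Hom (R Ψ) a X X → a ≡ idA X
  R-noEndo (hom-id _)  = refl
  R-noEndo (hom-arr p) = ⊥-elim (no-self p)

  R-fic : IsFIC (R Ψ)
  R-fic = record
    { isCategory = record
      { objs-unique = names-unique
      ; mors-unique = pairs-unique (sigList Ψ) names-unique vars-unique
      ; mors-dom    = λ p → let _ , _ , q , _ = R-mor⁻ Ψ p in ∈-map⁺ proj₁ q
      ; mors-cod    = cod∈
      ; comp-hom    = R-comp-hom
      ; id-left     = λ _ → refl
      ; id-right    = R-id-right
      ; assoc       = R-assoc
      }
    ; skeletal = λ p q e _ → R-skeletal p q e
    ; noEndo   = R-noEndo
    }
    where
    cod∈ : ∀ {K f K′} → (K , f , K′) ∈ mors (R Ψ) → K′ ∈ sigNames Ψ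
    cod∈ p with Γ , X , q , r , refl ← R-mor⁻ Ψ p = ∈-map⁺ proj₁ (Decl.Δ∈Ψ (decl q r))

  -- Recovering a signature from its category

  open FICOrders (R Ψ) R-fic

  varsOf : SN → List Var
  varsOf K = fromMaybe [] (lookupSig K Ψ >>= λ Γ → just (ctxVars Γ))

  varsOf-entry : ∀ {K Γ} → (K , Γ) ∈ sigList Ψ → varsOf K ≡ ctxVars Γ
  varsOf-entry p rewrite lookupSig-∈ Ψ names-unique p = refl

  declared : Choice (R Ψ)
  declared = record
    { objOrder      = sigNames Ψ
    ; objOrder-perm = ↭-refl
    ; objOrder-ok   = o-ok
    ; morOrder      = varsOf
    ; morOrder-perm = m-perm
    ; morOrder-ok   = m-ok
    }
    where
    o-ok : ∀ {K K′ f} → Hom (R Ψ) (arr K′ f) K′ K → Precedes (sigNames Ψ) K K′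
    o-ok (hom-arr p) with Γ , X , q , r , refl ← R-mor⁻ Ψ p = Decl.cod-precedes (decl q r)
    m-perm : ∀ {K} → K ∈ sigNames Ψ → varsOf K ↭ outNames (R Ψ) K
    m-perm {K} K∈ with (K , Γ) , p , refl ← ∈-map⁻ proj₁ K∈ rewrite varsOf-entry p =
      unique-set⇒↭ (vars-unique p) (outNames-unique K) to from
      where
      to : ∀ {x} → x ∈ ctxVars Γ → x ∈ outNames (R Ψ) K
      to x∈ with (x , X) , q , refl ← ∈-map⁻ proj₁ x∈ = ∈-outNames⁺ (R Ψ) (R-mor⁺ Ψ p q)
      from : ∀ {x} → x ∈ outNames (R Ψ) K → x ∈ ctxVars Γ
      from x∈
        with Y , q ← ∈-outNames⁻ (R Ψ) x∈
        with Γ′ , X , p′ , r , _ ← R-mor⁻ Ψ q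
        with refl ← entry-unique p p′ = ∈-map⁺ proj₁ r
    m-ok : ∀ {K f Y g Z h} → Hom (R Ψ) (arr K f) K Y → Hom (R Ψ) (arr Y g) Y Z →
           R-comp Ψ (arr Y g) (arr K f) ≡ arr K h → Precedes (varsOf K) h f
    m-ok (hom-arr p) (hom-arr q) e
      with Γ , X , p₁ , p₂ , refl ← R-mor⁻ Ψ p
      with Δ , W , q₁ , q₂ , refl ← R-mor⁻ Ψ q
      with c ← composite p₁ p₂ q₁ q₂
      with refl ← trans (sym (Composite.comp≡ c)) e
      rewrite varsOf-entry p₁ = Composite.precedes c

  -- Composition with `f` in `R Ψ` is by construction the action of the substitution in its sort, so
  -- `subList-map` gives that substitution back.
  declared-sort : ∀ {K Γ f X} → (K , Γ) ∈ sigList Ψ → (f , X) ∈ ctxList Γ → sortAt varsOf K f ≡ X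
  declared-sort {K} {Γ} {f} {X} p q
    = trans (cong (λ Y → Y ⟨ subFromList (map (cmpOf (R Ψ) K f) (varsOf Y)) ⟩) cod≡)
            (cong (name X ⟨_⟩) (trans (cong (subFromList ∘ map (cmpOf (R Ψ) K f)) (varsOf-entry r))
              (subList-map (Decl.σ-ok D) (vars-unique r) (cmpOf (R Ψ) K f) value)))
    where
    D = decl p q
    r = Decl.Δ∈Ψ D
    cod≡ : codOf (R Ψ) K f ≡ name X
    cod≡ = codOf-mor (R-mor⁺ Ψ p q)
    value : ∀ {g} → g ∈ ctxVars (Decl.Δ D) →
            ⟦ args X ⟧ (Decl.Δ D) g ≡ just (cmpOf (R Ψ) K f g)
    value {g} g∈
      with (_ , W) , s , refl ← ∈-map⁻ proj₁ g∈
      with c ← composite p q r s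
      = trans (Composite.value c) (cong just (cong nameOf (sym (trans
          (cong (λ Y → R-comp Ψ (arr Y g) (arr K f)) cod≡) (Composite.comp≡ c)))))

  declared-ctx : ∀ {K Γ} → (K , Γ) ∈ sigList Ψ → Tᵖ varsOf K ≡ Γ
  declared-ctx {K} {Γ} p = ctxList-injective (trans (ctxList-ctxFromList (map (declAt varsOf K) (varsOf K)))
    (trans (cong (map (declAt varsOf K)) (varsOf-entry p)) (decls-of-entries varsOf Γ (declared-sort p))))

  S-declared : S (R Ψ) declared ≡ Ψ
  S-declared = Sᵖ-of-entries varsOf Ψ declared-ctx

-- Change of linear orders

≡⇒≅ˢ : ∀ {Ψ Φ} → Ψ ≡ Φ → Ψ ≅ˢ Φ
≡⇒≅ˢ refl = nil

step : ∀ {Ψ Φ} → SigStep Ψ Φ → Ψ ≅ˢ Φ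
step s = fwd s ◅ nil

update : (SN → List Var) → SN → List Var → SN → List Var
update m K l K′ = if K′ ≡ᵇ K then l else m K′

update-≡ : ∀ (m : SN → List Var) K {l} → update m K l K ≡ l
update-≡ m K = if-≡ {x = K} refl

update-≢ : ∀ (m : SN → List Var) {K K′ l} → K′ ≢ K → update m K l K′ ≡ m K′
update-≢ m ≢K = if-≢ ≢K

update-self : ∀ (m : SN → List Var) K K′ → update m K (m K) K′ ≡ m K′
update-self m K K′ with K′ ≟ K
... | yes refl = update-≡ m K
... | no ≢K    = update-≢ m ≢K

update-elim : ∀ (P : SN → List Var → Set) m K {l} → P K l → (∀ {K′} → K′ ≢ K → P K′ (m K′)) →
              ∀ K′ → P K′ (update m K l K′)
update-elim P m K p q K′ with K′ ≟ K
... | yes refl = subst (P K) (sym (update-≡ m K)) p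
... | no ≢K    = subst (P K′) (sym (update-≢ m ≢K)) (q ≢K)

module Reorder (L : FinCatData) (fic : IsFIC L) where

  open FICOrders L fic

  Perms : (SN → List Var) → Set
  Perms m = ∀ {K} → K ∈ objs L → m K ↭ outNames L K

  -- The sort names in the context of `B` are the codomains of the morphisms out of `B`, so
  -- incomparability of two objects supplies exactly the side conditions of `sig-swap`.
  obj-swap : ∀ {m o o′} → Perms m → (∀ {K} → K ∈ o → K ∈ objs L) → ObjLin.Swap o o′ → SigStep (Sᵖ o m) (Sᵖ o′ m)
  obj-swap {m} m↭ o⊆ (ObjLin.swap-at us {a} {b} {vs} a⊀b b⊀a) =
    subst₂ SigStep (sym (Sᵖ-split₂ us vs m)) (sym (Sᵖ-split₂ us vs m))
      (sig-swap (fresh (∈-++⁺ʳ us (there (here refl))) a⊀b) (fresh (∈-insert us) b⊀a))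
    where
    fresh : ∀ {A B} → B ∈ us ++ a ∷ b ∷ vs → ¬ (A ≺ B) → A ∉ ctxSNs (Tᵖ m B)
    fresh {A} {B} B∈ A⊀B A∈
      with f , f∈ , refl ← ∈-map⁻ (codOf L B) (subst (A ∈_) (ctxSNs-decls m B (m B)) A∈)
      = A⊀B (f , perm⇒mor m↭ (o⊆ B∈) f∈)

  swap⇒↭ : ∀ {o o′} → ObjLin.Swap o o′ → o ↭ o′
  swap⇒↭ (ObjLin.swap-at us _ _) = ++⁺ˡ us (swap _ _ ↭-refl)

  obj-swaps : ∀ {m o o′} → Perms m → (∀ {K} → K ∈ o → K ∈ objs L) → Star ObjLin.Swap o o′ → Sᵖ o m ≅ˢ Sᵖ o′ m
  obj-swaps m↭ o⊆ nil      = nil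
  obj-swaps m↭ o⊆ (s ◅ ss) = fwd (obj-swap m↭ o⊆ s) ◅ obj-swaps m↭ (o⊆ ∘ ∈-resp-↭ (↭-sym (swap⇒↭ s))) ss

  module _ (c : Choice L) where

    open Chosen c using (o; o-unique; o-linExt; o⇒objs; objs⇒o)

    -- Serves two purposes: realising an exchange of morphisms as a step, and recognising the target
    -- of a given step. `before` holds because a morphism from `K′` to `K` would require `K` to be
    -- listed before `K′`.
    Sᵖ-ctx-swap : ∀ {m m′ K us vs} ps {x y qs} → Perms m → K ∈ objs L → o ≡ us ++ K ∷ vs →
                  m K ≡ ps ++ x ∷ y ∷ qs → m′ K ≡ ps ++ y ∷ x ∷ qs → (∀ {K′} → K′ ≢ K → m K′ ≡ m′ K′) →
                  Sᵖ o m′ ≡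
                  (Sᵖ us m ▸ˢ K ∶ (((ctxFromList (map (declAt m K) ps) ▸ y ∶ sortAt m K y) ▸ x ∶ sortAt m K x)
                                    ++ᶜ ctxFromList (map (declAt m K) qs)))
                  ++ˢ swapArgsSig K (ctxLen (ctxFromList (map (declAt m K) ps))) (Sᵖ vs m)
    Sᵖ-ctx-swap {m} {m′} {K} {us} {vs} ps m↭ K∈ o≡ mK m′K off = trans (cong (λ o → Sᵖ o m′) o≡)
      (SwapArgs.Sᵖ-swapped {K} {m} {m′} ps mK m′K off us vs (K∉ ∘ ∈-++⁺ˡ) (K∉ ∘ ∈-++⁺ʳ us) before self)
      where
      K∉ : K ∉ us ++ vs
      K∉ = proj₂ (unique-mid⁻ us (subst Unique o≡ o-unique))
      before : ∀ {K′ f} → K′ ∈ us → f ∈ m K′ → codOf L K′ f ≢ K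
      before {K′} {f} K′∈ f∈ refl = ObjLin.linExt-before us (subst ObjLin.LinExt o≡ o-linExt) K′∈
        (f , perm⇒mor m↭ (o⇒objs (subst (K′ ∈_) (sym o≡) (∈-++⁺ˡ K′∈))) f∈)
      self : ∀ {f} → f ∈ m K → codOf L K f ≢ K
      self {f} f∈ e = no-endo-mor (subst (λ Z → (K , f , Z) ∈ mors L) e (perm⇒mor m↭ K∈ f∈))

    mor-swap : ∀ {m K xs ys} → Perms m → K ∈ objs L → xs ↭ outNames L K → MorLin.Swap K xs ys →
               SigStep (Sᵖ o (update m K xs)) (Sᵖ o (update m K ys))
    mor-swap {m} {K} m↭ K∈ xs↭ (MorLin.swap-at ps {x} {y} {qs} x⊀y y⊀x)
      with us , vs , o≡ ← ∈-∃++ (objs⇒o K∈)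
      = subst₂ SigStep (sym lhs) (sym rhs) (ctx-swap (fresh y∈ x⊀y) (fresh x∈ y⊀x))
      where
      m₁ = update m K (ps ++ x ∷ y ∷ qs)
      m₂ = update m K (ps ++ y ∷ x ∷ qs)
      m₁K : m₁ K ≡ ps ++ x ∷ y ∷ qs
      m₁K = update-≡ m K
      m₁↭ : Perms m₁
      m₁↭ {K′} = update-elim (λ K l → K ∈ objs L → l ↭ outNames L K) m K (λ _ → xs↭) (λ _ → m↭) K′
      x∈ : x ∈ m₁ K
      x∈ = subst (x ∈_) (sym m₁K) (∈-insert ps)
      y∈ : y ∈ m₁ K
      y∈ = subst (y ∈_) (sym m₁K) (∈-++⁺ʳ ps (there (here refl)))
      -- The variables in the sort of `f` are the composites with `f`, so an `h` occurring there
      -- would factor through `f`.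
      fresh : ∀ {h f} → f ∈ m₁ K → ¬ Factors K h f → h ∉ sortVars (sortAt m₁ K f)
      fresh {h} {f} f∈ h⊀f h∈
        with p ← perm⇒mor m₁↭ K∈ f∈
        with g , g∈ , refl ← ∈-map⁻ (cmpOf L K f) (subst (h ∈_) (subList-subFromList (map (cmpOf L K f) (m₁ (codOf L K f)))) h∈)
        = h⊀f (factors p (perm⇒mor m₁↭ (mors-cod p) g∈))
      lhs : Sᵖ o m₁ ≡ _
      lhs = trans (cong (λ o → Sᵖ o m₁) o≡) (trans (Sᵖ-split us vs m₁)
        (cong (λ Γ → (Sᵖ us m₁ ▸ˢ K ∶ Γ) ++ˢ Sᵖ vs m₁)
          (trans (cong (ctxFromList ∘ map (declAt m₁ K)) m₁K) (decls-split₂ m₁ K ps qs))))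
      rhs : Sᵖ o m₂ ≡ _
      rhs = Sᵖ-ctx-swap {m₁} {m₂} ps m₁↭ K∈ o≡ m₁K (update-≡ m K)
              (λ ≢K → trans (update-≢ m ≢K) (sym (update-≢ m ≢K)))

    mor-swaps : ∀ {m K xs ys} → Perms m → K ∈ objs L → xs ↭ outNames L K → Star (MorLin.Swap K) xs ys →
                Sᵖ o (update m K xs) ≅ˢ Sᵖ o (update m K ys)
    mor-swaps m↭ K∈ xs↭ nil = nil
    mor-swaps {m} {K} m↭ K∈ xs↭ (s@(MorLin.swap-at us _ _) ◅ ss) =
      fwd (mor-swap {m} m↭ K∈ xs↭ s) ◅ mor-swaps {m} m↭ K∈ (↭-trans (++⁺ˡ us (swap _ _ ↭-refl)) xs↭) ss

    Sᵖ-cong-objs : ∀ {m m′} → Perms m → (∀ {K} → K ∈ objs L → m K ≡ m′ K) → Sᵖ o m ≡ Sᵖ o m′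
    Sᵖ-cong-objs {m} {m′} m↭ e = Sᵖ-cong {m} {m′} o (λ K∈ → e (o⇒objs K∈) , λ f∈ → e (mors-cod (perm⇒mor m↭ (o⇒objs K∈) f∈)))

    -- One object at a time; `ks` lists the objects at which `m` and `m′` may still differ. The
    -- orders `Factors K` depend on the category alone, so changing the list at one object leaves
    -- the conditions at the others intact.
    mor-reorder : ∀ {m m′} → Perms m → Perms m′ →
                  (∀ {K} → K ∈ objs L → MorLin.LinExt K (m K)) → (∀ {K} → K ∈ objs L → MorLin.LinExt K (m′ K)) →
                  ∀ ks → (∀ {K} → K ∈ ks → K ∈ objs L) → (∀ {K} → K ∈ objs L → K ∈ ks ⊎ m K ≡ m′ K) →
                  Sᵖ o m ≅ˢ Sᵖ o m′
    mor-reorder {m} {m′} m↭ m′↭ l l′ [] _ e = ≡⇒≅ˢ (Sᵖ-cong-objs {m} {m′} m↭ (λ K∈ → [ (λ ()) , id ]′ (e K∈)))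
    mor-reorder {m} {m′} m↭ m′↭ l l′ (k ∷ ks) ks⊆ e =
      -- `update m k (m k)` equals `m` only pointwise, so the passage to the updated form goes
      -- through the signatures.
      ≡⇒≅ˢ (Sᵖ-cong-objs {m} {update m k (m k)} m↭ (λ {K} _ → sym (update-self m k K)))
      ◅◅ mor-swaps {m} m↭ k∈ (m↭ k∈)
           (MorLin.linExt-connected k (↭-trans (m↭ k∈) (↭-sym (m′↭ k∈))) (l k∈) (l′ k∈))
      ◅◅ mor-reorder {update m k (m′ k)} {m′}
           (λ {K} → update-elim (λ K l → K ∈ objs L → l ↭ outNames L K) m k m′↭ (λ _ → m↭) K) m′↭
           (λ {K} → update-elim (λ K l → K ∈ objs L → MorLin.LinExt K l) m k l′ (λ _ → l) K) l′
           ks (ks⊆ ∘ there)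
           (λ {K} → update-elim (λ K l → K ∈ objs L → K ∈ ks ⊎ l ≡ m′ K) m k (λ _ → inj₂ refl) rest K)
      where
      k∈ = ks⊆ (here refl)
      rest : ∀ {K} → K ≢ k → K ∈ objs L → K ∈ ks ⊎ m K ≡ m′ K
      rest K≢k K∈ with e K∈
      ... | inj₁ (here K≡k) = ⊥-elim (K≢k K≡k)
      ... | inj₁ (there p)  = inj₁ p
      ... | inj₂ q          = inj₂ q

  S-independent : (c c′ : Choice L) → S L c ≅ˢ S L c′
  S-independent c c′ =
    -- Objects move first, with the morphism orders of `c` fixed. The morphism exchanges then take
    -- place over the object order of `c′`.
    obj-swaps (morOrder-perm c) (Chosen.o⇒objs c)
      (ObjLin.linExt-connected (↭-trans (objOrder-perm c) (↭-sym (objOrder-perm c′))) (Chosen.o-linExt c) (Chosen.o-linExt c′))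
    ◅◅ mor-reorder c′ (morOrder-perm c) (morOrder-perm c′) (Chosen.m-linExt c) (Chosen.m-linExt c′) (objs L) id inj₁

-- Renaming

mapSub : (Var → Var) → Sub → Sub
mapSub w ε        = ε
mapSub w (σ ,ₛ z) = mapSub w σ ,ₛ w z

mapSort : (SN → SN) → (Var → Var) → Sort → Sort
mapSort φ w X = φ (name X) ⟨ mapSub w (args X) ⟩

mapCtx : (SN → SN) → (Var → Var) → Ctx → Ctx
mapCtx φ w •           = •
mapCtx φ w (Γ ▸ x ∶ X) = mapCtx φ w Γ ▸ w x ∶ mapSort φ w X

mapSig : (SN → SN) → (SN → Var → Var) → Sig → Sig
mapSig φ v •ˢ           = •ˢ
mapSig φ v (Ψ ▸ˢ A ∶ Γ) = mapSig φ v Ψ ▸ˢ φ A ∶ mapCtx φ (v A) Γ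

subList-mapSub : ∀ w σ → subList (mapSub w σ) ≡ map w (subList σ)
subList-mapSub w ε        = refl
subList-mapSub w (σ ,ₛ z) = trans (cong (_∷ʳ w z) (subList-mapSub w σ)) (sym (map-++ w (subList σ) _))

mapSub-subFromList : ∀ w xs → mapSub w (subFromList xs) ≡ subFromList (map w xs)
mapSub-subFromList w xs = trans (sym (subFromList-subList (mapSub w (subFromList xs))))
  (cong subFromList (trans (subList-mapSub w (subFromList xs)) (cong (map w) (subList-subFromList xs))))

ctxList-mapCtx : ∀ φ w Γ → ctxList (mapCtx φ w Γ) ≡ map (λ p → w (proj₁ p) , mapSort φ w (proj₂ p)) (ctxList Γ)
ctxList-mapCtx φ w •           = refl
ctxList-mapCtx φ w (Γ ▸ x ∶ X) = trans (cong (_∷ʳ (w x , mapSort φ w X)) (ctxList-mapCtx φ w Γ)) (sym (map-++ _ (ctxList Γ) _))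

sigList-mapSig : ∀ φ v Ψ → sigList (mapSig φ v Ψ) ≡
                 map (λ d → φ (proj₁ d) , mapCtx φ (v (proj₁ d)) (proj₂ d)) (sigList Ψ)
sigList-mapSig φ v •ˢ           = refl
sigList-mapSig φ v (Ψ ▸ˢ A ∶ Γ) = trans (cong (_∷ʳ (φ A , mapCtx φ (v A) Γ)) (sigList-mapSig φ v Ψ)) (sym (map-++ _ (sigList Ψ) _))

mapSub-id : ∀ σ → mapSub id σ ≡ σ
mapSub-id ε        = refl
mapSub-id (σ ,ₛ z) = cong (_,ₛ z) (mapSub-id σ)

mapCtx-id : ∀ Γ → mapCtx id id Γ ≡ Γ
mapCtx-id •           = refl
mapCtx-id (Γ ▸ x ∶ X) = cong₂ (λ Γ σ → Γ ▸ x ∶ (name X ⟨ σ ⟩)) (mapCtx-id Γ) (mapSub-id (args X))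

mapSub-∘ : ∀ w w′ σ → mapSub w (mapSub w′ σ) ≡ mapSub (w ∘ w′) σ
mapSub-∘ w w′ ε        = refl
mapSub-∘ w w′ (σ ,ₛ z) = cong (_,ₛ w (w′ z)) (mapSub-∘ w w′ σ)

mapCtx-∘ : ∀ φ w φ′ w′ Γ → mapCtx φ w (mapCtx φ′ w′ Γ) ≡ mapCtx (φ ∘ φ′) (w ∘ w′) Γ
mapCtx-∘ φ w φ′ w′ •           = refl
mapCtx-∘ φ w φ′ w′ (Γ ▸ x ∶ X) =
  cong₂ (λ Γ σ → Γ ▸ w (w′ x) ∶ (φ (φ′ (name X)) ⟨ σ ⟩)) (mapCtx-∘ φ w φ′ w′ Γ) (mapSub-∘ w w′ (args X))

mapSig-∘ : ∀ φ v φ′ v′ Ψ → mapSig φ v (mapSig φ′ v′ Ψ) ≡ mapSig (φ ∘ φ′) (λ A → v (φ′ A) ∘ v′ A) Ψ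
mapSig-∘ φ v φ′ v′ •ˢ           = refl
mapSig-∘ φ v φ′ v′ (Ψ ▸ˢ A ∶ Γ) =
  cong₂ (_▸ˢ φ (φ′ A) ∶_) (mapSig-∘ φ v φ′ v′ Ψ) (mapCtx-∘ φ (v (φ′ A)) φ′ (v′ A) Γ)

mapSub-cong : ∀ {w w′} σ → (∀ {x} → x ∈ subList σ → w x ≡ w′ x) → mapSub w σ ≡ mapSub w′ σ
mapSub-cong ε        h = refl
mapSub-cong (σ ,ₛ z) h = cong₂ _,ₛ_ (mapSub-cong σ (h ∘ ∈-++⁺ˡ)) (h (∈-∷ʳ⁺ (subList σ)))

∈-concatMap-∷ʳˡ : ∀ {A B : Set} (k : A → List B) xs {x y} → y ∈ concatMap k xs → y ∈ concatMap k (xs ∷ʳ x)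
∈-concatMap-∷ʳˡ k xs p with a , a∈ , q ← find (∈-concatMap⁻ k {xs = xs} p) = ∈-concatMap⁺ k (lose (∈-++⁺ˡ a∈) q)

∈-concatMap-∷ʳʳ : ∀ {A B : Set} (k : A → List B) xs {x y} → y ∈ k x → y ∈ concatMap k (xs ∷ʳ x)
∈-concatMap-∷ʳʳ k xs q = ∈-concatMap⁺ k (lose (∈-∷ʳ⁺ xs) q)

ctxAllVars-snocˡ : ∀ Γ {x X y} → y ∈ ctxAllVars Γ → y ∈ ctxAllVars (Γ ▸ x ∶ X)
ctxAllVars-snocˡ Γ = ∈-concatMap-∷ʳˡ _ (ctxList Γ)

ctxAllVars-snocʳ : ∀ Γ {x X y} → y ∈ x ∷ sortVars X → y ∈ ctxAllVars (Γ ▸ x ∶ X)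
ctxAllVars-snocʳ Γ {x} {X} = ∈-concatMap-∷ʳʳ (λ p → proj₁ p ∷ sortVars (proj₂ p)) (ctxList Γ) {x , X}

sigAllSNs-snocˡ : ∀ Ψ {A Γ B} → B ∈ sigAllSNs Ψ → B ∈ sigAllSNs (Ψ ▸ˢ A ∶ Γ)
sigAllSNs-snocˡ Ψ = ∈-concatMap-∷ʳˡ _ (sigList Ψ)

sigAllSNs-snocʳ : ∀ Ψ {A Γ B} → B ∈ A ∷ ctxSNs Γ → B ∈ sigAllSNs (Ψ ▸ˢ A ∶ Γ)
sigAllSNs-snocʳ Ψ {A} {Γ} = ∈-concatMap-∷ʳʳ (λ p → proj₁ p ∷ ctxSNs (proj₂ p)) (sigList Ψ) {A , Γ}

mapCtx-cong : ∀ {φ φ′ w w′} Γ → (∀ {A} → A ∈ ctxSNs Γ → φ A ≡ φ′ A) → (∀ {x} → x ∈ ctxAllVars Γ → w x ≡ w′ x) →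
              mapCtx φ w Γ ≡ mapCtx φ′ w′ Γ
mapCtx-cong •           h k = refl
mapCtx-cong {φ} {φ′} {w} {w′} (Γ ▸ x ∶ X) h k
  rewrite mapCtx-cong {φ} {φ′} {w} {w′} Γ (λ p → h (subst (_ ∈_) (sym (map-++ _ (ctxList Γ) _)) (∈-++⁺ˡ p))) (k ∘ ctxAllVars-snocˡ Γ)
        | k (ctxAllVars-snocʳ Γ {x} {X} (here refl))
        | h (subst (name X ∈_) (sym (map-++ (λ p → name (proj₂ p)) (ctxList Γ) ((x , X) ∷ []))) (∈-∷ʳ⁺ (ctxSNs Γ)))
        | mapSub-cong {w} {w′} (args X) (k ∘ ctxAllVars-snocʳ Γ {x} {X} ∘ there)
  = refl

mapSig-cong : ∀ {φ φ′ v} Ψ → (∀ {A} → A ∈ sigAllSNs Ψ → φ A ≡ φ′ A) → mapSig φ v Ψ ≡ mapSig φ′ v Ψ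
mapSig-cong •ˢ           h = refl
mapSig-cong {φ} {φ′} {v} (Ψ ▸ˢ A ∶ Γ) h
  rewrite mapSig-cong {φ} {φ′} {v} Ψ (h ∘ sigAllSNs-snocˡ Ψ)
        | h (sigAllSNs-snocʳ Ψ {A} {Γ} (here refl))
        | mapCtx-cong {φ} {φ′} {v A} Γ (h ∘ sigAllSNs-snocʳ Ψ {A} {Γ} ∘ there) (λ _ → refl)
  = refl

mapSig-id : ∀ Ψ → mapSig id (λ _ → id) Ψ ≡ Ψ
mapSig-id •ˢ           = refl
mapSig-id (Ψ ▸ˢ A ∶ Γ) = cong₂ (_▸ˢ A ∶_) (mapSig-id Ψ) (mapCtx-id Γ)

ctxSNs-mapCtx : ∀ φ w Γ → ctxSNs (mapCtx φ w Γ) ≡ map φ (ctxSNs Γ)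
ctxSNs-mapCtx φ w Γ = trans (cong (map _) (ctxList-mapCtx φ w Γ)) (trans (sym (map-∘ (ctxList Γ))) (map-∘ (ctxList Γ)))

sigAllSNs-mapSig : ∀ φ v Ψ → sigAllSNs (mapSig φ v Ψ) ≡ map φ (sigAllSNs Ψ)
sigAllSNs-mapSig φ v Ψ = trans (cong (concatMap k) (sigList-mapSig φ v Ψ)) (trans (concatMap-map k _ (sigList Ψ))
  (trans (concatMap-cong (λ d → cong (φ (proj₁ d) ∷_) (ctxSNs-mapCtx φ (v (proj₁ d)) (proj₂ d))) (sigList Ψ))
         (sym (map-concatMap φ k (sigList Ψ)))))
  where
  k : SN × Ctx → List SN
  k p = proj₁ p ∷ ctxSNs (proj₂ p)

ctxAllVars-mapCtx : ∀ φ w Γ → ctxAllVars (mapCtx φ w Γ) ≡ map w (ctxAllVars Γ)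
ctxAllVars-mapCtx φ w Γ = trans (cong (concatMap k) (ctxList-mapCtx φ w Γ)) (trans (concatMap-map k _ (ctxList Γ))
  (trans (concatMap-cong (λ d → cong (w (proj₁ d) ∷_) (subList-mapSub w (args (proj₂ d)))) (ctxList Γ))
         (sym (map-concatMap w k (ctxList Γ)))))
  where
  k : Var × Sort → List Var
  k p = proj₁ p ∷ sortVars (proj₂ p)

-- Renamings injective on the names in use

InjectiveOn : List ℕ → (ℕ → ℕ) → Set
InjectiveOn xs φ = ∀ {a b} → a ∈ xs → b ∈ xs → φ a ≡ φ b → a ≡ b

upper-bound : ∀ xs → ∃ λ M → ∀ {x} → x ∈ xs → x < M
upper-bound []       = 0 , λ ()
upper-bound (x ∷ xs) with M , h ← upper-bound xs =
  suc (x + M) , λ { (here refl) → s≤s (m≤m+n x M) ; (there p) → ≤-trans (h p) (≤-trans (m≤n+m M x) (m≤n+m (x + M) 1)) }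

-- Going through names larger than all those involved makes every single-name step fresh.
module InjectiveRenaming {X : Set} (act : (ℕ → ℕ) → X → X) (supp : X → List ℕ) (_~_ : X → X → Set)
  (~-refl : ∀ {x} → x ~ x) (~-trans : ∀ {x y z} → x ~ y → y ~ z → x ~ z)
  (act-cong : ∀ {φ ψ} x → (∀ {n} → n ∈ supp x → φ n ≡ ψ n) → act φ x ≡ act ψ x)
  (act-id : ∀ x → act id x ≡ x)
  (act-∘ : ∀ φ ψ x → act φ (act ψ x) ≡ act (φ ∘ ψ) x)
  (supp-act : ∀ φ x → supp (act φ x) ≡ map φ (supp x))
  (rename : ∀ {a b} x → b ∉ supp x → x ~ act (renSN a b) x) where

  open import Data.List.Membership.DecPropositional _≟_ using (_∈?_)

  on : List ℕ → (ℕ → ℕ) → ℕ → ℕ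
  on ks φ n with n ∈? ks
  ... | yes _ = φ n
  ... | no _  = n

  on-∈ : ∀ {ks φ n} → n ∈ ks → on ks φ n ≡ φ n
  on-∈ {ks} {φ} {n} p with n ∈? ks
  ... | yes _ = refl
  ... | no ∉  = ⊥-elim (∉ p)

  on-∉ : ∀ {ks φ n} → n ∉ ks → on ks φ n ≡ n
  on-∉ {ks} {φ} {n} ∉ with n ∈? ks
  ... | yes p = ⊥-elim (∉ p)
  ... | no _  = refl

  module _ {φ : ℕ → ℕ} (x : X) (inj : InjectiveOn (supp x) φ) (apart : ∀ {n} → n ∈ supp x → φ n ∉ supp x) where

    -- Names are renamed one at a time. Images avoid the support, so a renamed name is not caught by
    -- a later step; by injectivity `φ k` is not yet taken when its turn comes. A repeated `k`
    -- requires no step.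
    rename-on : ∀ ks → (∀ {k} → k ∈ ks → k ∈ supp x) → x ~ act (on ks φ) x
    rename-on []       _   = subst (x ~_) (sym (trans (act-cong x (λ _ → refl)) (act-id x))) ~-refl
    rename-on (k ∷ ks) ks⊆ with k ∈? ks
    ... | yes k∈ = subst (x ~_) (act-cong x same) (rename-on ks (ks⊆ ∘ there))
      where
      same : ∀ {n} → n ∈ supp x → on ks φ n ≡ on (k ∷ ks) φ n
      same {n} _ = split (n ∈? ks)
        where
        split : Dec (n ∈ ks) → on ks φ n ≡ on (k ∷ ks) φ n
        split (yes p) = trans (on-∈ p) (sym (on-∈ {k ∷ ks} (there p)))
        split (no ∉)  = trans (on-∉ ∉) (sym (on-∉ {k ∷ ks} (λ { (here refl) → ∉ k∈ ; (there p) → ∉ p })))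
    ... | no k∉  = subst (x ~_) (trans (act-∘ _ _ x) (act-cong x one-more))
                     (~-trans (rename-on ks (ks⊆ ∘ there)) (rename (act (on ks φ) x) fresh))
      where
      one-more : ∀ {n} → n ∈ supp x → renSN k (φ k) (on ks φ n) ≡ on (k ∷ ks) φ n
      one-more {n} n∈ = split (n ∈? ks) (n ≟ k)
        where
        split : Dec (n ∈ ks) → Dec (n ≡ k) → renSN k (φ k) (on ks φ n) ≡ on (k ∷ ks) φ n
        split (yes p) _          = trans (cong (renSN k (φ k)) (on-∈ p))
          (trans (if-≢ {x = φ n} (λ e → apart n∈ (subst (_∈ supp x) (sym e) (ks⊆ (here refl)))))
                 (sym (on-∈ {k ∷ ks} (there p))))
        split (no ∉) (yes refl) = trans (cong (renSN n (φ n)) (on-∉ ∉)) (trans (if-≡ {x = n} refl) (sym (on-∈ {n ∷ ks} (here refl))))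
        split (no ∉) (no n≢k)   = trans (cong (renSN k (φ k)) (on-∉ ∉))
          (trans (if-≢ n≢k) (sym (on-∉ {k ∷ ks} (λ { (here e) → n≢k e ; (there p) → ∉ p }))))
      fresh : φ k ∉ supp (act (on ks φ) x)
      fresh p with n , n∈ , e ← ∈-map⁻ (on ks φ) (subst (φ k ∈_) (supp-act _ x) p) = split (n ∈? ks)
        where
        split : ¬ Dec (n ∈ ks)
        split (yes q) with refl ← inj (ks⊆ (here refl)) n∈ (trans e (on-∈ q)) = k∉ q
        split (no ∉)  = apart (ks⊆ (here refl)) (subst (_∈ supp x) (sym (trans e (on-∉ ∉))) n∈)

    rename-apart : x ~ act φ x
    rename-apart = subst (x ~_) (act-cong x on-∈) (rename-on (supp x) id)

  rename-injective : ∀ {φ} x → InjectiveOn (supp x) φ → x ~ act φ x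
  rename-injective {φ} x inj with M , bound ← upper-bound (supp x ++ map φ (supp x)) =
    subst (x ~_) (trans (act-∘ back up x) (act-cong x (λ {n} _ → cong φ (m+n∸n≡m n M))))
      (~-trans (rename-apart x (λ {a} {b} _ _ → +-cancelʳ-≡ M a b) up-apart)
               (rename-apart (act up x) back-inj back-apart))
    where
    -- `M` bounds the support and its image under `φ`. So `up` leaves the support, and on the
    -- shifted names `back` takes values below `M`, outside the shifted support. The truncated
    -- subtraction is exact on names of the form `n + M`.
    up back : ℕ → ℕ
    up n   = n + M
    back n = φ (n ∸ M)
    up-apart : ∀ {n} → n ∈ supp x → up n ∉ supp x
    up-apart {n} _ p = <⇒≱ (bound (∈-++⁺ˡ p)) (m≤n+m M n)
    up⁻ : ∀ {n} → n ∈ supp (act up x) → ∃ λ k → k ∈ supp x × n ≡ up k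
    up⁻ {n} p = ∈-map⁻ up (subst (n ∈_) (supp-act up x) p)
    back-inj : InjectiveOn (supp (act up x)) back
    back-inj p q e with a , a∈ , refl ← up⁻ p with b , b∈ , refl ← up⁻ q =
      cong up (inj a∈ b∈ (subst₂ (λ c d → φ c ≡ φ d) (m+n∸n≡m a M) (m+n∸n≡m b M) e))
    back-apart : ∀ {n} → n ∈ supp (act up x) → back n ∉ supp (act up x)
    back-apart p q with a , a∈ , refl ← up⁻ p with b , b∈ , e ← up⁻ q =
      <⇒≱ (bound (∈-++⁺ʳ (supp x) (∈-map⁺ φ a∈))) (subst (M ≤_) (trans (sym e) (cong φ (m+n∸n≡m a M))) (m≤n+m M b))

renSNCtx-mapCtx : ∀ A B Γ → renSNCtx A B Γ ≡ mapCtx (renSN A B) id Γ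
renSNCtx-mapCtx A B •           = refl
renSNCtx-mapCtx A B (Γ ▸ x ∶ X) = cong₂ (λ Γ σ → Γ ▸ x ∶ (renSN A B (name X) ⟨ σ ⟩)) (renSNCtx-mapCtx A B Γ) (sym (mapSub-id (args X)))

renSNSig-mapSig : ∀ A B Ψ → renSNSig A B Ψ ≡ mapSig (renSN A B) (λ _ → id) Ψ
renSNSig-mapSig A B •ˢ           = refl
renSNSig-mapSig A B (Ψ ▸ˢ C ∶ Γ) = cong₂ (_▸ˢ renSN A B C ∶_) (renSNSig-mapSig A B Ψ) (renSNCtx-mapCtx A B Γ)

renVSub-mapSub : ∀ x y σ → renVSub x y σ ≡ mapSub (renV x y) σ
renVSub-mapSub x y ε        = refl
renVSub-mapSub x y (σ ,ₛ z) = cong (_,ₛ renV x y z) (renVSub-mapSub x y σ)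

renVCtx-mapCtx : ∀ x y Γ → renVCtx x y Γ ≡ mapCtx id (renV x y) Γ
renVCtx-mapCtx x y •           = refl
renVCtx-mapCtx x y (Γ ▸ z ∶ X) = cong₂ (λ Γ σ → Γ ▸ renV x y z ∶ (name X ⟨ σ ⟩)) (renVCtx-mapCtx x y Γ) (renVSub-mapSub x y (args X))

rename-names : ∀ {φ} Ψ → InjectiveOn (sigAllSNs Ψ) φ → Ψ ≅ˢ mapSig φ (λ _ → id) Ψ
rename-names = InjectiveRenaming.rename-injective (λ φ → mapSig φ (λ _ → id)) sigAllSNs _≅ˢ_ nil _◅◅_
  (λ Ψ → mapSig-cong Ψ) mapSig-id (λ φ ψ → mapSig-∘ φ _ ψ _) (λ φ → sigAllSNs-mapSig φ _)
  (λ {A} {B} Ψ B∉ → subst (Ψ ≅ˢ_) (renSNSig-mapSig A B Ψ) (step (α-sn B∉)))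

rename-vars : ∀ {w} Γ → InjectiveOn (ctxAllVars Γ) w →
              ∀ {Ψ K Φ} → ((Ψ ▸ˢ K ∶ Γ) ++ˢ Φ) ≅ˢ ((Ψ ▸ˢ K ∶ mapCtx id w Γ) ++ˢ Φ)
rename-vars Γ inj {Ψ} {K} {Φ} = InjectiveRenaming.rename-injective (mapCtx id) ctxAllVars
  (λ Γ Γ′ → ((Ψ ▸ˢ K ∶ Γ) ++ˢ Φ) ≅ˢ ((Ψ ▸ˢ K ∶ Γ′) ++ˢ Φ)) nil _◅◅_
  (λ Γ → mapCtx-cong Γ (λ _ → refl)) mapCtx-id (λ w w′ → mapCtx-∘ id w id w′) (ctxAllVars-mapCtx id)
  (λ {x} {y} Γ y∉ → subst (λ Γ′ → ((Ψ ▸ˢ K ∶ Γ) ++ˢ Φ) ≅ˢ ((Ψ ▸ˢ K ∶ Γ′) ++ˢ Φ)) (renVCtx-mapCtx x y Γ) (step (α-var {Ψ} {Φ} y∉)))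
  Γ inj

++ˢ-shift : ∀ Ψ K Γ Φ → (Ψ ▸ˢ K ∶ Γ) ++ˢ Φ ≡ Ψ ++ˢ ((•ˢ ▸ˢ K ∶ Γ) ++ˢ Φ)
++ˢ-shift Ψ K Γ •ˢ           = refl
++ˢ-shift Ψ K Γ (Φ ▸ˢ A ∶ Δ) = cong (_▸ˢ A ∶ Δ) (++ˢ-shift Ψ K Γ Φ)

-- Variables are local to one declaration, so contexts can be renamed separately. The last one of
-- `Ψ` goes first and then joins `Φ`, which collects the finished declarations.
rename-all-vars : ∀ {v} Ψ Φ → (∀ {K Γ} → (K , Γ) ∈ sigList Ψ → InjectiveOn (ctxAllVars Γ) (v K)) →
                  (Ψ ++ˢ Φ) ≅ˢ (mapSig id v Ψ ++ˢ Φ)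
rename-all-vars •ˢ           Φ h = nil
rename-all-vars {v} (Ψ ▸ˢ K ∶ Γ) Φ h =
  rename-vars Γ (h (∈-∷ʳ⁺ (sigList Ψ))) {Ψ} {K} {Φ}
  ◅◅ subst₂ _≅ˢ_ (sym (++ˢ-shift Ψ K _ Φ)) (sym (++ˢ-shift (mapSig id v Ψ) K _ Φ))
       (rename-all-vars Ψ ((•ˢ ▸ˢ K ∶ mapCtx id (v K) Γ) ++ˢ Φ) (h ∘ ∈-++⁺ˡ))

mapSig-≅ˢ : ∀ {φ v} Ψ → InjectiveOn (sigAllSNs Ψ) φ →
            (∀ {K Γ} → (K , Γ) ∈ sigList Ψ → InjectiveOn (ctxAllVars Γ) (v K)) → Ψ ≅ˢ mapSig φ v Ψ
mapSig-≅ˢ {φ} {v} Ψ φ-inj v-inj =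
  rename-all-vars Ψ •ˢ v-inj
  ◅◅ subst (mapSig id v Ψ ≅ˢ_) (mapSig-∘ φ (λ _ → id) id v Ψ)
       (rename-names (mapSig id v Ψ) (subst (λ xs → InjectiveOn xs φ)
         (sym (trans (sigAllSNs-mapSig id v Ψ) (map-id (sigAllSNs Ψ)))) φ-inj))

-- Isomorphisms of categories

hom-view : ∀ {C a X Y} → Hom C a X Y → (a ≡ idA X × X ≡ Y) ⊎ ∃ λ f → a ≡ arr X f × (X , f , Y) ∈ mors C
hom-view (hom-id _)  = inj₁ (refl , refl)
hom-view (hom-arr p) = inj₂ (_ , refl , p)

idA-obj : ∀ {C X Y Z} → Hom C (idA X) Y Z → X ∈ objs C
idA-obj (hom-id p) = p

≅ᶜ-sym : ∀ {C D} → C ≅ᶜ D → D ≅ᶜ C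
≅ᶜ-sym i = record
  { Fo = Go ; Fm = Gm ; Go = Fo ; Gm = Fm
  ; F-hom = G-hom ; F-id = G-id ; F-comp = G-comp ; G-hom = F-hom ; G-id = F-id ; G-comp = F-comp
  ; GF-obj = FG-obj ; GF-arr = FG-arr ; FG-obj = GF-obj ; FG-arr = GF-arr
  }
  where open _≅ᶜ_ i

Fo-obj : ∀ {C D} (i : C ≅ᶜ D) {X} → X ∈ objs C → _≅ᶜ_.Fo i X ∈ objs D
Fo-obj {D = D} i p = idA-obj (subst (λ a → Hom D a _ _) (_≅ᶜ_.F-id i p) (_≅ᶜ_.F-hom i (hom-id p)))

≅ᶜ-trans : ∀ {C D E} → C ≅ᶜ D → D ≅ᶜ E → C ≅ᶜ E
≅ᶜ-trans i j = record
  { Fo = J.Fo ∘ I.Fo ; Fm = J.Fm ∘ I.Fm ; Go = I.Go ∘ J.Go ; Gm = I.Gm ∘ J.Gm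
  ; F-hom  = J.F-hom ∘ I.F-hom
  ; F-id   = λ p → trans (cong J.Fm (I.F-id p)) (J.F-id (Fo-obj i p))
  ; F-comp = λ p q → trans (cong J.Fm (I.F-comp p q)) (J.F-comp (I.F-hom p) (I.F-hom q))
  ; G-hom  = I.G-hom ∘ J.G-hom
  ; G-id   = λ p → trans (cong I.Gm (J.G-id p)) (I.G-id (Fo-obj (≅ᶜ-sym j) p))
  ; G-comp = λ p q → trans (cong I.Gm (J.G-comp p q)) (I.G-comp (J.G-hom p) (J.G-hom q))
  ; GF-obj = λ p → trans (cong I.Go (J.GF-obj (Fo-obj i p))) (I.GF-obj p)
  ; GF-arr = λ p → trans (cong I.Gm (J.GF-arr (I.F-hom p))) (I.GF-arr p)
  ; FG-obj = λ p → trans (cong J.Fo (I.FG-obj (Fo-obj (≅ᶜ-sym j) p))) (J.FG-obj p)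
  ; FG-arr = λ p → trans (cong J.Fm (I.FG-arr (J.G-hom p))) (J.FG-arr p)
  }
  where
  module I = _≅ᶜ_ i
  module J = _≅ᶜ_ j

≅ᶜ-refl : ∀ {C} → C ≅ᶜ C
≅ᶜ-refl = ≅ᶜ-identity id id (λ _ _ → refl)

arr-injective : ∀ {K K′ f f′} → arr K f ≡ arr K′ f′ → f ≡ f′
arr-injective refl = refl

nameMap : ∀ {C D} → C ≅ᶜ D → SN → Var → Var
nameMap i K f = nameOf (_≅ᶜ_.Fm i (arr K f))

-- An isomorphism keeps non-identities apart from identities: if the image of `arr K f` were an
-- identity, the inverse functor would send it to an identity, not back to `arr K f`.
Fm-mor : ∀ {C D} (i : C ≅ᶜ D) → let open _≅ᶜ_ i in ∀ {K f Y} → (K , f , Y) ∈ mors C →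
         Fm (arr K f) ≡ arr (Fo K) (nameMap i K f) × (Fo K , nameMap i K f , Fo Y) ∈ mors D
Fm-mor {C} {D} i {K} {f} {Y} p = split (hom-view (F-hom (hom-arr p)))
  where
  open _≅ᶜ_ i
  split : (Fm (arr K f) ≡ idA (Fo K) × Fo K ≡ Fo Y) ⊎ (∃ λ f′ → Fm (arr K f) ≡ arr (Fo K) f′ × (Fo K , f′ , Fo Y) ∈ mors D) →
          Fm (arr K f) ≡ arr (Fo K) (nameMap i K f) × (Fo K , nameMap i K f , Fo Y) ∈ mors D
  split (inj₂ (f′ , e , q)) = trans e (cong (arr (Fo K)) (sym (cong nameOf e))) ,
                              subst (λ z → (Fo K , z , Fo Y) ∈ mors D) (sym (cong nameOf e)) q
  split (inj₁ (e , _))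
    with () ← trans (sym (GF-arr (hom-arr p))) (trans (cong Gm e)
                (G-id (idA-obj (subst (λ a → Hom D a (Fo K) (Fo Y)) e (F-hom (hom-arr p))))))

nameMap-inverse : ∀ {C D} (i : C ≅ᶜ D) → let open _≅ᶜ_ i in ∀ {K f Y} → (K , f , Y) ∈ mors D →
                  nameMap i (Go K) (nameMap (≅ᶜ-sym i) K f) ≡ f
nameMap-inverse i p =
  cong nameOf (trans (cong Fm (sym (proj₁ (Fm-mor (≅ᶜ-sym i) p)))) (FG-arr (hom-arr p)))
  where open _≅ᶜ_ i

nameMap-injective : ∀ {C D} (i : C ≅ᶜ D) {K f f′ Y Y′} → (K , f , Y) ∈ mors C → (K , f′ , Y′) ∈ mors C →
                    nameMap i K f ≡ nameMap i K f′ → f ≡ f′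
nameMap-injective i {K} {f} {f′} p q e = arr-injective (trans (sym (GF-arr (hom-arr p)))
  (trans (cong Gm (trans (proj₁ (Fm-mor i p)) (trans (cong (arr (Fo K)) e) (sym (proj₁ (Fm-mor i q))))))
         (GF-arr (hom-arr q))))
  where open _≅ᶜ_ i

Fo-injective : ∀ {C D} (i : C ≅ᶜ D) {X Y} → X ∈ objs C → Y ∈ objs C → _≅ᶜ_.Fo i X ≡ _≅ᶜ_.Fo i Y → X ≡ Y
Fo-injective i p q e = trans (sym (GF-obj p)) (trans (cong Go e) (GF-obj q))
  where open _≅ᶜ_ i

-- Transport of orders along an isomorphism

module Transport (L L′ : FinCatData) (fic : IsFIC L) (fic′ : IsFIC L′) (i : L ≅ᶜ L′) (c : Choice L) where

  open _≅ᶜ_ i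
  open FICOrders L fic
  open Chosen c
  private
    module L′ = FICOrders L′ fic′

  nF = nameMap i
  nG = nameMap (≅ᶜ-sym i)

  m′ : SN → List Var
  m′ K′ = map (nF (Go K′)) (m (Go K′))

  m′-Fo : ∀ {K} → K ∈ objs L → m′ (Fo K) ≡ map (nF K) (m K)
  m′-Fo K∈ = cong (λ K → map (nF K) (m K)) (GF-obj K∈)

  Go-obj : ∀ {K} → K ∈ objs L′ → Go K ∈ objs L
  Go-obj = Fo-obj (≅ᶜ-sym i)

  transported : Choice L′
  transported = record
    { objOrder      = map Fo o
    ; objOrder-perm = unique-set⇒↭ (unique-map-∈ (λ p q → Fo-injective i (o⇒objs p) (o⇒objs q)) o-unique)
                        L′.objs-unique o-to o-from
    ; objOrder-ok   = o-ok
    ; morOrder      = m′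
    ; morOrder-perm = m-perm
    ; morOrder-ok   = m-ok
    }
    where
    o-to : ∀ {K} → K ∈ map Fo o → K ∈ objs L′
    o-to p with K , K∈ , refl ← ∈-map⁻ Fo p = Fo-obj i (o⇒objs K∈)
    o-from : ∀ {K} → K ∈ objs L′ → K ∈ map Fo o
    o-from p = subst (_∈ map Fo o) (FG-obj p) (∈-map⁺ Fo (objs⇒o (Go-obj p)))
    o-ok : ∀ {K K′ f} → Hom L′ (arr K′ f) K′ K → Precedes (map Fo o) K K′
    o-ok (hom-arr p) = subst₂ (Precedes (map Fo o)) (FG-obj (L′.mors-cod p)) (FG-obj (L′.mors-dom p))
      (precedes-map Fo (objOrder-ok c (hom-arr (proj₂ (Fm-mor (≅ᶜ-sym i) p)))))
    m-perm : ∀ {K} → K ∈ objs L′ → m′ K ↭ outNames L′ K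
    m-perm {K} K∈ = unique-set⇒↭
      (unique-map-∈ (λ p q → nameMap-injective i (m⇒mor (Go-obj K∈) p) (m⇒mor (Go-obj K∈) q)) (m-unique (Go-obj K∈)))
      (L′.outNames-unique K) to from
      where
      to : ∀ {f} → f ∈ m′ K → f ∈ outNames L′ K
      to p with f , f∈ , refl ← ∈-map⁻ (nF (Go K)) p =
        subst (λ K′ → nF (Go K) f ∈ outNames L′ K′) (FG-obj K∈) (∈-outNames⁺ L′ (proj₂ (Fm-mor i (m⇒mor (Go-obj K∈) f∈))))
      from : ∀ {f} → f ∈ outNames L′ K → f ∈ m′ K
      from p with Y , q ← ∈-outNames⁻ L′ p =
        subst (_∈ m′ K) (nameMap-inverse i q) (∈-map⁺ (nF (Go K)) (mor⇒m (proj₂ (Fm-mor (≅ᶜ-sym i) q))))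
    m-ok : ∀ {K f Y g Z h} → Hom L′ (arr K f) K Y → Hom L′ (arr Y g) Y Z →
           comp L′ (arr Y g) (arr K f) ≡ arr K h → Precedes (m′ K) h f
    m-ok {K} {f} {Y} {g} {Z} {h} (hom-arr p) (hom-arr q) e =
      subst₂ (Precedes (m′ K)) (nameMap-inverse i h∈) (nameMap-inverse i p)
        (precedes-map (nF (Go K)) (morOrder-ok c (hom-arr (proj₂ Gp)) (hom-arr (proj₂ Gq)) (begin
          comp L (arr (Go Y) (nG Y g)) (arr (Go K) (nG K f))  ≡⟨ cong₂ (comp L) (sym (proj₁ Gq)) (sym (proj₁ Gp)) ⟩
          comp L (Gm (arr Y g)) (Gm (arr K f))                ≡⟨ sym (G-comp (hom-arr p) (hom-arr q)) ⟩
          Gm (comp L′ (arr Y g) (arr K f))                    ≡⟨ cong Gm e ⟩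
          Gm (arr K h)                                        ≡⟨ proj₁ (Fm-mor (≅ᶜ-sym i) h∈) ⟩
          arr (Go K) (nG K h)                                 ∎)))
      where
      open ≡-Reasoning
      Gp = Fm-mor (≅ᶜ-sym i) p
      Gq = Fm-mor (≅ᶜ-sym i) q
      h∈ : (K , h , Z) ∈ mors L′
      h∈ with e′ , r ← L′.comp-mor p q = subst (λ z → (K , z , Z) ∈ mors L′) (arr-injective (trans (sym e′) e)) r

  cmpOf-nF : ∀ {K f Y p Z} → (K , f , Y) ∈ mors L → (Y , p , Z) ∈ mors L →
             cmpOf L′ (Fo K) (nF K f) (nF Y p) ≡ nF K (cmpOf L K f p)
  cmpOf-nF {K} {f} {Y} {p} a b = cong nameOf (begin
    comp L′ (arr (codOf L′ (Fo K) (nF K f)) (nF Y p)) (arr (Fo K) (nF K f))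
      ≡⟨ cong (λ A → comp L′ (arr A (nF Y p)) (arr (Fo K) (nF K f))) (L′.codOf-mor (proj₂ (Fm-mor i a))) ⟩
    comp L′ (arr (Fo Y) (nF Y p)) (arr (Fo K) (nF K f))  ≡⟨ cong₂ (comp L′) (sym (proj₁ (Fm-mor i b))) (sym (proj₁ (Fm-mor i a))) ⟩
    comp L′ (Fm (arr Y p)) (Fm (arr K f))                ≡⟨ sym (F-comp (hom-arr a) (hom-arr b)) ⟩
    Fm (comp L (arr Y p) (arr K f))                      ≡⟨ cong Fm (proj₁ (comp-mor a b)) ⟩
    Fm (arr K (cmpOf L K f p))                           ∎)
    where open ≡-Reasoning

  sortAt-nF : ∀ {K f} → K ∈ objs L → f ∈ m K → L′.sortAt m′ (Fo K) (nF K f) ≡ mapSort Fo (nF K) (sortAt m K f)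
  sortAt-nF {K} {f} K∈ f∈ = begin
    L′.sortAt m′ (Fo K) (nF K f)
      ≡⟨ cong (λ A → A ⟨ subFromList (map k (m′ A)) ⟩) (L′.codOf-mor (proj₂ (Fm-mor i p))) ⟩
    Fo Y ⟨ subFromList (map k (m′ (Fo Y))) ⟩
      ≡⟨ cong (λ l → Fo Y ⟨ subFromList (map k l) ⟩) (m′-Fo (mors-cod p)) ⟩
    Fo Y ⟨ subFromList (map k (map (nF Y) (m Y))) ⟩
      ≡⟨ cong (λ l → Fo Y ⟨ subFromList l ⟩) (trans (sym (map-∘ (m Y))) (trans
           (map-cong-∈ (m Y) (λ g∈ → cmpOf-nF p (m⇒mor (mors-cod p) g∈))) (map-∘ (m Y)))) ⟩
    Fo Y ⟨ subFromList (map (nF K) (map (cmpOf L K f) (m Y))) ⟩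
      ≡⟨ cong (Fo Y ⟨_⟩) (sym (mapSub-subFromList (nF K) (map (cmpOf L K f) (m Y)))) ⟩
    mapSort Fo (nF K) (sortAt m K f) ∎
    where
    open ≡-Reasoning
    p = m⇒mor K∈ f∈
    Y = codOf L K f
    k = cmpOf L′ (Fo K) (nF K f)

  Tᵖ-nF : ∀ {K} → K ∈ objs L → L′.Tᵖ m′ (Fo K) ≡ mapCtx Fo (nF K) (Tᵖ m K)
  Tᵖ-nF {K} K∈ = ctxList-injective (begin
    ctxList (L′.Tᵖ m′ (Fo K))                              ≡⟨ ctxList-ctxFromList (map (L′.declAt m′ (Fo K)) (m′ (Fo K))) ⟩
    map (L′.declAt m′ (Fo K)) (m′ (Fo K))                  ≡⟨ cong (map (L′.declAt m′ (Fo K))) (m′-Fo K∈) ⟩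
    map (L′.declAt m′ (Fo K)) (map (nF K) (m K))           ≡⟨ sym (map-∘ (m K)) ⟩
    map (λ f → L′.declAt m′ (Fo K) (nF K f)) (m K)         ≡⟨ map-cong-∈ (m K) (λ f∈ → cong (_ ,_) (sortAt-nF K∈ f∈)) ⟩
    map (d ∘ declAt m K) (m K)                             ≡⟨ map-∘ (m K) ⟩
    map d (map (declAt m K) (m K))                         ≡⟨ cong (map d) (sym (ctxList-ctxFromList (map (declAt m K) (m K)))) ⟩
    map d (ctxList (Tᵖ m K))                               ≡⟨ sym (ctxList-mapCtx Fo (nF K) (Tᵖ m K)) ⟩
    ctxList (mapCtx Fo (nF K) (Tᵖ m K))                    ∎)
    where
    open ≡-Reasoning
    d : Var × Sort → Var × Sort
    d p = nF K (proj₁ p) , mapSort Fo (nF K) (proj₂ p)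

  S-transported : S L′ transported ≡ mapSig Fo nF (S L c)
  S-transported = sigList-injective (begin
    sigList (L′.Sᵖ (map Fo o) m′)                     ≡⟨ L′.sigList-Sᵖ (map Fo o) m′ ⟩
    map (λ K → K , L′.Tᵖ m′ K) (map Fo o)             ≡⟨ sym (map-∘ o) ⟩
    map (λ K → Fo K , L′.Tᵖ m′ (Fo K)) o              ≡⟨ map-cong-∈ o (λ K∈ → cong (_ ,_) (Tᵖ-nF (o⇒objs K∈))) ⟩
    map (λ K → d (K , Tᵖ m K)) o                      ≡⟨ map-∘ o ⟩
    map d (map (λ K → K , Tᵖ m K) o)                  ≡⟨ cong (map d) (sym (sigList-Sᵖ o m)) ⟩
    map d (sigList (Sᵖ o m))                          ≡⟨ sym (sigList-mapSig Fo nF (Sᵖ o m)) ⟩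
    sigList (mapSig Fo nF (Sᵖ o m))                   ∎)
    where
    open ≡-Reasoning
    d : SN × Ctx → SN × Ctx
    d p = Fo (proj₁ p) , mapCtx Fo (nF (proj₁ p)) (proj₂ p)

  entry⁻ : ∀ {K Γ} → (K , Γ) ∈ sigList (S L c) → K ∈ objs L × Γ ≡ Tᵖ m K
  entry⁻ {K} {Γ} p with K , K∈ , refl ← ∈-map⁻ (λ K → K , Tᵖ m K) (subst ((K , Γ) ∈_) (sigList-Sᵖ o m) p) = o⇒objs K∈ , refl

  -- `Fo` is injective on objects only, and `nF K` on morphisms out of `K` only. This lemma and the
  -- next check that the names used in `S L c` stay within these ranges.
  names⊆objs : ∀ {A} → A ∈ sigAllSNs (S L c) → A ∈ objs L
  names⊆objs {A} p
    with (K , Γ) , q , r ← find (∈-concatMap⁻ (λ p → proj₁ p ∷ ctxSNs (proj₂ p)) {xs = sigList (S L c)} p)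
    with K∈ , refl ← entry⁻ q
    with r
  ... | here refl = K∈
  ... | there s with f , f∈ , refl ← ∈-map⁻ (codOf L K) (subst (A ∈_) (ctxSNs-decls m K (m K)) s) = mors-cod (m⇒mor K∈ f∈)

  vars⊆mors : ∀ {K x} → K ∈ objs L → x ∈ ctxAllVars (Tᵖ m K) → ∃ λ Y → (K , x , Y) ∈ mors L
  vars⊆mors {K} {x} K∈ p
    with d , q , r ← find (∈-concatMap⁻ (λ p → proj₁ p ∷ sortVars (proj₂ p)) {xs = ctxList (Tᵖ m K)} p)
    with f , f∈ , refl ← ∈-map⁻ (declAt m K) (subst (d ∈_) (ctxList-ctxFromList (map (declAt m K) (m K))) q)
    with s ← m⇒mor K∈ f∈
    with r
  ... | here refl = _ , s
  ... | there t
    with g , g∈ , refl ← ∈-map⁻ (cmpOf L K f) (subst (x ∈_) (subList-subFromList (map (cmpOf L K f) (m (codOf L K f)))) t)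
    = _ , proj₂ (comp-mor s (m⇒mor (mors-cod s) g∈))

  S≅transported : S L c ≅ˢ S L′ transported
  S≅transported = subst (S L c ≅ˢ_) (sym S-transported) (mapSig-≅ˢ (S L c)
    (λ p q → Fo-injective i (names⊆objs p) (names⊆objs q))
    v-inj)
    where
    v-inj : ∀ {K Γ} → (K , Γ) ∈ sigList (S L c) → InjectiveOn (ctxAllVars Γ) (nF K)
    v-inj p q r with K∈ , refl ← entry⁻ p = nameMap-injective i (proj₂ (vars⊆mors K∈ q)) (proj₂ (vars⊆mors K∈ r))

S-resp-≅ : ∀ L L′ → IsFIC L → IsFIC L′ → L ≅ᶜ L′ → (c : Choice L) (c′ : Choice L′) → S L c ≅ˢ S L′ c′
S-resp-≅ L L′ fic fic′ i c c′ = S≅transported ◅◅ Reorder.S-independent L′ fic′ transported c′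
  where open Transport L L′ fic fic′ i c

S∘R≅ : ∀ Ψ → SigOK Ψ → (c : Choice (R Ψ)) → S (R Ψ) c ≅ˢ Ψ
S∘R≅ Ψ Ψ-ok c = subst (S (R Ψ) c ≅ˢ_) S-declared (Reorder.S-independent (R Ψ) R-fic c declared)
  where open WellFormed Ψ Ψ-ok

-- Invariance of R under isomorphism of signatures

Linked : Sig → Sig → Set
Linked Ψ Ψ′ = SigOK Ψ′ × R Ψ ≅ᶜ R Ψ′

-- Well-formedness of Ψ′ is never checked syntactically: it suffices to exhibit Ψ′ as
-- the signature of a category isomorphic to R Ψ.
linked-by : ∀ {Ψ Ψ′ L} → IsFIC L → R Ψ ≅ᶜ L → (c : Choice L) → S L c ≡ Ψ′ → Linked Ψ Ψ′
linked-by fic i c refl = FICOrders.Chosen.S-ok _ fic c , ≅ᶜ-trans i (≅ᶜ-sym (RS.R∘S≅ _ fic c))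

sigList-split₂ : ∀ Ψ {A Γ B Δ} Φ → sigList (((Ψ ▸ˢ A ∶ Γ) ▸ˢ B ∶ Δ) ++ˢ Φ) ≡ sigList Ψ ++ (A , Γ) ∷ (B , Δ) ∷ sigList Φ
sigList-split₂ Ψ {A} {Γ} {B} {Δ} Φ = trans (sigList-++ˢ ((Ψ ▸ˢ A ∶ Γ) ▸ˢ B ∶ Δ) Φ)
  (trans (++-assoc (sigList Ψ ∷ʳ (A , Γ)) _ (sigList Φ)) (++-assoc (sigList Ψ) _ _))

sigList-split : ∀ Ψ {K Γ} Φ → sigList ((Ψ ▸ˢ K ∶ Γ) ++ˢ Φ) ≡ sigList Ψ ++ (K , Γ) ∷ sigList Φ
sigList-split Ψ {K} {Γ} Φ = trans (sigList-++ˢ (Ψ ▸ˢ K ∶ Γ) Φ) (++-assoc (sigList Ψ) _ (sigList Φ))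

ctxList-split₂ : ∀ Γ {x X y Y} Δ → ctxList (((Γ ▸ x ∶ X) ▸ y ∶ Y) ++ᶜ Δ) ≡ ctxList Γ ++ (x , X) ∷ (y , Y) ∷ ctxList Δ
ctxList-split₂ Γ {x} {X} {y} {Y} Δ = trans (ctxList-++ᶜ ((Γ ▸ x ∶ X) ▸ y ∶ Y) Δ)
  (trans (++-assoc (ctxList Γ ∷ʳ (x , X)) _ (ctxList Δ)) (++-assoc (ctxList Γ) _ _))

-- The category `R Ψ₁` is kept and two neighbours of its object order are exchanged. The entries are
-- the same on both sides, so every context is still the declared one.
sig-swap-linked : ∀ {Ψ Φ A B Γ Δ} → A ∉ ctxSNs Δ → SigOK (((Ψ ▸ˢ A ∶ Γ) ▸ˢ B ∶ Δ) ++ˢ Φ) →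
                  Linked (((Ψ ▸ˢ A ∶ Γ) ▸ˢ B ∶ Δ) ++ˢ Φ) (((Ψ ▸ˢ B ∶ Δ) ▸ˢ A ∶ Γ) ++ˢ Φ)
sig-swap-linked {Ψ} {Φ} {A} {B} {Γ} {Δ} A∉ ok = linked-by R-fic ≅ᶜ-refl swapped
  (trans (cong (λ o → Sᵖ o varsOf) (sym names₂)) (Sᵖ-of-entries varsOf Ψ₂ (declared-ctx ∘ entries)))
  where
  Ψ₁ Ψ₂ : Sig
  Ψ₁ = ((Ψ ▸ˢ A ∶ Γ) ▸ˢ B ∶ Δ) ++ˢ Φ
  Ψ₂ = ((Ψ ▸ˢ B ∶ Δ) ▸ˢ A ∶ Γ) ++ˢ Φ
  open WellFormed Ψ₁ ok
  open FICOrders (R Ψ₁) R-fic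
  open Chosen declared
  us = sigNames Ψ
  vs = sigNames Φ
  names₁ : sigNames Ψ₁ ≡ us ++ A ∷ B ∷ vs
  names₁ = trans (cong (map proj₁) (sigList-split₂ Ψ Φ)) (map-++ proj₁ (sigList Ψ) _)
  names₂ : sigNames Ψ₂ ≡ us ++ B ∷ A ∷ vs
  names₂ = trans (cong (map proj₁) (sigList-split₂ Ψ Φ)) (map-++ proj₁ (sigList Ψ) _)
  entries : ∀ {d} → d ∈ sigList Ψ₂ → d ∈ sigList Ψ₁
  entries {d} = subst (d ∈_) (sym (sigList-split₂ Ψ Φ)) ∘ ∈-resp-↭ (++⁺ˡ (sigList Ψ) (swap _ _ ↭-refl))
              ∘ subst (d ∈_) (sigList-split₂ Ψ Φ)
  A⊀B : ¬ (A ≺ B)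
  A⊀B (f , p)
    with Δ′ , X , q , r , refl ← R-mor⁻ Ψ₁ p
    with refl ← entry-unique q (subst ((B , Δ) ∈_) (sym (sigList-split₂ Ψ Φ)) (∈-++⁺ʳ (sigList Ψ) (there (here refl))))
    = A∉ (∈-map⁺ (λ p → name (proj₂ p)) r)
  swapped : Choice (R Ψ₁)
  swapped = mkChoice (us ++ B ∷ A ∷ vs)
    (↭-trans (++⁺ˡ us (swap _ _ ↭-refl)) (↭-reflexive (sym names₁)))
    (ObjLin.swap-linExt us A⊀B (subst ObjLin.LinExt names₁ o-linExt))
    varsOf (morOrder-perm declared) m-linExt

ctx-swap-linked : ∀ {Ψ Φ K Γ Δ x y X Y} → x ∉ sortVars Y →
                  SigOK ((Ψ ▸ˢ K ∶ (((Γ ▸ x ∶ X) ▸ y ∶ Y) ++ᶜ Δ)) ++ˢ Φ) →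
                  Linked ((Ψ ▸ˢ K ∶ (((Γ ▸ x ∶ X) ▸ y ∶ Y) ++ᶜ Δ)) ++ˢ Φ)
                         ((Ψ ▸ˢ K ∶ (((Γ ▸ y ∶ Y) ▸ x ∶ X) ++ᶜ Δ)) ++ˢ swapArgsSig K (ctxLen Γ) Φ)
ctx-swap-linked {Ψ} {Φ} {K} {Γ} {Δ} {x} {y} {X} {Y} x∉ ok = linked-by R-fic ≅ᶜ-refl swapped (begin
  Sᵖ (sigNames Ψ₁) m′
    ≡⟨ Reorder.Sᵖ-ctx-swap (R Ψ₁) R-fic declared {varsOf} {m′} ps (morOrder-perm declared) K∈ names₁ mK (update-≡ varsOf K)
         (λ ≢K → sym (update-≢ varsOf ≢K)) ⟩
  (Sᵖ us varsOf ▸ˢ K ∶ (((Dc ps ▸ y ∶ sortAt varsOf K y) ▸ x ∶ sortAt varsOf K x) ++ᶜ Dc qs))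
    ++ˢ swapArgsSig K (ctxLen (Dc ps)) (Sᵖ vs varsOf)
    ≡⟨ cong₂ (λ Γ′ Δ′ → (Sᵖ us varsOf ▸ˢ K ∶ (((Γ′ ▸ y ∶ sortAt varsOf K y) ▸ x ∶ sortAt varsOf K x) ++ᶜ Δ′))
                ++ˢ swapArgsSig K (ctxLen Γ′) (Sᵖ vs varsOf))
             (decls Γ (∈-++⁺ˡ)) (decls Δ (λ p → ∈-++⁺ʳ (ctxList Γ) (there (there p)))) ⟩
  (Sᵖ us varsOf ▸ˢ K ∶ (((Γ ▸ y ∶ sortAt varsOf K y) ▸ x ∶ sortAt varsOf K x) ++ᶜ Δ))
    ++ˢ swapArgsSig K (ctxLen Γ) (Sᵖ vs varsOf)
    ≡⟨ cong₂ (λ Y′ X′ → (Sᵖ us varsOf ▸ˢ K ∶ (((Γ ▸ y ∶ Y′) ▸ x ∶ X′) ++ᶜ Δ)) ++ˢ swapArgsSig K (ctxLen Γ) (Sᵖ vs varsOf))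
             (declared-sort Γ₁∈ y∈) (declared-sort Γ₁∈ x∈) ⟩
  (Sᵖ us varsOf ▸ˢ K ∶ (((Γ ▸ y ∶ Y) ▸ x ∶ X) ++ᶜ Δ)) ++ˢ swapArgsSig K (ctxLen Γ) (Sᵖ vs varsOf)
    ≡⟨ cong₂ (λ Ψ′ Φ′ → (Ψ′ ▸ˢ K ∶ (((Γ ▸ y ∶ Y) ▸ x ∶ X) ++ᶜ Δ)) ++ˢ swapArgsSig K (ctxLen Γ) Φ′)
             (Sᵖ-of-entries varsOf Ψ (λ p → declared-ctx (subst (_ ∈_) (sym (sigList-split Ψ Φ)) (∈-++⁺ˡ p))))
             (Sᵖ-of-entries varsOf Φ (λ p → declared-ctx (subst (_ ∈_) (sym (sigList-split Ψ Φ)) (∈-++⁺ʳ (sigList Ψ) (there p))))) ⟩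
  (Ψ ▸ˢ K ∶ (((Γ ▸ y ∶ Y) ▸ x ∶ X) ++ᶜ Δ)) ++ˢ swapArgsSig K (ctxLen Γ) Φ ∎)
  where
  open ≡-Reasoning
  Γ₁ : Ctx
  Γ₁ = ((Γ ▸ x ∶ X) ▸ y ∶ Y) ++ᶜ Δ
  Ψ₁ : Sig
  Ψ₁ = (Ψ ▸ˢ K ∶ Γ₁) ++ˢ Φ
  open WellFormed Ψ₁ ok
  open FICOrders (R Ψ₁) R-fic
  open Chosen declared
  us = sigNames Ψ
  vs = sigNames Φ
  ps = ctxVars Γ
  qs = ctxVars Δ
  m′ = update varsOf K (ps ++ y ∷ x ∷ qs)
  Dc : List Var → Ctx
  Dc fs = ctxFromList (map (declAt varsOf K) fs)
  names₁ : sigNames Ψ₁ ≡ us ++ K ∷ vs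
  names₁ = trans (cong (map proj₁) (sigList-split Ψ Φ)) (map-++ proj₁ (sigList Ψ) _)
  Γ₁∈ : (K , Γ₁) ∈ sigList Ψ₁
  Γ₁∈ = subst ((K , Γ₁) ∈_) (sym (sigList-split Ψ Φ)) (∈-insert (sigList Ψ))
  K∈ : K ∈ sigNames Ψ₁
  K∈ = ∈-map⁺ proj₁ Γ₁∈
  in-Γ₁ : ∀ {d} → d ∈ ctxList Γ ++ (x , X) ∷ (y , Y) ∷ ctxList Δ → d ∈ ctxList Γ₁
  in-Γ₁ {d} = subst (d ∈_) (sym (ctxList-split₂ Γ Δ))
  x∈ : (x , X) ∈ ctxList Γ₁
  x∈ = in-Γ₁ (∈-insert (ctxList Γ))
  y∈ : (y , Y) ∈ ctxList Γ₁
  y∈ = in-Γ₁ (∈-++⁺ʳ (ctxList Γ) (there (here refl)))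
  mK : varsOf K ≡ ps ++ x ∷ y ∷ qs
  mK = trans (varsOf-entry Γ₁∈) (trans (cong (map proj₁) (ctxList-split₂ Γ Δ)) (map-++ proj₁ (ctxList Γ) _))
  decls : ∀ Θ → (∀ {d} → d ∈ ctxList Θ → d ∈ ctxList Γ ++ (x , X) ∷ (y , Y) ∷ ctxList Δ) → Dc (ctxVars Θ) ≡ Θ
  decls Θ Θ⊆ = trans (cong ctxFromList (decls-of-entries varsOf Θ (λ p → declared-sort Γ₁∈ (in-Γ₁ (Θ⊆ p))))) (ctxFromList-ctxList Θ)
  x⊀y : ¬ Factors K x y
  x⊀y (p , g , Z , q , e) = x∉ (subst (x ∈_)
    (trans (sym (subList-subFromList (map (cmpOf (R Ψ₁) K y) (varsOf (codOf (R Ψ₁) K y))))) (cong sortVars (declared-sort Γ₁∈ y∈)))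
    (subst (_∈ map (cmpOf (R Ψ₁) K y) (varsOf (codOf (R Ψ₁) K y))) e (∈-map⁺ (cmpOf (R Ψ₁) K y) (mor⇒m q))))
  swapped : Choice (R Ψ₁)
  swapped = mkChoice (sigNames Ψ₁) ↭-refl o-linExt m′
    (λ {K′} → update-elim (λ K l → K ∈ sigNames Ψ₁ → l ↭ outNames (R Ψ₁) K) varsOf K
      (λ _ → ↭-trans (++⁺ˡ ps (swap _ _ ↭-refl)) (subst (_↭ outNames (R Ψ₁) K) mK (morOrder-perm declared K∈)))
      (λ _ → morOrder-perm declared) K′)
    (λ {K′} → update-elim (λ K l → K ∈ sigNames Ψ₁ → MorLin.LinExt K l) varsOf K
      (λ _ → MorLin.swap-linExt K ps x⊀y (subst (MorLin.LinExt K) mK (m-linExt K∈))) (λ _ → m-linExt) K′)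

-- Makes a reversed `ctx-swap` a `ctx-swap` again: exchanging the arguments a second time restores
-- the later declarations.
swapAt-involutive : ∀ {A : Set} n (xs : List A) → swapAt n (swapAt n xs) ≡ xs
swapAt-involutive zero    []           = refl
swapAt-involutive zero    (_ ∷ [])     = refl
swapAt-involutive zero    (_ ∷ _ ∷ _)  = refl
swapAt-involutive (suc n) []           = refl
swapAt-involutive (suc n) (x ∷ xs)     = cong (x ∷_) (swapAt-involutive n xs)

swapArgsSort-involutive : ∀ K n X → swapArgsSort K n (swapArgsSort K n X) ≡ X
swapArgsSort-involutive K n (C ⟨ σ ⟩) with C ≟ K
... | no ≢K  = trans (cong (swapArgsSort K n) (if-≢ ≢K)) (if-≢ ≢K)
... | yes ≡K = trans (cong (swapArgsSort K n) (if-≡ ≡K)) (trans (if-≡ ≡K) (cong (C ⟨_⟩) (begin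
  subFromList (swapAt n (subList (subFromList (swapAt n (subList σ)))))  ≡⟨ cong (subFromList ∘ swapAt n) (subList-subFromList (swapAt n (subList σ))) ⟩
  subFromList (swapAt n (swapAt n (subList σ)))                          ≡⟨ cong subFromList (swapAt-involutive n (subList σ)) ⟩
  subFromList (subList σ)                                                ≡⟨ subFromList-subList σ ⟩
  σ                                                                      ∎)))
  where open ≡-Reasoning

swapArgsCtx-involutive : ∀ K n Γ → swapArgsCtx K n (swapArgsCtx K n Γ) ≡ Γ
swapArgsCtx-involutive K n •           = refl
swapArgsCtx-involutive K n (Γ ▸ x ∶ X) = cong₂ (_▸ x ∶_) (swapArgsCtx-involutive K n Γ) (swapArgsSort-involutive K n X)

swapArgsSig-involutive : ∀ K n Ψ → swapArgsSig K n (swapArgsSig K n Ψ) ≡ Ψ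
swapArgsSig-involutive K n •ˢ           = refl
swapArgsSig-involutive K n (Ψ ▸ˢ A ∶ Γ) = cong₂ (_▸ˢ A ∶_) (swapArgsSig-involutive K n Ψ) (swapArgsCtx-involutive K n Γ)

-- Relabelling a category by involutions

module Relabel (L : FinCatData) (fic : IsFIC L) (φ : SN → SN) (v : SN → Var → Var)
               (φφ : ∀ K → φ (φ K) ≡ K) (vv : ∀ K f → v K (v K f) ≡ f) where

  open FIC L fic

  -- `v` is indexed by the original domain. An arrow of the relabelled category with domain `K`
  -- comes from the domain `φ K`, hence `v (φ K)` in `inv`.
  act inv : Arr → Arr
  act (idA K)   = idA (φ K)
  act (arr K f) = arr (φ K) (v K f)
  inv (idA K)   = idA (φ K)
  inv (arr K f) = arr (φ K) (v (φ K) f)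

  inv-act : ∀ a → inv (act a) ≡ a
  inv-act (idA K)   = cong idA (φφ K)
  inv-act (arr K f) rewrite φφ K | vv K f = refl

  act-inv : ∀ a → act (inv a) ≡ a
  act-inv (idA K)   = cong idA (φφ K)
  act-inv (arr K f) = cong₂ arr (φφ K) (vv (φ K) f)

  φ-injective : ∀ {K K′} → φ K ≡ φ K′ → K ≡ K′
  φ-injective e = trans (sym (φφ _)) (trans (cong φ e) (φφ _))

  label : SN × Var × SN → SN × Var × SN
  label (K , f , Y) = φ K , v K f , φ Y

  relabelled : FinCatData
  relabelled = record
    { objs = map φ (objs L)
    ; mors = map label (mors L)
    ; comp = λ g f → act (comp L (inv g) (inv f))
    }

  hom⁺ : ∀ {a X Y} → Hom L a X Y → Hom relabelled (act a) (φ X) (φ Y)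
  hom⁺ (hom-id p)  = hom-id (∈-map⁺ φ p)
  hom⁺ (hom-arr p) = hom-arr (∈-map⁺ label p)

  hom⁻ : ∀ {a X Y} → Hom relabelled a X Y → Hom L (inv a) (φ X) (φ Y)
  hom⁻ (hom-id p) with K , q , refl ← ∈-map⁻ φ p = hom-id (subst (_∈ objs L) (sym (φφ K)) q)
  hom⁻ (hom-arr p) with (K , f , Y) , q , refl ← ∈-map⁻ label p rewrite φφ K | φφ Y | vv K f = hom-arr q

  pairs-relabelled : Unique (map (λ m → proj₁ m , proj₁ (proj₂ m)) (map label (mors L)))
  pairs-relabelled = subst Unique (trans (sym (map-∘ (mors L))) (map-∘ (mors L)))
    (Uniqueₚ.map⁺ inj mors-unique)
    where
    inj : ∀ {p q : SN × Var} → (φ (proj₁ p) , v (proj₁ p) (proj₂ p)) ≡ (φ (proj₁ q) , v (proj₁ q) (proj₂ q)) → p ≡ q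
    inj {K , f} {K′ , f′} e
      with refl ← φ-injective (cong proj₁ e)
      = cong (K ,_) (trans (sym (vv K f)) (trans (cong (v K) (cong proj₂ e)) (vv K f′)))

  relabelled-fic : IsFIC relabelled
  relabelled-fic = record
    { isCategory = record
      { objs-unique = Uniqueₚ.map⁺ φ-injective objs-unique
      ; mors-unique = pairs-relabelled
      ; mors-dom    = λ p → let _ , q , e = ∈-map⁻ label p in subst (_∈ map φ (objs L)) (sym (cong proj₁ e)) (∈-map⁺ φ (mors-dom q))
      ; mors-cod    = λ p → let _ , q , e = ∈-map⁻ label p in subst (_∈ map φ (objs L)) (sym (cong (proj₂ ∘ proj₂) e)) (∈-map⁺ φ (mors-cod q))
      ; comp-hom    = λ p q → subst₂ (Hom relabelled _) (φφ _) (φφ _) (hom⁺ (comp-hom (hom⁻ p) (hom⁻ q)))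
      ; id-left     = λ p → trans (cong act (id-left (hom⁻ p))) (act-inv _)
      ; id-right    = λ p → trans (cong act (id-right (hom⁻ p))) (act-inv _)
      ; assoc       = λ {f} {g} {h} p q r → cong act (trans (cong (comp L (inv h)) (inv-act _))
                        (trans (assoc (hom⁻ p) (hom⁻ q) (hom⁻ r)) (cong (λ a → comp L a (inv f)) (sym (inv-act _)))))
      }
    ; skeletal = λ p q e e′ → φ-injective (skeletal (hom⁻ p) (hom⁻ q)
                   (trans (sym (inv-act _)) (cong inv e)) (trans (sym (inv-act _)) (cong inv e′)))
    ; noEndo   = λ p → trans (sym (act-inv _)) (trans (cong act (noEndo (hom⁻ p))) (cong idA (φφ _)))
    }

  relabelled-≅ : L ≅ᶜ relabelled
  relabelled-≅ = record
    { Fo = φ ; Fm = act ; Go = φ ; Gm = inv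
    ; F-hom  = hom⁺
    ; F-id   = λ _ → refl
    ; F-comp = λ {f} {g} _ _ → cong act (sym (cong₂ (comp L) (inv-act g) (inv-act f)))
    ; G-hom  = hom⁻
    ; G-id   = λ _ → refl
    ; G-comp = λ _ _ → inv-act _
    ; GF-obj = λ _ → φφ _
    ; GF-arr = λ _ → inv-act _
    ; FG-obj = λ _ → φφ _
    ; FG-arr = λ _ → act-inv _
    }

mapSig-linked : ∀ {φ v} → (∀ K → φ (φ K) ≡ K) → (∀ K f → v K (v K f) ≡ f) →
                ∀ {Ψ} → SigOK Ψ → Linked Ψ (mapSig φ v Ψ)
mapSig-linked {φ} {v} φφ vv {Ψ} ok = linked-by relabelled-fic relabelled-≅ transported
  (trans S-transported (cong (mapSig φ v) S-declared))
  where
  open WellFormed Ψ ok using (R-fic; declared; S-declared)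
  open Relabel (R Ψ) R-fic φ v φφ vv
  open Transport (R Ψ) relabelled R-fic relabelled-fic relabelled-≅ declared

-- Replacing `a` by `b` is not injective on all names, but when `b` is fresh it agrees on the names
-- in use with this permutation. Being its own inverse, it treats both directions of a renaming
-- step.
transpose : ℕ → ℕ → ℕ → ℕ
transpose a b n = if n ≡ᵇ a then b else (if n ≡ᵇ b then a else n)

transpose-ren : ∀ {a b n} → n ≢ b → renSN a b n ≡ transpose a b n
transpose-ren {a} {b} {n} n≢b = cong (λ m → if n ≡ᵇ a then b else m) (sym (if-≢ {b = a} n≢b))

transpose-involutive : ∀ a b n → transpose a b (transpose a b n) ≡ n
transpose-involutive a b n with n ≟ a | n ≟ b
... | yes refl | yes refl = trans (cong (transpose n n) (if-≡ {x = n} refl)) (if-≡ {x = n} refl)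
... | yes refl | no n≢b   = trans (cong (transpose n b) (if-≡ {x = n} refl)) (trans (if-≢ {x = b} (n≢b ∘ sym)) (if-≡ {x = b} refl))
... | no n≢a   | yes refl = trans (cong (transpose a n) (trans (if-≢ n≢a) (if-≡ {x = n} refl))) (if-≡ {x = a} refl)
... | no n≢a   | no n≢b   = trans (cong (transpose a b) fixed) fixed
  where
  fixed : transpose a b n ≡ n
  fixed = trans (if-≢ n≢a) (if-≢ n≢b)

α-sn-transpose : ∀ {A B} Ψ → B ∉ sigAllSNs Ψ → renSNSig A B Ψ ≡ mapSig (transpose A B) (λ _ → id) Ψ
α-sn-transpose {A} {B} Ψ B∉ = trans (renSNSig-mapSig A B Ψ) (mapSig-cong Ψ (λ {C} C∈ → transpose-ren {A} {B} {C} (λ { refl → B∉ C∈ })))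

α-var-transpose : ∀ {x y} Γ → y ∉ ctxAllVars Γ → renVCtx x y Γ ≡ mapCtx id (transpose x y) Γ
α-var-transpose {x} {y} Γ y∉ = trans (renVCtx-mapCtx x y Γ) (mapCtx-cong Γ (λ _ → refl) (λ {z} z∈ → transpose-ren {x} {y} {z} (λ { refl → y∉ z∈ })))

mapSig-++ˢ : ∀ φ v Ψ Φ → mapSig φ v (Ψ ++ˢ Φ) ≡ mapSig φ v Ψ ++ˢ mapSig φ v Φ
mapSig-++ˢ φ v Ψ •ˢ           = refl
mapSig-++ˢ φ v Ψ (Φ ▸ˢ A ∶ Γ) = cong (_▸ˢ φ A ∶ mapCtx φ (v A) Γ) (mapSig-++ˢ φ v Ψ Φ)

mapSig-fixed : ∀ {v} Ψ → (∀ {A} → A ∈ sigNames Ψ → ∀ f → v A f ≡ f) → mapSig id v Ψ ≡ Ψ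
mapSig-fixed •ˢ           h = refl
mapSig-fixed {v} (Ψ ▸ˢ A ∶ Γ) h = cong₂ (_▸ˢ A ∶_)
  (mapSig-fixed Ψ (λ p → h (subst (_ ∈_) (sym (sigNames-∷ʳ Ψ A Γ)) (∈-++⁺ˡ p))))
  (trans (mapCtx-cong {w = v A} {w′ = id} Γ (λ _ → refl) (λ {x} _ → h (subst (A ∈_) (sym (sigNames-∷ʳ Ψ A Γ)) (∈-∷ʳ⁺ (sigNames Ψ))) x)) (mapCtx-id Γ))

transpose-vars-linked : ∀ {Ψ Φ K Γ} x y → SigOK ((Ψ ▸ˢ K ∶ Γ) ++ˢ Φ) →
                        Linked ((Ψ ▸ˢ K ∶ Γ) ++ˢ Φ) ((Ψ ▸ˢ K ∶ mapCtx id (transpose x y) Γ) ++ˢ Φ)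
transpose-vars-linked {Ψ} {Φ} {K} {Γ} x y ok =
  subst (Linked ((Ψ ▸ˢ K ∶ Γ) ++ˢ Φ)) mapped (mapSig-linked {v = v} (λ _ → refl) vv ok)
  where
  v : SN → Var → Var
  -- Only the declaration of `K` is touched; since `K` is declared once, `Ψ` and `Φ` are fixed.
  v A z = if A ≡ᵇ K then transpose x y z else z
  vv : ∀ A z → v A (v A z) ≡ z
  vv A z with A ≡ᵇ K
  ... | true  = transpose-involutive x y z
  ... | false = refl
  K∉ : K ∉ sigNames Ψ ++ sigNames Φ
  K∉ = proj₂ (unique-mid⁻ (sigNames Ψ) (subst Unique
    (trans (cong (map proj₁) (sigList-split Ψ Φ)) (map-++ proj₁ (sigList Ψ) _)) (sigOK⇒unique ok)))
  fixed : ∀ Θ → (∀ {A} → A ∈ sigNames Θ → A ∈ sigNames Ψ ++ sigNames Φ) → mapSig id v Θ ≡ Θ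
  fixed Θ Θ⊆ = mapSig-fixed Θ (λ {A} A∈ f → if-≢ {x = A} (λ { refl → K∉ (Θ⊆ A∈) }))
  mapped : mapSig id v ((Ψ ▸ˢ K ∶ Γ) ++ˢ Φ) ≡ (Ψ ▸ˢ K ∶ mapCtx id (transpose x y) Γ) ++ˢ Φ
  mapped = trans (mapSig-++ˢ id v (Ψ ▸ˢ K ∶ Γ) Φ) (cong₂ _++ˢ_
    (cong₂ (_▸ˢ K ∶_) (fixed Ψ ∈-++⁺ˡ) (mapCtx-cong {w = v K} {w′ = transpose x y} Γ (λ _ → refl) (λ _ → if-≡ {x = K} refl)))
    (fixed Φ (∈-++⁺ʳ (sigNames Ψ))))

step-linked : ∀ {Ψ Ψ′} → SigStep Ψ Ψ′ → SigOK Ψ → Linked Ψ Ψ′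
step-linked (sig-swap {Ψ} {Φ} A∉ B∉) ok = sig-swap-linked {Ψ} {Φ} A∉ ok
step-linked (ctx-swap {Ψ} {Φ} {Γ = Γ} {Δ} x∉ y∉) ok = ctx-swap-linked {Ψ} {Φ} {Γ = Γ} {Δ} x∉ ok
step-linked (α-sn {Ψ} {A} {B} B∉) ok = subst (Linked Ψ) (sym (α-sn-transpose Ψ B∉))
  (mapSig-linked (transpose-involutive A B) (λ _ _ → refl) ok)
step-linked (α-var {Ψ} {Φ} {K} {Γ} {x} {y} y∉) ok =
  subst (λ Γ′ → Linked ((Ψ ▸ˢ K ∶ Γ) ++ˢ Φ) ((Ψ ▸ˢ K ∶ Γ′) ++ˢ Φ)) (sym (α-var-transpose Γ y∉))
    (transpose-vars-linked {Ψ} {Φ} x y ok)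

-- A reversed swap is a swap with the roles of the two neighbours exchanged. A reversed renaming is
-- the same transposition applied again, once the target has been rewritten in terms of it.
step-linked⁻¹ : ∀ {Ψ Ψ′} → SigStep Ψ Ψ′ → SigOK Ψ′ → Linked Ψ′ Ψ
step-linked⁻¹ (sig-swap {Ψ} {Φ} A∉ B∉) ok = sig-swap-linked {Ψ} {Φ} B∉ ok
step-linked⁻¹ (ctx-swap {Ψ} {Φ} {K} {Γ} {Δ} {x} {y} {X} {Y} x∉ y∉) ok =
  subst (λ Φ′ → Linked ((Ψ ▸ˢ K ∶ (((Γ ▸ y ∶ Y) ▸ x ∶ X) ++ᶜ Δ)) ++ˢ swapArgsSig K (ctxLen Γ) Φ)
                       ((Ψ ▸ˢ K ∶ (((Γ ▸ x ∶ X) ▸ y ∶ Y) ++ᶜ Δ)) ++ˢ Φ′))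
    (swapArgsSig-involutive K (ctxLen Γ) Φ)
    (ctx-swap-linked {Ψ} {swapArgsSig K (ctxLen Γ) Φ} {Γ = Γ} {Δ} y∉ ok)
step-linked⁻¹ (α-sn {Ψ} {A} {B} B∉) ok
  rewrite α-sn-transpose {A} Ψ B∉
  = subst (Linked (mapSig (transpose A B) (λ _ → id) Ψ))
      (trans (mapSig-∘ (transpose A B) _ (transpose A B) _ Ψ)
        (trans (mapSig-cong Ψ (λ {C} _ → transpose-involutive A B C)) (mapSig-id Ψ)))
      (mapSig-linked (transpose-involutive A B) (λ _ _ → refl) ok)
step-linked⁻¹ (α-var {Ψ} {Φ} {K} {Γ} {x} {y} y∉) ok
  rewrite α-var-transpose {x} Γ y∉
  = subst (λ Γ′ → Linked ((Ψ ▸ˢ K ∶ mapCtx id (transpose x y) Γ) ++ˢ Φ) ((Ψ ▸ˢ K ∶ Γ′) ++ˢ Φ))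
      (trans (mapCtx-∘ id (transpose x y) id (transpose x y) Γ)
        (trans (mapCtx-cong Γ (λ _ → refl) (λ {z} _ → transpose-involutive x y z)) (mapCtx-id Γ)))
      (transpose-vars-linked {Ψ} {Φ} x y ok)

R-resp-≅ˢ : ∀ {Ψ Ψ′} → SigOK Ψ → Ψ ≅ˢ Ψ′ → R Ψ ≅ᶜ R Ψ′
R-resp-≅ˢ ok nil          = ≅ᶜ-refl
R-resp-≅ˢ ok (fwd s ◅ ss) with ok′ , i ← step-linked s ok   = ≅ᶜ-trans i (R-resp-≅ˢ ok′ ss)
R-resp-≅ˢ ok (bwd s ◅ ss) with ok′ , i ← step-linked⁻¹ s ok = ≅ᶜ-trans i (R-resp-≅ˢ ok′ ss)

theorem3p10 : ((Ψ : Sig) → SigOK Ψ → IsFIC (R Ψ))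
    × ((Ψ Ψ′ : Sig) → SigOK Ψ → SigOK Ψ′ → Ψ ≅ˢ Ψ′ → R Ψ ≅ᶜ R Ψ′)
    × ((L : FinCatData) → IsFIC L → Choice L)
    × ((L : FinCatData) → IsFIC L → (c : Choice L) → SigOK (S L c))
    × ((L L′ : FinCatData) → IsFIC L → IsFIC L′ → L ≅ᶜ L′ →
    (c : Choice L) (c′ : Choice L′) → S L c ≅ˢ S L′ c′)
    × ((Ψ : Sig) → SigOK Ψ → (c : Choice (R Ψ)) → S (R Ψ) c ≅ˢ Ψ)
    × ((L : FinCatData) → IsFIC L → (c : Choice L) → R (S L c) ≅ᶜ L)
theorem3p10 = WellFormed.R-fic
  , (λ _ _ ok _ → R-resp-≅ˢ ok)
  , FICOrders.choice
  , FICOrders.Chosen.S-ok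
  , S-resp-≅
  , S∘R≅
  , RS.R∘S≅
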